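{- Let $F$ be a finite field and let $L$ be an extension field of $F$. Let $A$ be a Sidon subspace of $L$ of finite dimension $\dim(A)\ge 3$. Then $\dim(A^2)>2\dim(A)-1$.
   Context: All dimensions are over $F$. For an $F$-subspace $A$ of $L$ and $x\in L$, $xA=\{xa: a\in A\}$, and $A^2$ is the $F$-linear span of all products $aa'$ with $a,a'\in A$. An $F$-subspace $A$ of $L$ is called a Sidon space if for every $x\in L\setminus F$ one has $\dim(A\cap xA)\le 1$. -}

module Defs where

open import Level using (0ℓ)
open import Data.Nat using (ℕ; zero; suc)
open import Data.Fin using (Fin)
open import Data.Product using (Σ; ∃; _×_; _,_)
open import Data.List using (List)
open import Data.List.Membership.Propositional using (_∈_)
open import Relation.Nullary using (¬_)
open import Relation.Binary.PropositionalEquality using (_≡_)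
open import Algebra.Structures using (IsCommutativeRing)

record Field : Set₁ where
  infixl 6 _+_
  infixl 7 _*_
  field
    Carrier : Set
    _+_ _*_ : Carrier → Carrier → Carrier
    -_      : Carrier → Carrier
    0# 1#   : Carrier
    isCommutativeRing : IsCommutativeRing _≡_ _+_ _*_ -_ 0# 1#
    0≢1     : ¬ (0# ≡ 1#)
    inv     : (x : Carrier) → ¬ (x ≡ 0#) → Σ Carrier (λ y → x * y ≡ 1#)

module _ (L : Field) where
  open Field L

  Pred : Set₁
  Pred = Carrier → Set

  record IsSubfield (F : Pred) : Set where
    field
      0∈ : F 0#
      1∈ : F 1#
      +∈ : ∀ {x y} → F x → F y → F (x + y)
      -∈ : ∀ {x} → F x → F (- x)
      *∈ : ∀ {x y} → F x → F y → F (x * y)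
      inv∈ : ∀ {x} → F x → (nz : ¬ (x ≡ 0#)) → F (Data.Product.proj₁ (inv x nz))

  IsFinite : Pred → Set
  IsFinite F = ∃ λ (xs : List Carrier) → ∀ x → F x → x ∈ xs

  lincomb : (n : ℕ) → (Fin n → Carrier) → (Fin n → Carrier) → Carrier
  lincomb zero    c v = 0#
  lincomb (suc n) c v = c Fin.zero * v Fin.zero + lincomb n (λ i → c (Fin.suc i)) (λ i → v (Fin.suc i))

  module _ (F : Pred) where

    record IsSubspace (A : Pred) : Set where
      field
        0∈ : A 0#
        +∈ : ∀ {x y} → A x → A y → A (x + y)
        ·∈ : ∀ {c x} → F c → A x → A (c * x)

    HasDim : Pred → ℕ → Set
    HasDim A n = Σ (Fin n → Carrier) λ v →
        (∀ i → A (v i))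
      × (∀ (c : Fin n → Carrier) → (∀ i → F (c i)) → lincomb n c v ≡ 0# → ∀ i → c i ≡ 0#)
      × (∀ a → A a → Σ (Fin n → Carrier) λ c → (∀ i → F (c i)) × a ≡ lincomb n c v)

    _·S_ : Carrier → Pred → Pred
    (x ·S A) y = Σ Carrier λ a → A a × y ≡ x * a

    _∩_ : Pred → Pred → Pred
    (A ∩ B) y = A y × B y

    Sq : Pred → Pred
    Sq A y = Σ ℕ λ k → Σ (Fin k → Carrier) λ c → Σ (Fin k → Carrier) λ a → Σ (Fin k → Carrier) λ a' →
        (∀ i → F (c i)) × (∀ i → A (a i)) × (∀ i → A (a' i))
      × y ≡ lincomb k c (λ i → a i * a' i)

    IsSidon : Pred → Set
    IsSidon A = ∀ x → ¬ F x → Σ ℕ λ m → HasDim (A ∩ (x ·S A)) m × (m Data.Nat.≤ 1)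

-- Suppose dim A² ≤ 2n - 1 with n = dim A, and let q = |F|. The Sidon property makes xA + yA of dimension 2n - 1
-- for independent x, y ∈ A, so A² = xA + yA, and every nonzero functional φ on A² has the property that the
-- symmetric form φ(xy) on A has a radical of dimension k(φ) ≤ 1. Two weighted counts of these coranks over all φ
-- are known. Summing φ(xy) over A × A through nontrivial characters gives Σ q^(n + k) in terms of the number of
-- solutions of xy = 0. Summing φ(x² + xw + cw²), where s² + s + c is irreducible over F, gives Σ (-q)^(n + k) in
-- terms of the number of solutions of x² + xw + cw² = 0, because φ then becomes a Hermitian form over the quadratic
-- extension of F; by the Sidon property only x = w = 0 is a solution. For k ≤ 1 the two counts and the total number
-- of functionals satisfy a linear relation, which with P = q^(n-1) reads (qP - 1)(P - q) = 0 for n even and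
-- (P - 1)² = 0 for n odd, impossible for n ≥ 3.
module Submission where

open import Defs
open import Level using (0ℓ)
open import Data.Nat as ℕ using (ℕ; zero; suc)
import Data.Nat.Properties as ℕP
open import Data.Integer as ℤ using (ℤ; -[1+_]; 0ℤ; 1ℤ)
import Data.Integer.Properties as ℤP
import Data.Integer.Tactic.RingSolver as ℤS
open import Data.Fin using (Fin; zero; suc)
import Data.Fin.Properties as FinP
open import Data.Maybe using (Maybe; just; nothing)
open import Data.Product using (Σ; ∃; _×_; _,_; proj₁; proj₂)
open import Data.Sum using (_⊎_; inj₁; inj₂; [_,_]′)
open import Data.Unit using (tt)
open import Data.Empty using (⊥; ⊥-elim)
open import Data.List using (List; []; _∷_; _++_; map; cartesianProductWith)
open import Data.List.Membership.Propositional using (_∈_)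
open import Data.List.Relation.Unary.Any as Any using (here; there)
open import Data.Vec as Vec using (Vec; []; _∷_)
open import Relation.Nullary using (¬_; Dec; yes; no)
open import Relation.Nullary.Decidable as Dec using (_×-dec_)
open import Relation.Binary.PropositionalEquality
open import Relation.Binary.PropositionalEquality.Algebra using (isMagma)
open import Relation.Binary.Definitions using (DecidableEquality; tri<; tri≈; tri>)
open import Algebra.Bundles using (CommutativeRing)
open import Algebra.Solver.Ring.AlmostCommutativeRing
  using (AlmostCommutativeRing; fromCommutativeRing; _-Raw-AlmostCommutative⟶_)
import Algebra.Solver.Ring
import Algebra.Properties.Ring
import Algebra.Properties.Semiring.Mult.TCOptimised
import Algebra.Morphism.RingMonomorphism as RingMonomorphism

-- Sums over finite types

-- No complex numbers occur: the weight q·[x = 0] - 1, which is the sum of all nontrivial additive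
-- characters at x, has integer values, so every count is an identity in ℤ. The obstacle is that
-- sums of φ(x²) over A depend on more than the corank: in odd characteristic on the discriminant,
-- in characteristic 2 on whether the form is alternating. A Hermitian form over a finite field is
-- determined by its rank, so passing to the quadratic extension leaves the corank as the only
-- unknown; the shape x² + xw + cw² does this in all characteristics at once. The corank is never
-- the dimension of a constructed subspace: one induction evaluates the norm sum together with a
-- second sum that counts the radical, and the common exponent is compared. Neither equality in L
-- nor membership in F is decidable, so F is replaced by a copy of itself on a finite index type.
-- That copy exists only up to double negation, which suffices for a decidable conclusion.

module Summation where
  open import Data.Integer using (_+_; _*_; _^_; _≤_; +≤+)

  private variable
    X Y Z : Set
    P Q : Set

  𝟙 : Dec P → ℤ
  𝟙 (yes _) = 1ℤ
  𝟙 (no _)  = 0ℤ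

  𝟙-yes : (d : Dec P) → P → 𝟙 d ≡ 1ℤ
  𝟙-yes (yes _) _ = refl
  𝟙-yes (no ¬p) p = ⊥-elim (¬p p)

  𝟙-no : (d : Dec P) → ¬ P → 𝟙 d ≡ 0ℤ
  𝟙-no (yes p) ¬p = ⊥-elim (¬p p)
  𝟙-no (no _)  _  = refl

  𝟙-nonneg : (d : Dec P) → 0ℤ ≤ 𝟙 d
  𝟙-nonneg (yes _) = +≤+ ℕ.z≤n
  𝟙-nonneg (no _)  = +≤+ ℕ.z≤n

  𝟙-⇔ : (d : Dec P) (e : Dec Q) → (P → Q) → (Q → P) → 𝟙 d ≡ 𝟙 e
  𝟙-⇔ (yes p) e f g = sym (𝟙-yes e (f p))
  𝟙-⇔ (no ¬p) e f g = sym (𝟙-no e (λ q → ¬p (g q)))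

  𝟙-× : (d : Dec P) (e : Dec Q) → 𝟙 (d ×-dec e) ≡ 𝟙 d * 𝟙 e
  𝟙-× (yes _) (yes _) = refl
  𝟙-× (yes _) (no _)  = refl
  𝟙-× (no _)  (yes _) = refl
  𝟙-× (no _)  (no _)  = refl

  ∑ : List X → (X → ℤ) → ℤ
  ∑ []       f = 0ℤ
  ∑ (x ∷ xs) f = f x + ∑ xs f

  ∑-cong : (xs : List X) {f g : X → ℤ} → (∀ x → f x ≡ g x) → ∑ xs f ≡ ∑ xs g
  ∑-cong []       e = refl
  ∑-cong (x ∷ xs) e = cong₂ _+_ (e x) (∑-cong xs e)

  ∑-zero : (xs : List X) → ∑ xs (λ _ → 0ℤ) ≡ 0ℤ
  ∑-zero []       = refl
  ∑-zero (x ∷ xs) = trans (ℤP.+-identityˡ _) (∑-zero xs)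

  ∑-+ : (xs : List X) (f g : X → ℤ) → ∑ xs (λ x → f x + g x) ≡ ∑ xs f + ∑ xs g
  ∑-+ []       f g = refl
  ∑-+ (x ∷ xs) f g = trans (cong (_+_ (f x + g x)) (∑-+ xs f g)) (shuffle (f x) (g x) (∑ xs f) (∑ xs g))
    where
    shuffle : ∀ a b c d → a + b + (c + d) ≡ a + c + (b + d)
    shuffle = ℤS.solve-∀

  ∑-*ˡ : (xs : List X) (k : ℤ) (f : X → ℤ) → ∑ xs (λ x → k * f x) ≡ k * ∑ xs f
  ∑-*ˡ []       k f = sym (ℤP.*-zeroʳ k)
  ∑-*ˡ (x ∷ xs) k f = trans (cong (_+_ (k * f x)) (∑-*ˡ xs k f)) (sym (ℤP.*-distribˡ-+ k (f x) (∑ xs f)))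

  ∑-*ʳ : (xs : List X) (k : ℤ) (f : X → ℤ) → ∑ xs (λ x → f x * k) ≡ ∑ xs f * k
  ∑-*ʳ xs k f = trans (∑-cong xs (λ x → ℤP.*-comm (f x) k)) (trans (∑-*ˡ xs k f) (ℤP.*-comm k _))

  ∑-comm : (xs : List X) (ys : List Y) (f : X → Y → ℤ) →
           ∑ xs (λ x → ∑ ys (f x)) ≡ ∑ ys (λ y → ∑ xs (λ x → f x y))
  ∑-comm []       ys f = sym (∑-zero ys)
  ∑-comm (x ∷ xs) ys f = trans (cong (_+_ (∑ ys (f x))) (∑-comm xs ys f))
                               (sym (∑-+ ys (f x) (λ y → ∑ xs (λ x → f x y))))

  ∑-mono : (xs : List X) {f g : X → ℤ} → (∀ x → f x ≤ g x) → ∑ xs f ≤ ∑ xs g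
  ∑-mono []       e = ℤP.≤-refl
  ∑-mono (x ∷ xs) e = ℤP.+-mono-≤ (e x) (∑-mono xs e)

  ∑-++ : (xs ys : List X) (f : X → ℤ) → ∑ (xs ++ ys) f ≡ ∑ xs f + ∑ ys f
  ∑-++ []       ys f = sym (ℤP.+-identityˡ _)
  ∑-++ (x ∷ xs) ys f = trans (cong (_+_ (f x)) (∑-++ xs ys f)) (sym (ℤP.+-assoc (f x) _ _))

  ∑-map : (h : X → Y) (xs : List X) (f : Y → ℤ) → ∑ (map h xs) f ≡ ∑ xs (λ x → f (h x))
  ∑-map h []       f = refl
  ∑-map h (x ∷ xs) f = cong (_+_ (f (h x))) (∑-map h xs f)

  ∑-cartesianProductWith : (h : X → Y → Z) (xs : List X) (ys : List Y) (f : Z → ℤ) →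
    ∑ (cartesianProductWith h xs ys) f ≡ ∑ xs (λ x → ∑ ys (λ y → f (h x y)))
  ∑-cartesianProductWith h []       ys f = refl
  ∑-cartesianProductWith h (x ∷ xs) ys f =
    trans (∑-++ (map (h x) ys) _ f) (cong₂ _+_ (∑-map (h x) ys f) (∑-cartesianProductWith h xs ys f))

  -- The condition on indicator sums says that elems lists every element exactly once.
  record Enumeration (X : Set) : Set where
    infix 4 _≟_
    field
      elems : List X
      _≟_   : DecidableEquality X
      ∑-δ   : ∀ a → ∑ elems (λ x → 𝟙 (x ≟ a)) ≡ 1ℤ

    ∑∈ : (X → ℤ) → ℤ
    ∑∈ = ∑ elems

    card : ℤ
    card = ∑∈ (λ _ → 1ℤ)

    ∑-const : ∀ k → ∑∈ (λ _ → k) ≡ k * card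
    ∑-const k = trans (∑-cong elems (λ _ → sym (ℤP.*-identityʳ k))) (∑-*ˡ elems k (λ _ → 1ℤ))

    ∑-δ* : ∀ a (f : X → ℤ) → ∑∈ (λ x → 𝟙 (x ≟ a) * f x) ≡ f a
    ∑-δ* a f = begin
      ∑∈ (λ x → 𝟙 (x ≟ a) * f x)  ≡⟨ ∑-cong elems step ⟩
      ∑∈ (λ x → 𝟙 (x ≟ a) * f a)  ≡⟨ ∑-*ʳ elems (f a) _ ⟩
      ∑∈ (λ x → 𝟙 (x ≟ a)) * f a  ≡⟨ cong (_* f a) (∑-δ a) ⟩
      1ℤ * f a                    ≡⟨ ℤP.*-identityˡ (f a) ⟩
      f a                         ∎
      where
      open ≡-Reasoning
      step : ∀ x → 𝟙 (x ≟ a) * f x ≡ 𝟙 (x ≟ a) * f a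
      step x with x ≟ a
      ... | yes refl = refl
      ... | no _     = refl

    member : ∀ a → a ∈ elems
    member a with Any.any? (a ≟_) elems
    ... | yes p = p
    ... | no ¬p = ⊥-elim (0≢1 (trans (sym (vanish elems ¬p)) (∑-δ a)))
      where
      0≢1 : ¬ (0ℤ ≡ 1ℤ)
      0≢1 ()
      vanish : ∀ xs → ¬ (a ∈ xs) → ∑ xs (λ x → 𝟙 (x ≟ a)) ≡ 0ℤ
      vanish []       _  = refl
      vanish (x ∷ xs) ¬m = cong₂ _+_ (𝟙-no (x ≟ a) (λ e → ¬m (here (sym e)))) (vanish xs (λ m → ¬m (there m)))

    any? : {P : X → Set} → (∀ x → Dec (P x)) → Dec (∃ P)
    any? P? with Any.any? P? elems
    ... | yes p = yes (Any.satisfied p)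
    ... | no ¬p = no λ (x , px) → ¬p (Any.map (λ { refl → px }) (member x))

    all? : {P : X → Set} → (∀ x → Dec (P x)) → Dec (∀ x → P x)
    all? P? with any? (λ x → Dec.¬? (P? x))
    ... | yes (x , ¬px) = no λ p → ¬px (p x)
    ... | no ¬∃         = yes λ x → Dec.decidable-stable (P? x) λ ¬px → ¬∃ (x , ¬px)

    nonneg-summand : (f : X → ℤ) → (∀ x → 0ℤ ≤ f x) → ∀ a → f a ≤ ∑∈ f
    nonneg-summand f f≥0 a = subst (_≤ ∑∈ f) (∑-δ* a f) (∑-mono elems bound)
      where
      bound : ∀ x → 𝟙 (x ≟ a) * f x ≤ f x
      bound x with x ≟ a
      ... | yes _ = ℤP.≤-reflexive (ℤP.*-identityˡ _)
      ... | no _  = f≥0 x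

    ∑-nonneg : (f : X → ℤ) → (∀ x → 0ℤ ≤ f x) → 0ℤ ≤ ∑∈ f
    ∑-nonneg f f≥0 = subst (_≤ ∑∈ f) (∑-zero elems) (∑-mono elems f≥0)

    -- Double counting the pairs (x , y) with y = `to x` avoids any argument about permutations of
    -- lists.
    ∑-bij : (to from : X → X) → (∀ x → from (to x) ≡ x) → (∀ x → to (from x) ≡ x) →
            ∀ f → ∑∈ (λ x → f (to x)) ≡ ∑∈ f
    ∑-bij to from ft tf f = begin
      ∑∈ (λ x → f (to x))                           ≡⟨ ∑-cong elems (λ x → sym (∑-δ* (to x) f)) ⟩
      ∑∈ (λ x → ∑∈ (λ y → 𝟙 (y ≟ to x) * f y))      ≡⟨ ∑-comm elems elems _ ⟩
      ∑∈ (λ y → ∑∈ (λ x → 𝟙 (y ≟ to x) * f y))      ≡⟨ ∑-cong elems (λ y → ∑-*ʳ elems (f y) _) ⟩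
      ∑∈ (λ y → ∑∈ (λ x → 𝟙 (y ≟ to x)) * f y)      ≡⟨ ∑-cong elems (λ y → cong (_* f y) (count y)) ⟩
      ∑∈ (λ y → 1ℤ * f y)                           ≡⟨ ∑-cong elems (λ y → ℤP.*-identityˡ (f y)) ⟩
      ∑∈ f                                          ∎
      where
      open ≡-Reasoning
      count : ∀ y → ∑∈ (λ x → 𝟙 (y ≟ to x)) ≡ 1ℤ
      count y = trans (∑-cong elems (λ x → 𝟙-⇔ (y ≟ to x) (x ≟ from y)
                        (λ { refl → sym (ft x) }) (λ { refl → sym (tf y) })))
                      (∑-δ (from y))

  open Enumeration using (elems; ∑∈; card; ∑-δ)

  _×ᵉ_ : Enumeration X → Enumeration Y → Enumeration (X × Y)
  _×ᵉ_ {X} {Y} EX EY = record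
    { elems = cartesianProductWith _,_ (elems EX) (elems EY)
    ; _≟_   = _≟′_
    ; ∑-δ   = λ (a , b) → trans (∑-cartesianProductWith _,_ (elems EX) (elems EY) _) (begin
        ∑∈ EX (λ x → ∑∈ EY (λ y → 𝟙 ((x , y) ≟′ (a , b))))     ≡⟨ ∑-cong (elems EX) (λ x → ∑-cong (elems EY) (λ y → split x y a b)) ⟩
        ∑∈ EX (λ x → ∑∈ EY (λ y → 𝟙 (x ≟₁ a) * 𝟙 (y ≟₂ b)))    ≡⟨ ∑-cong (elems EX) (λ x → trans (∑-*ˡ (elems EY) (𝟙 (x ≟₁ a)) _) (trans (cong (𝟙 (x ≟₁ a) *_) (∑-δ EY b)) (ℤP.*-identityʳ (𝟙 (x ≟₁ a))))) ⟩
        ∑∈ EX (λ x → 𝟙 (x ≟₁ a))                               ≡⟨ ∑-δ EX a ⟩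
        1ℤ                                                     ∎)
    }
    where
    open ≡-Reasoning
    open Enumeration EX using () renaming (_≟_ to _≟₁_)
    open Enumeration EY using () renaming (_≟_ to _≟₂_)
    _≟′_ : DecidableEquality (X × Y)
    (x , y) ≟′ (a , b) = Dec.map′ (λ { (refl , refl) → refl }) (λ { refl → refl , refl }) (x ≟₁ a ×-dec y ≟₂ b)
    split : ∀ x y a b → 𝟙 ((x , y) ≟′ (a , b)) ≡ 𝟙 (x ≟₁ a) * 𝟙 (y ≟₂ b)
    split x y a b with x ≟₁ a | y ≟₂ b
    ... | yes _ | yes _ = refl
    ... | yes _ | no _  = refl
    ... | no _  | yes _ = refl
    ... | no _  | no _  = refl

  -- Vectors replace functions on `Fin n` because their equality is decidable without function
  -- extensionality.
  Vecᵉ : Enumeration X → ∀ n → Enumeration (Vec X n)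
  Vecᵉ {X} E zero = record
    { elems = [] ∷ [] ; _≟_ = λ { [] [] → yes refl } ; ∑-δ = λ { [] → refl } }
  Vecᵉ {X} E (suc n) = record
    { elems = cartesianProductWith _∷_ (elems E) (elems En)
    ; _≟_   = _≟′_
    ; ∑-δ   = λ { (a ∷ as) → trans (∑-cartesianProductWith _∷_ (elems E) (elems En) _)
        (trans (∑-cong (elems E) λ x → ∑-cong (elems En) λ xs → 𝟙-⇔ ((x ∷ xs) ≟′ (a ∷ as)) (_≟ᵖ_ (x , xs) (a , as))
                  (λ { refl → refl }) (λ { refl → refl }))
        (trans (sym (∑-cartesianProductWith _,_ (elems E) (elems En) _)) (∑-δ (E ×ᵉ En) (a , as)))) }
    }
    where
    En = Vecᵉ E n
    open Enumeration (E ×ᵉ En) using () renaming (_≟_ to _≟ᵖ_)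
    _≟′_ : DecidableEquality (Vec X (suc n))
    (x ∷ xs) ≟′ (a ∷ as) = Dec.map′ (λ { refl → refl }) (λ { refl → refl }) ((x , xs) ≟ᵖ (a , as))

  ∑-× : (EX : Enumeration X) (EY : Enumeration Y) (f : X × Y → ℤ) →
        ∑∈ (EX ×ᵉ EY) f ≡ ∑∈ EX (λ x → ∑∈ EY (λ y → f (x , y)))
  ∑-× EX EY = ∑-cartesianProductWith _,_ (elems EX) (elems EY)

  ∑-∷ : (E : Enumeration X) (n : ℕ) (f : Vec X (suc n) → ℤ) →
        ∑∈ (Vecᵉ E (suc n)) f ≡ ∑∈ E (λ x → ∑∈ (Vecᵉ E n) (λ v → f (x ∷ v)))
  ∑-∷ E n = ∑-cartesianProductWith _∷_ (elems E) (elems (Vecᵉ E n))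

  card-Vec : (E : Enumeration X) (n : ℕ) → card (Vecᵉ E n) ≡ card E ^ n
  card-Vec E zero    = refl
  card-Vec E (suc n) = trans (∑-∷ E n _)
    (trans (Enumeration.∑-const E (card (Vecᵉ E n))) (trans (ℤP.*-comm (card (Vecᵉ E n)) (card E)) (cong (card E *_) (card-Vec E n))))

  -- Summed over a further variable, this bounds the size of a set by that of a family parametrising
  -- it; the parametrisation need not be injective.
  𝟙-≤-∑ : (E : Enumeration Y) (d : Dec P) {R : Y → Set} (r : ∀ y → Dec (R y)) →
          (P → ∃ R) → 𝟙 d ≤ ∑∈ E (λ y → 𝟙 (r y))
  𝟙-≤-∑ E (no _)  r _ = Enumeration.∑-nonneg E _ (λ y → 𝟙-nonneg (r y))
  𝟙-≤-∑ E (yes p) r f with f p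
  ... | y , ry = ℤP.≤-trans (ℤP.≤-reflexive (sym (𝟙-yes (r y) ry)))
                            (Enumeration.nonneg-summand E (λ y → 𝟙 (r y)) (λ y → 𝟙-nonneg (r y)) y)

  -- The same device with an exceptional case `Q` outside the parametrised family, such as the base
  -- point of a conic.
  𝟙-≤-+∑ : (E : Enumeration Y) (d : Dec P) (e : Dec Q) {R : Y → Set} (r : ∀ y → Dec (R y)) →
           (P → ¬ Q → ∃ R) → 𝟙 d ≤ 𝟙 e + ∑∈ E (λ y → 𝟙 (r y))
  𝟙-≤-+∑ E d (no ¬q) r f = subst (𝟙 d ≤_) (sym (ℤP.+-identityˡ (∑∈ E (λ y → 𝟙 (r y))))) (𝟙-≤-∑ E d r (λ p → f p ¬q))
  𝟙-≤-+∑ E (no _)  (yes _) r f = ℤP.+-mono-≤ {0ℤ} {1ℤ} (+≤+ ℕ.z≤n) (Enumeration.∑-nonneg E _ (λ y → 𝟙-nonneg (r y)))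
  𝟙-≤-+∑ E (yes _) (yes _) r f = ℤP.+-monoʳ-≤ 1ℤ (Enumeration.∑-nonneg E _ (λ y → 𝟙-nonneg (r y)))

open Summation
open Enumeration using (elems; ∑∈; card; ∑-δ)

-- Fields and vectors

module FieldTheory (𝔽 : Field) where
  open Field 𝔽 public

  commutativeRing : CommutativeRing 0ℓ 0ℓ
  commutativeRing = record { isCommutativeRing = isCommutativeRing }

  open CommutativeRing commutativeRing public
    using (+-comm; +-assoc; +-identityˡ; +-identityʳ; -‿inverseˡ; -‿inverseʳ;
           *-comm; *-assoc; *-identityˡ; *-identityʳ; zeroˡ; zeroʳ; distribˡ; distribʳ)

  private
    module S = Algebra.Properties.Semiring.Mult.TCOptimised (CommutativeRing.semiring commutativeRing)
    module RP = Algebra.Properties.Ring (CommutativeRing.ring commutativeRing)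

    -- The ring solver needs coefficients with an equality test, which the field itself (L in
    -- particular) may lack. Integers serve as coefficients, along the canonical map from ℤ.
    fromℕ : ℕ → Carrier
    fromℕ n = n S.× 1#

    fromℤ : ℤ → Carrier
    fromℤ (ℤ.+ n)    = fromℕ n
    fromℤ -[1+ n ] = - fromℕ (suc n)

    open ≡-Reasoning

    fromℤ-⊖ : ∀ m n → fromℤ (m ℤ.⊖ n) ≡ fromℕ m + - fromℕ n
    fromℤ-⊖ m zero = sym (trans (cong (fromℕ m +_) RP.-0#≈0#) (+-identityʳ _))
    fromℤ-⊖ zero (suc n) = sym (+-identityˡ _)
    fromℤ-⊖ (suc m) (suc n) = begin
      fromℤ (suc m ℤ.⊖ suc n)                      ≡⟨ cong fromℤ (ℤP.[1+m]⊖[1+n]≡m⊖n m n) ⟩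
      fromℤ (m ℤ.⊖ n)                              ≡⟨ fromℤ-⊖ m n ⟩
      fromℕ m + - fromℕ n                          ≡⟨ cong (fromℕ m +_) (sym (+-identityˡ _)) ⟩
      fromℕ m + (0# + - fromℕ n)                   ≡⟨ cong (λ z → fromℕ m + (z + - fromℕ n)) (sym (-‿inverseʳ 1#)) ⟩
      fromℕ m + ((1# + - 1#) + - fromℕ n)          ≡⟨ cong (fromℕ m +_) (+-assoc _ _ _) ⟩
      fromℕ m + (1# + (- 1# + - fromℕ n))          ≡⟨ sym (+-assoc _ _ _) ⟩
      (fromℕ m + 1#) + (- 1# + - fromℕ n)          ≡⟨ cong₂ _+_ (+-comm _ _) (RP.-‿+-comm _ _) ⟩
      (1# + fromℕ m) + - (1# + fromℕ n)            ≡⟨ cong₂ (λ a b → a + - b) (sym (S.1+× m 1#)) (sym (S.1+× n 1#)) ⟩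
      fromℕ (suc m) + - fromℕ (suc n)              ∎

    +-homo : ∀ a b → fromℤ (a ℤ.+ b) ≡ fromℤ a + fromℤ b
    +-homo (ℤ.+ m)    (ℤ.+ n)    = S.×-homo-+ 1# m n
    +-homo (ℤ.+ m)    -[1+ n ] = fromℤ-⊖ m (suc n)
    +-homo -[1+ m ] (ℤ.+ n)    = trans (fromℤ-⊖ n (suc m)) (+-comm _ _)
    +-homo -[1+ m ] -[1+ n ] = begin
      - fromℕ (suc (suc (m ℕ.+ n)))         ≡⟨ cong (λ k → - fromℕ (suc k)) (sym (ℕP.+-suc m n)) ⟩
      - fromℕ (suc m ℕ.+ suc n)             ≡⟨ cong -_ (S.×-homo-+ 1# (suc m) (suc n)) ⟩
      - (fromℕ (suc m) + fromℕ (suc n))     ≡⟨ sym (RP.-‿+-comm _ _) ⟩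
      - fromℕ (suc m) + - fromℕ (suc n)     ∎

    -‿homo : ∀ a → fromℤ (ℤ.- a) ≡ - fromℤ a
    -‿homo (ℤ.+ zero)    = sym RP.-0#≈0#
    -‿homo (ℤ.+ suc n)   = refl
    -‿homo -[1+ n ]    = sym (RP.-‿involutive _)

    *-homo⁺ : ∀ m b → fromℤ (ℤ.+ m ℤ.* b) ≡ fromℕ m * fromℤ b
    *-homo⁺ zero b = sym (zeroˡ _)
    *-homo⁺ (suc m) b = begin
      fromℤ (ℤ.+ suc m ℤ.* b)                ≡⟨ cong fromℤ (ℤP.suc-* (ℤ.+ m) b) ⟩
      fromℤ (b ℤ.+ ℤ.+ m ℤ.* b)              ≡⟨ +-homo b (ℤ.+ m ℤ.* b) ⟩
      fromℤ b + fromℤ (ℤ.+ m ℤ.* b)          ≡⟨ cong₂ _+_ (sym (*-identityˡ _)) (*-homo⁺ m b) ⟩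
      1# * fromℤ b + fromℕ m * fromℤ b     ≡⟨ sym (distribʳ _ _ _) ⟩
      (1# + fromℕ m) * fromℤ b             ≡⟨ cong (_* fromℤ b) (sym (S.1+× m 1#)) ⟩
      fromℕ (suc m) * fromℤ b              ∎

    *-homo : ∀ a b → fromℤ (a ℤ.* b) ≡ fromℤ a * fromℤ b
    *-homo (ℤ.+ m) b = *-homo⁺ m b
    *-homo -[1+ m ] b = begin
      fromℤ (-[1+ m ] ℤ.* b)          ≡⟨ cong fromℤ (sym (ℤP.neg-distribˡ-* (ℤ.+ suc m) b)) ⟩
      fromℤ (ℤ.- (ℤ.+ suc m ℤ.* b))     ≡⟨ -‿homo (ℤ.+ suc m ℤ.* b) ⟩
      - fromℤ (ℤ.+ suc m ℤ.* b)         ≡⟨ cong -_ (*-homo⁺ (suc m) b) ⟩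
      - (fromℕ (suc m) * fromℤ b)     ≡⟨ RP.-‿distribˡ-* _ _ ⟩
      - fromℕ (suc m) * fromℤ b       ∎

    acr : AlmostCommutativeRing 0ℓ 0ℓ
    acr = fromCommutativeRing commutativeRing

    morphism : CommutativeRing.rawRing ℤP.+-*-commutativeRing -Raw-AlmostCommutative⟶ acr
    morphism = record
      { ⟦_⟧ = fromℤ ; +-homo = +-homo ; *-homo = *-homo ; -‿homo = -‿homo
      ; 0-homo = refl ; 1-homo = refl }

    dec : ∀ a b → Maybe (fromℤ a ≡ fromℤ b)
    dec a b with a ℤ.≟ b
    ... | yes e = just (cong fromℤ e)
    ... | no _  = nothing

  open Algebra.Solver.Ring _ acr morphism dec public
    using (solve; con; _:+_; _:*_; :-_; _:-_; _:=_; Polynomial)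

  -- For a quadratic, having no root is irreducibility. The linear term is there for characteristic
  -- 2, where every element of a finite field is a square and s² + c always has a root.
  Irreducible : Carrier → Set
  Irreducible c = ∀ s → ¬ (s * s + s + c ≡ 0#)

  *-cancel-0 : ∀ {a b} → ¬ (a ≡ 0#) → a * b ≡ 0# → b ≡ 0#
  *-cancel-0 {a} {b} a≢0 ab≡0 with inv a a≢0
  ... | a⁻¹ , aa⁻¹≡1 = begin
    b              ≡⟨ sym (*-identityˡ b) ⟩
    1# * b         ≡⟨ cong (_* b) (sym aa⁻¹≡1) ⟩
    a * a⁻¹ * b    ≡⟨ solve 3 (λ a c b → a :* c :* b := c :* (a :* b)) refl a a⁻¹ b ⟩
    a⁻¹ * (a * b)  ≡⟨ cong (a⁻¹ *_) ab≡0 ⟩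
    a⁻¹ * 0#       ≡⟨ zeroʳ a⁻¹ ⟩
    0#             ∎

  x-y≡0⇒x≡y : ∀ {x y} → x + - y ≡ 0# → x ≡ y
  x-y≡0⇒x≡y {x} {y} e = begin
    x            ≡⟨ solve 2 (λ x y → x := (x :- y) :+ y) refl x y ⟩
    x + - y + y  ≡⟨ cong (_+ y) e ⟩
    0# + y       ≡⟨ +-identityˡ y ⟩
    y            ∎

  +-cancel-0 : ∀ {x y} → x + y ≡ y → x ≡ 0#
  +-cancel-0 {x} {y} e = begin
    x            ≡⟨ solve 2 (λ x y → x := (x :+ y) :- y) refl x y ⟩
    x + y + - y  ≡⟨ cong (_+ - y) e ⟩
    y + - y      ≡⟨ -‿inverseʳ y ⟩
    0#           ∎

-- Extracts the size of a radical from its square, the quantity that the Hermitian sum yields.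
ℤ-square-injective : ∀ {a b} → 0ℤ ℤ.≤ a → 0ℤ ℤ.≤ b → a ℤ.* a ≡ b ℤ.* b → a ≡ b
ℤ-square-injective {ℤ.+ a} {ℤ.+ b} _ _ a²≡b² = cong ℤ.+_ (ℕ-square-injective a b (ℤP.+-injective (trans (ℤP.pos-* a a) (trans a²≡b² (sym (ℤP.pos-* b b))))))
  where
  ℕ-square-injective : ∀ a b → a ℕ.* a ≡ b ℕ.* b → a ≡ b
  ℕ-square-injective a b e with ℕP.<-cmp a b
  ... | tri< a<b _ _ = ⊥-elim (ℕP.<⇒≢ (ℕP.*-mono-< a<b a<b) e)
  ... | tri≈ _ a≡b _ = a≡b
  ... | tri> _ _ b<a = ⊥-elim (ℕP.<⇒≢ (ℕP.*-mono-< b<a b<a) (sym e))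

module VectorTheory (𝔽 : Field) where
  open FieldTheory 𝔽

  infixl 6 _⊕_
  infixl 7 _⊙_

  V : ℕ → Set
  V = Vec Carrier

  _⊕_ : ∀ {n} → V n → V n → V n
  _⊕_ = Vec.zipWith _+_

  _⊙_ : ∀ {n} → Carrier → V n → V n
  t ⊙ v = Vec.map (t *_) v

  𝟎 : ∀ {n} → V n
  𝟎 {n} = Vec.replicate n 0#

  ⊕-⊙-cancel : ∀ {n} t (v u : V n) → (v ⊕ t ⊙ u) ⊕ (- t) ⊙ u ≡ v
  ⊕-⊙-cancel t []      []      = refl
  ⊕-⊙-cancel t (x ∷ v) (y ∷ u) =
    cong₂ _∷_ (solve 3 (λ t x y → (x :+ t :* y) :+ (:- t) :* y := x) refl t x y) (⊕-⊙-cancel t v u)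

  ⊕-comm : ∀ {n} (u v : V n) → u ⊕ v ≡ v ⊕ u
  ⊕-comm []      []      = refl
  ⊕-comm (x ∷ u) (y ∷ v) = cong₂ _∷_ (+-comm x y) (⊕-comm u v)

  ⊕-identityʳ : ∀ {n} (v : V n) → v ⊕ 𝟎 ≡ v
  ⊕-identityʳ []      = refl
  ⊕-identityʳ (x ∷ v) = cong₂ _∷_ (+-identityʳ x) (⊕-identityʳ v)

  ⊙-zeroʳ : ∀ {n} t → t ⊙ 𝟎 ≡ 𝟎 {n}
  ⊙-zeroʳ {zero}  t = refl
  ⊙-zeroʳ {suc n} t = cong₂ _∷_ (zeroʳ t) (⊙-zeroʳ t)

  ⊙-zeroˡ : ∀ {n} (v : V n) → 0# ⊙ v ≡ 𝟎
  ⊙-zeroˡ []      = refl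
  ⊙-zeroˡ (x ∷ v) = cong₂ _∷_ (zeroˡ x) (⊙-zeroˡ v)

  ⊙-identity : ∀ {n} (v : V n) → 1# ⊙ v ≡ v
  ⊙-identity []      = refl
  ⊙-identity (x ∷ v) = cong₂ _∷_ (*-identityˡ x) (⊙-identity v)

  ⊙-distribˡ : ∀ {n} t (u v : V n) → t ⊙ (u ⊕ v) ≡ t ⊙ u ⊕ t ⊙ v
  ⊙-distribˡ t []      []      = refl
  ⊙-distribˡ t (x ∷ u) (y ∷ v) = cong₂ _∷_ (distribˡ t x y) (⊙-distribˡ t u v)

  ⊙-assoc : ∀ {n} s t (v : V n) → s ⊙ (t ⊙ v) ≡ (s * t) ⊙ v
  ⊙-assoc s t []      = refl
  ⊙-assoc s t (x ∷ v) = cong₂ _∷_ (sym (*-assoc s t x)) (⊙-assoc s t v)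

  dot : ∀ {n} → V n → V n → Carrier
  dot []      []      = 0#
  dot (x ∷ u) (y ∷ v) = x * y + dot u v

  dot-⊕ˡ : ∀ {n} (u v w : V n) → dot (u ⊕ v) w ≡ dot u w + dot v w
  dot-⊕ˡ []      []      []      = sym (+-identityˡ 0#)
  dot-⊕ˡ (x ∷ u) (y ∷ v) (z ∷ w) = trans (cong ((x + y) * z +_) (dot-⊕ˡ u v w))
    (solve 5 (λ x y z a b → (x :+ y) :* z :+ (a :+ b) := (x :* z :+ a) :+ (y :* z :+ b)) refl
       x y z (dot u w) (dot v w))

  dot-⊙ˡ : ∀ {n} t (u v : V n) → dot (t ⊙ u) v ≡ t * dot u v
  dot-⊙ˡ t []      []      = sym (zeroʳ t)
  dot-⊙ˡ t (x ∷ u) (y ∷ v) = trans (cong (t * x * y +_) (dot-⊙ˡ t u v))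
    (solve 4 (λ t x y a → t :* x :* y :+ t :* a := t :* (x :* y :+ a)) refl t x y (dot u v))

  dot-comm : ∀ {n} (u v : V n) → dot u v ≡ dot v u
  dot-comm []      []      = refl
  dot-comm (x ∷ u) (y ∷ v) = cong₂ _+_ (*-comm x y) (dot-comm u v)

  dot-⊕ʳ : ∀ {n} (u v w : V n) → dot u (v ⊕ w) ≡ dot u v + dot u w
  dot-⊕ʳ u v w = trans (dot-comm u (v ⊕ w)) (trans (dot-⊕ˡ v w u) (cong₂ _+_ (dot-comm v u) (dot-comm w u)))

  dot-⊙ʳ : ∀ {n} t (u v : V n) → dot u (t ⊙ v) ≡ t * dot u v
  dot-⊙ʳ t u v = trans (dot-comm u (t ⊙ v)) (trans (dot-⊙ˡ t v u) (cong (t *_) (dot-comm v u)))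

  dot-𝟎ˡ : ∀ {n} (v : V n) → dot 𝟎 v ≡ 0#
  dot-𝟎ˡ []      = refl
  dot-𝟎ˡ (x ∷ v) = trans (cong₂ _+_ (zeroˡ x) (dot-𝟎ˡ v)) (+-identityˡ 0#)

  dot-𝟎ʳ : ∀ {n} (v : V n) → dot v 𝟎 ≡ 0#
  dot-𝟎ʳ v = trans (dot-comm v 𝟎) (dot-𝟎ˡ v)

-- Additive character sums over a finite field

module FiniteFieldTheory (𝔽 : Field) (E : Enumeration (Field.Carrier 𝔽)) where
  open FieldTheory 𝔽 public
  open VectorTheory 𝔽 public
  open Enumeration E public using (_≟_)

  q : ℤ
  q = card E

  ∑F : (Carrier → ℤ) → ℤ
  ∑F = ∑∈ E

  ∑V : ∀ {n} → (V n → ℤ) → ℤ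
  ∑V {n} = ∑∈ (Vecᵉ E n)

  ∑V-const : ∀ {n} k → ∑V {n} (λ _ → k) ≡ k ℤ.* q ℤ.^ n
  ∑V-const {n} k = trans (Enumeration.∑-const (Vecᵉ E n) k) (cong (k ℤ.*_) (card-Vec E n))

  2≤q : ℤ.+ 2 ℤ.≤ q
  2≤q = subst (ℤ._≤ q) two (∑-mono (elems E) bound)
    where
    two : ∑F (λ x → 𝟙 (x ≟ 0#) ℤ.+ 𝟙 (x ≟ 1#)) ≡ ℤ.+ 2
    two = trans (∑-+ (elems E) _ _) (cong₂ ℤ._+_ (∑-δ E 0#) (∑-δ E 1#))
    bound : ∀ x → 𝟙 (x ≟ 0#) ℤ.+ 𝟙 (x ≟ 1#) ℤ.≤ 1ℤ
    bound x with x ≟ 0# | x ≟ 1#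
    ... | yes refl | yes 0≡1 = ⊥-elim (0≢1 0≡1)
    ... | yes _    | no _    = ℤP.≤-refl
    ... | no _     | yes _   = ℤP.≤-refl
    ... | no _     | no _    = ℤ.+≤+ ℕ.z≤n

  instance
    q-nonZero : ℤ.NonZero q
    q-nonZero = ℤ.>-nonZero (ℤP.<-≤-trans {0ℤ} (ℤ.+<+ (ℕ.s≤s ℕ.z≤n)) 2≤q)

  0<q : 0ℤ ℤ.< q
  0<q = ℤP.<-≤-trans (ℤ.+<+ (ℕ.s≤s ℕ.z≤n)) 2≤q

  0<q^ : ∀ k → 0ℤ ℤ.< q ℤ.^ k
  0<q^ zero    = ℤ.+<+ (ℕ.s≤s ℕ.z≤n)
  0<q^ (suc k) = subst (ℤ._< q ℤ.* q ℤ.^ k) (ℤP.*-zeroʳ q) (ℤP.*-monoˡ-<-pos q {{ℤ.positive 0<q}} (0<q^ k))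

  q^-nonneg : ∀ k → 0ℤ ℤ.≤ q ℤ.^ k
  q^-nonneg k = ℤP.<⇒≤ (0<q^ k)

  q^-nonZero : ∀ k → ℤ.NonZero (q ℤ.^ k)
  q^-nonZero k = ℤ.>-nonZero (0<q^ k)

  q^-mono-< : ∀ {i j} → i ℕ.< j → q ℤ.^ i ℤ.< q ℤ.^ j
  q^-mono-< {i} {suc j} (ℕ.s≤s i≤j) = ℤP.≤-<-trans (q^-mono-≤ i≤j) (subst (ℤ._< q ℤ.* q ℤ.^ j) (ℤP.*-identityˡ (q ℤ.^ j))
      (ℤP.*-monoʳ-<-pos (q ℤ.^ j) {{ℤ.positive (0<q^ j)}} 1<q))
    where
    1<q : 1ℤ ℤ.< q
    1<q = ℤP.<-≤-trans (ℤ.+<+ (ℕ.s≤s (ℕ.s≤s ℕ.z≤n))) 2≤q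
    q^-mono-≤ : ∀ {i j} → i ℕ.≤ j → q ℤ.^ i ℤ.≤ q ℤ.^ j
    q^-mono-≤ {zero} {j} ℕ.z≤n = ℤP.i<j⇒suc[i]≤j (0<q^ j)
    q^-mono-≤ {suc i} {suc j} (ℕ.s≤s i≤j) = ℤP.*-monoˡ-≤-nonNeg q {{ℤ.nonNegative (ℤP.<⇒≤ 0<q)}} (q^-mono-≤ i≤j)

  0<q-1 : 0ℤ ℤ.< q ℤ.- 1ℤ
  0<q-1 = ℤP.<-≤-trans (ℤ.+<+ (ℕ.s≤s ℕ.z≤n)) (ℤP.+-monoˡ-≤ (ℤ.- 1ℤ) 2≤q)

  q-1-nonZero : ℤ.NonZero (q ℤ.- 1ℤ)
  q-1-nonZero = ℤ.>-nonZero 0<q-1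

  -- The sum of all nontrivial additive characters of the field, evaluated at x.
  g : Carrier → ℤ
  g x = q ℤ.* 𝟙 (x ≟ 0#) ℤ.- 1ℤ

  g-0 : g 0# ≡ q ℤ.- 1ℤ
  g-0 = cong (λ z → z ℤ.- 1ℤ) (trans (cong (q ℤ.*_) (𝟙-yes (0# ≟ 0#) refl)) (ℤP.*-identityʳ q))

  ∑-g : ∑F g ≡ 0ℤ
  ∑-g = begin
    ∑F (λ x → q ℤ.* 𝟙 (x ≟ 0#) ℤ.+ ℤ.- 1ℤ)        ≡⟨ ∑-+ (elems E) _ _ ⟩
    ∑F (λ x → q ℤ.* 𝟙 (x ≟ 0#)) ℤ.+ ∑F (λ _ → ℤ.- 1ℤ) ≡⟨ cong₂ ℤ._+_ (∑-*ˡ (elems E) q _) (Enumeration.∑-const E (ℤ.- 1ℤ)) ⟩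
    q ℤ.* ∑F (λ x → 𝟙 (x ≟ 0#)) ℤ.+ ℤ.- 1ℤ ℤ.* q       ≡⟨ cong (λ z → q ℤ.* z ℤ.+ ℤ.- 1ℤ ℤ.* q) (∑-δ E 0#) ⟩
    q ℤ.* 1ℤ ℤ.+ ℤ.- 1ℤ ℤ.* q                          ≡⟨ arith q ⟩
    0ℤ                                             ∎
    where
    open ≡-Reasoning
    arith : ∀ q → q ℤ.* 1ℤ ℤ.+ ℤ.- 1ℤ ℤ.* q ≡ 0ℤ
    arith = ℤS.solve-∀

  ∑-g-affine : ∀ {d} → ¬ (d ≡ 0#) → ∀ b → ∑F (λ t → g (b + t * d)) ≡ 0ℤ
  ∑-g-affine {d} d≢0 b with inv d d≢0
  ... | d⁻¹ , dd⁻¹≡1 = trans (Enumeration.∑-bij E (λ t → b + t * d) (λ y → (y + - b) * d⁻¹) ft tf g) ∑-g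
    where
    open ≡-Reasoning
    ft : ∀ t → (b + t * d + - b) * d⁻¹ ≡ t
    ft t = begin
      (b + t * d + - b) * d⁻¹  ≡⟨ solve 4 (λ b t d e → (b :+ t :* d :- b) :* e := t :* (d :* e)) refl b t d d⁻¹ ⟩
      t * (d * d⁻¹)            ≡⟨ cong (t *_) dd⁻¹≡1 ⟩
      t * 1#                   ≡⟨ *-identityʳ t ⟩
      t                        ∎
    tf : ∀ y → b + (y + - b) * d⁻¹ * d ≡ y
    tf y = begin
      b + (y + - b) * d⁻¹ * d    ≡⟨ solve 4 (λ b y d e → b :+ (y :- b) :* e :* d := b :+ (y :- b) :* (d :* e)) refl b y d d⁻¹ ⟩
      b + (y + - b) * (d * d⁻¹)  ≡⟨ cong (λ z → b + (y + - b) * z) dd⁻¹≡1 ⟩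
      b + (y + - b) * 1#         ≡⟨ solve 2 (λ b y → b :+ (y :- b) :* con 1ℤ := y) refl b y ⟩
      y                          ∎

  -- Orthogonality of characters: f shifts by a nonzero multiple of t under the
  -- bijection τ t of the domain, so averaging over t kills the sum.
  orthogonality : {X : Set} (EX : Enumeration X) (f : X → Carrier) (τ : Carrier → X → X) (d : Carrier) →
    (∀ t x → τ (- t) (τ t x) ≡ x) → ¬ (d ≡ 0#) → (∀ t x → f (τ t x) ≡ f x + t * d) →
    ∑∈ EX (λ x → g (f x)) ≡ 0ℤ
  orthogonality EX f τ d τ-inv d≢0 shift =
    ℤP.*-cancelˡ-≡ q (∑∈ EX (λ x → g (f x))) 0ℤ (begin
      q ℤ.* ∑∈ EX (λ x → g (f x))                  ≡⟨ ℤP.*-comm q _ ⟩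
      ∑∈ EX (λ x → g (f x)) ℤ.* q                  ≡⟨ sym (Enumeration.∑-const E _) ⟩
      ∑F (λ _ → ∑∈ EX (λ x → g (f x)))             ≡⟨ ∑-cong (elems E) (λ t → sym (Enumeration.∑-bij EX (τ t) (τ (- t)) (τ-inv t) (τ-inv′ t) (λ x → g (f x)))) ⟩
      ∑F (λ t → ∑∈ EX (λ x → g (f (τ t x))))       ≡⟨ ∑-comm (elems E) (elems EX) _ ⟩
      ∑∈ EX (λ x → ∑F (λ t → g (f (τ t x))))       ≡⟨ ∑-cong (elems EX) (λ x → trans (∑-cong (elems E) (λ t → cong g (shift t x))) (∑-g-affine d≢0 (f x))) ⟩
      ∑∈ EX (λ _ → 0ℤ)                             ≡⟨ ∑-zero (elems EX) ⟩
      0ℤ                                           ≡⟨ sym (ℤP.*-zeroʳ q) ⟩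
      q ℤ.* 0ℤ                                     ∎)
    where
    open ≡-Reasoning
    τ-inv′ : ∀ t x → τ t (τ (- t) x) ≡ x
    τ-inv′ t x = trans (cong (λ s → τ s (τ (- t) x)) (solve 1 (λ t → t := :- (:- t)) refl t)) (τ-inv (- t) x)

  ∑V-translate : ∀ {n} (u : V n) t (f : V n → ℤ) → ∑V (λ v → f (v ⊕ t ⊙ u)) ≡ ∑V f
  ∑V-translate {n} u t = Enumeration.∑-bij (Vecᵉ E n) (λ v → v ⊕ t ⊙ u) (λ v → v ⊕ (- t) ⊙ u)
    (λ v → ⊕-⊙-cancel t v u)
    (λ v → trans (cong (λ s → (v ⊕ (- t) ⊙ u) ⊕ s ⊙ u) (solve 1 (λ t → t := :- (:- t)) refl t)) (⊕-⊙-cancel (- t) v u))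

  ∑V-linear-zero : ∀ {n} (f : V n → Carrier) → (∀ u v → f (u ⊕ v) ≡ f u + f v) → (∀ t u → f (t ⊙ u) ≡ t * f u) →
    ∀ u → ¬ (f u ≡ 0#) → ∑V (λ v → g (f v)) ≡ 0ℤ
  ∑V-linear-zero {n} f f-⊕ f-⊙ u fu≢0 =
    orthogonality (Vecᵉ E n) f (λ t v → v ⊕ t ⊙ u) (f u) (λ t v → ⊕-⊙-cancel t v u) fu≢0
      (λ t v → trans (f-⊕ v (t ⊙ u)) (cong (f v +_) (f-⊙ t u)))

  ∑V-kernel : ∀ {n} (f : V n → Carrier) → (∀ v → f v ≡ 0#) → ∑V (λ v → g (f v)) ≡ (q ℤ.- 1ℤ) ℤ.* q ℤ.^ n
  ∑V-kernel {n} f f≡0 = trans (∑-cong (elems (Vecᵉ E n)) (λ v → trans (cong g (f≡0 v)) g-0)) (∑V-const {n} (q ℤ.- 1ℤ))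

  dot-nondegenerate : ∀ {n} (v : V n) → ¬ (v ≡ 𝟎) → ∃ λ u → ¬ (dot u v ≡ 0#)
  dot-nondegenerate []      v≢0 = ⊥-elim (v≢0 refl)
  dot-nondegenerate (y ∷ v) v≢0 with y ≟ 0#
  ... | no y≢0 = (1# ∷ 𝟎) , λ e → y≢0 (trans (sym (trans (cong₂ _+_ (*-identityˡ y) (dot-𝟎ˡ v)) (+-identityʳ y))) e)
  ... | yes refl with dot-nondegenerate v (λ e → v≢0 (cong (0# ∷_) e))
  ...   | u , uv≢0 = (0# ∷ u) , λ e → uv≢0 (trans (sym (trans (cong (_+ dot u v) (zeroˡ 0#)) (+-identityˡ _))) e)

  infix 4 _≟ᵥ_
  _≟ᵥ_ : ∀ {n} (u v : V n) → Dec (u ≡ v)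
  _≟ᵥ_ {n} = Enumeration._≟_ (Vecᵉ E n)

  -- Only v = 0 is annihilated by every functional. After an exchange of sums, this turns a sum over
  -- all φ of g(φ(v)) into a count of the zeros v.
  ∑V-dot : ∀ {n} (v : V n) → ∑V (λ φ → g (dot φ v)) ≡ (q ℤ.- 1ℤ) ℤ.* q ℤ.^ n ℤ.* 𝟙 (v ≟ᵥ 𝟎)
  ∑V-dot {n} v with v ≟ᵥ 𝟎
  ... | yes refl = trans (∑V-kernel {n} (λ φ → dot φ 𝟎) dot-𝟎ʳ) (sym (ℤP.*-identityʳ ((q ℤ.- 1ℤ) ℤ.* q ℤ.^ n)))
  ... | no v≢0 with dot-nondegenerate v v≢0
  ...   | u , uv≢0 = trans (∑V-linear-zero (λ φ → dot φ v) (λ φ ψ → dot-⊕ˡ φ ψ v) (λ t φ → dot-⊙ˡ t φ v) u uv≢0)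
                           (sym (ℤP.*-zeroʳ ((q ℤ.- 1ℤ) ℤ.* q ℤ.^ n)))

-- The quadratic extension and Hermitian forms over it

record QuadraticExtension (𝔽 : Field) (E : Enumeration (Field.Carrier 𝔽)) : Set₁ where
  private module F = FiniteFieldTheory 𝔽 E
  field
    𝕂  : Field
    EK : Enumeration (Field.Carrier 𝕂)
  open Field 𝕂
  field
    ι          : F.Carrier → Carrier
    σ          : Carrier → Carrier
    N Tr       : Carrier → F.Carrier
    θ          : Carrier
    ι-+        : ∀ x y → ι (x F.+ y) ≡ ι x + ι y
    ι-*        : ∀ x y → ι (x F.* y) ≡ ι x * ι y
    ι-1        : ι F.1# ≡ 1#
    ι-inj      : ∀ {x y} → ι x ≡ ι y → x ≡ y
    σ-+        : ∀ z y → σ (z + y) ≡ σ z + σ y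
    σ-*        : ∀ z y → σ (z * y) ≡ σ z * σ y
    σ-σ        : ∀ z → σ (σ z) ≡ z
    σ-ι        : ∀ x → σ (ι x) ≡ ι x
    norm       : ∀ z → z * σ z ≡ ι (N z)
    trace      : ∀ z → z + σ z ≡ ι (Tr z)
    -- An element of trace 1 makes the trace surjective without a division by 2.
    Tr-θ       : Tr θ ≡ F.1#
    card-K     : card EK ≡ F.q ℤ.* F.q
    -- The source of the factor -q in the Hermitian sums: each anisotropic direction that is split
    -- off contributes one sum of this kind.
    ∑-norm     : ∀ {a} → ¬ (a ≡ F.0#) → ∀ y → ∑∈ EK (λ z → F.g (a F.* N z F.+ y)) ≡ ℤ.- F.q ℤ.* F.g y

-- F[θ]/(θ² - θ + c), a field as soon as s² + s + c has no root s in F.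
module AdjoinRoot (𝔽 : Field) (E : Enumeration (Field.Carrier 𝔽))
  (c : Field.Carrier 𝔽) (irreducible : FieldTheory.Irreducible 𝔽 c) where
  open FiniteFieldTheory 𝔽 E

  -- The pair `(x , w)` stands for x + wθ. The conjugate of θ is 1 - θ and its norm is c, so N(x +
  -- wθ) = x² + xw + cw² is the quadratic form that is summed over A × A.
  K : Set
  K = Carrier × Carrier

  infixl 6 _+ᴷ_
  infixl 7 _*ᴷ_

  _+ᴷ_ _*ᴷ_ : K → K → K
  (x , w) +ᴷ (x′ , w′) = x + x′ , w + w′
  (x , w) *ᴷ (x′ , w′) = x * x′ + - (c * (w * w′)) , x * w′ + w * x′ + w * w′

  -ᴷ_ σ : K → K
  -ᴷ (x , w) = - x , - w
  σ (x , w) = x + w , - w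

  ι : Carrier → K
  ι x = x , 0#

  N Tr : K → Carrier
  N (x , w) = x * x + x * w + c * (w * w)
  Tr (x , w) = x + x + w

  private
    0ₚ : ∀ {n} → Polynomial n
    0ₚ = con 0ℤ

  *ᴷ-assoc : ∀ z y u → (z *ᴷ y) *ᴷ u ≡ z *ᴷ (y *ᴷ u)
  *ᴷ-assoc (x , w) (x′ , w′) (x″ , w″) = cong₂ _,_
    (solve 7 (λ c x w x′ w′ x″ w″ →
       (x :* x′ :- c :* (w :* w′)) :* x″ :- c :* ((x :* w′ :+ w :* x′ :+ w :* w′) :* w″) :=
       x :* (x′ :* x″ :- c :* (w′ :* w″)) :- c :* (w :* (x′ :* w″ :+ w′ :* x″ :+ w′ :* w″))) refl c x w x′ w′ x″ w″)
    (solve 7 (λ c x w x′ w′ x″ w″ →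
       (x :* x′ :- c :* (w :* w′)) :* w″ :+ (x :* w′ :+ w :* x′ :+ w :* w′) :* x″ :+ (x :* w′ :+ w :* x′ :+ w :* w′) :* w″ :=
       x :* (x′ :* w″ :+ w′ :* x″ :+ w′ :* w″) :+ w :* (x′ :* x″ :- c :* (w′ :* w″)) :+ w :* (x′ :* w″ :+ w′ :* x″ :+ w′ :* w″))
      refl c x w x′ w′ x″ w″)

  *ᴷ-comm : ∀ z y → z *ᴷ y ≡ y *ᴷ z
  *ᴷ-comm (x , w) (x′ , w′) = cong₂ _,_
    (solve 5 (λ c x w x′ w′ → x :* x′ :- c :* (w :* w′) := x′ :* x :- c :* (w′ :* w)) refl c x w x′ w′)
    (solve 4 (λ x w x′ w′ → x :* w′ :+ w :* x′ :+ w :* w′ := x′ :* w :+ w′ :* x :+ w′ :* w) refl x w x′ w′)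

  *ᴷ-identityˡ : ∀ z → (1# , 0#) *ᴷ z ≡ z
  *ᴷ-identityˡ (x , w) = cong₂ _,_
    (solve 3 (λ c x w → con 1ℤ :* x :- c :* (0ₚ :* w) := x) refl c x w)
    (solve 2 (λ x w → con 1ℤ :* w :+ 0ₚ :* x :+ 0ₚ :* w := w) refl x w)

  *ᴷ-distribˡ : ∀ z y u → z *ᴷ (y +ᴷ u) ≡ z *ᴷ y +ᴷ z *ᴷ u
  *ᴷ-distribˡ (x , w) (x′ , w′) (x″ , w″) = cong₂ _,_
    (solve 7 (λ c x w x′ w′ x″ w″ → x :* (x′ :+ x″) :- c :* (w :* (w′ :+ w″)) :=
       (x :* x′ :- c :* (w :* w′)) :+ (x :* x″ :- c :* (w :* w″))) refl c x w x′ w′ x″ w″)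
    (solve 6 (λ x w x′ w′ x″ w″ → x :* (w′ :+ w″) :+ w :* (x′ :+ x″) :+ w :* (w′ :+ w″) :=
       (x :* w′ :+ w :* x′ :+ w :* w′) :+ (x :* w″ :+ w :* x″ :+ w :* w″)) refl x w x′ w′ x″ w″)

  ι-* : ∀ a b → ι (a * b) ≡ ι a *ᴷ ι b
  ι-* a b = cong₂ _,_ (solve 3 (λ c a b → a :* b := a :* b :- c :* (0ₚ :* 0ₚ)) refl c a b)
                      (solve 2 (λ a b → 0ₚ := a :* 0ₚ :+ 0ₚ :* b :+ 0ₚ :* 0ₚ) refl a b)

  norm : ∀ z → z *ᴷ σ z ≡ ι (N z)
  norm (x , w) = cong₂ _,_
    (solve 3 (λ c x w → x :* (x :+ w) :- c :* (w :* (:- w)) := x :* x :+ x :* w :+ c :* (w :* w)) refl c x w)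
    (solve 2 (λ x w → x :* (:- w) :+ w :* (x :+ w) :+ w :* (:- w) := 0ₚ) refl x w)

  -- For w ≠ 0 the norm is w² times the value of s² + s + c at s = x / w.
  N≡0⇒0 : ∀ z → N z ≡ 0# → z ≡ (0# , 0#)
  N≡0⇒0 (x , w) e with w ≟ 0#
  ... | yes refl = cong (_, 0#) (x≡0 (trans (solve 2 (λ c x → x :* x := x :* x :+ x :* 0ₚ :+ c :* (0ₚ :* 0ₚ)) refl c x) e))
    where
    x≡0 : x * x ≡ 0# → x ≡ 0#
    x≡0 x²≡0 with x ≟ 0#
    ... | yes x≡0 = x≡0
    ... | no x≢0  = *-cancel-0 x≢0 x²≡0
  ... | no w≢0 with inv w w≢0
  ...   | w⁻¹ , ww⁻¹≡1 = ⊥-elim (irreducible (x * w⁻¹) (begin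
      x * w⁻¹ * (x * w⁻¹) + x * w⁻¹ + c
        ≡⟨ solve 3 (λ c x v → x :* v :* (x :* v) :+ x :* v :+ c := x :* v :* (x :* v) :+ con 1ℤ :* (x :* v) :+ c :* (con 1ℤ :* con 1ℤ)) refl c x w⁻¹ ⟩
      x * w⁻¹ * (x * w⁻¹) + 1# * (x * w⁻¹) + c * (1# * 1#)
        ≡⟨ cong (λ o → x * w⁻¹ * (x * w⁻¹) + o * (x * w⁻¹) + c * (o * o)) (sym ww⁻¹≡1) ⟩
      x * w⁻¹ * (x * w⁻¹) + w * w⁻¹ * (x * w⁻¹) + c * (w * w⁻¹ * (w * w⁻¹))
        ≡⟨ solve 4 (λ c x w v → x :* v :* (x :* v) :+ w :* v :* (x :* v) :+ c :* (w :* v :* (w :* v)) :=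
                      v :* v :* (x :* x :+ x :* w :+ c :* (w :* w))) refl c x w w⁻¹ ⟩
      w⁻¹ * w⁻¹ * N (x , w)
        ≡⟨ cong (w⁻¹ * w⁻¹ *_) e ⟩
      w⁻¹ * w⁻¹ * 0#
        ≡⟨ zeroʳ _ ⟩
      0# ∎))
    where open ≡-Reasoning

  𝕂 : Field
  𝕂 = record
    { Carrier = K
    ; _+_ = _+ᴷ_ ; _*_ = _*ᴷ_ ; -_ = -ᴷ_ ; 0# = 0# , 0# ; 1# = 1# , 0#
    ; isCommutativeRing = record
      { isRing = record
        { +-isAbelianGroup = record
          { isGroup = record
            { isMonoid = record
              { isSemigroup = record
                { isMagma = isMagma _+ᴷ_
                ; assoc = λ _ _ _ → cong₂ _,_ (+-assoc _ _ _) (+-assoc _ _ _) }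
              ; identity = (λ _ → cong₂ _,_ (+-identityˡ _) (+-identityˡ _))
                         , (λ _ → cong₂ _,_ (+-identityʳ _) (+-identityʳ _)) }
            ; inverse = (λ _ → cong₂ _,_ (-‿inverseˡ _) (-‿inverseˡ _))
                      , (λ _ → cong₂ _,_ (-‿inverseʳ _) (-‿inverseʳ _))
            ; ⁻¹-cong = cong -ᴷ_ }
          ; comm = λ _ _ → cong₂ _,_ (+-comm _ _) (+-comm _ _) }
        ; *-cong = cong₂ _*ᴷ_
        ; *-assoc = *ᴷ-assoc
        ; *-identity = *ᴷ-identityˡ , (λ z → trans (*ᴷ-comm z _) (*ᴷ-identityˡ z))
        ; distrib = *ᴷ-distribˡ
                  , (λ z y u → trans (*ᴷ-comm (y +ᴷ u) z) (trans (*ᴷ-distribˡ z y u) (cong₂ _+ᴷ_ (*ᴷ-comm z y) (*ᴷ-comm z u)))) }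
      ; *-comm = *ᴷ-comm }
    ; 0≢1 = λ e → 0≢1 (cong proj₁ e)
    ; inv = inverse }
    where
    inverse : ∀ z → ¬ (z ≡ (0# , 0#)) → Σ K λ y → z *ᴷ y ≡ (1# , 0#)
    inverse z z≢0 with inv (N z) (λ e → z≢0 (N≡0⇒0 z e))
    ... | n⁻¹ , nn⁻¹≡1 = σ z *ᴷ ι n⁻¹ , trans (sym (*ᴷ-assoc z (σ z) (ι n⁻¹))) (trans (cong (_*ᴷ ι n⁻¹) (norm z))
          (cong₂ _,_ (trans (solve 3 (λ c n m → n :* m :- c :* (0ₚ :* 0ₚ) := n :* m) refl c (N z) n⁻¹) nn⁻¹≡1)
                     (solve 2 (λ n m → n :* 0ₚ :+ 0ₚ :* m :+ 0ₚ :* 0ₚ := 0ₚ) refl (N z) n⁻¹)))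

  EK : Enumeration K
  EK = E ×ᵉ E

  ∑K : (K → ℤ) → ℤ
  ∑K = ∑∈ EK

  open Enumeration EK public using () renaming (_≟_ to infix 4 _≟ᴷ_)

  card-K : card EK ≡ q ℤ.* q
  card-K = trans (∑-× E E (λ _ → 1ℤ)) (Enumeration.∑-const E q)

  module KT = FieldTheory 𝕂

  -- The points of the conic N z = N z₁ other than z₁ are parametrised by s ∈ F through
  -- z = z₁ (s + θ) / σ (s + θ) (Hilbert 90).
  hilbert90 : ∀ z₁ z → ¬ (z ≡ z₁) → N z ≡ N z₁ → Σ Carrier λ s → z *ᴷ (s + 1# , - 1#) ≡ z₁ *ᴷ (s , 1#)
  hilbert90 z₁@(x₁ , w₁) z@(x , w) z≢z₁ Nz≡Nz₁ = s , KT.x-y≡0⇒x≡y (begin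
      z *ᴷ (s + 1# , - 1#) +ᴷ -ᴷ (z₁ *ᴷ (s , 1#))
        ≡⟨ cong₂ _,_
           (solve 6 (λ c x w x₁ w₁ s →
              (x :* (s :+ con 1ℤ) :- c :* (w :* (:- con 1ℤ))) :- (x₁ :* s :- c :* (w₁ :* con 1ℤ)) :=
              (s :* (x :- x₁) :- c :* (0ₚ :* (w :- w₁))) :- (:- (x :+ c :* w) :- c :* w₁)) refl c x w x₁ w₁ s)
           (solve 5 (λ x w x₁ w₁ s →
              (x :* (:- con 1ℤ) :+ w :* (s :+ con 1ℤ) :+ w :* (:- con 1ℤ)) :- (x₁ :* con 1ℤ :+ w₁ :* s :+ w₁ :* con 1ℤ) :=
              (s :* (w :- w₁) :+ 0ₚ :* (x :- x₁) :+ 0ₚ :* (w :- w₁)) :- (x :+ x₁ :+ w₁)) refl x w x₁ w₁ s) ⟩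
      ι s *ᴷ δ +ᴷ -ᴷ η
        ≡⟨ cong (_+ᴷ -ᴷ η) sδ≡η ⟩
      η +ᴷ -ᴷ η
        ≡⟨ KT.-‿inverseʳ η ⟩
      (0# , 0#) ∎)
    where
    open ≡-Reasoning
    -- Here δ = z - z₁ and η = z₁θ - zσ(θ). The equation zσ(s + θ) = z₁(s + θ) reads sδ = η, so s =
    -- ησ(δ) / N(δ). This lies in F because the θ-coordinate of ησ(δ) is N(z) - N(z₁).
    δ η : K
    δ = x + - x₁ , w + - w₁
    η = - (x + c * w) + - (c * w₁) , x + x₁ + w₁
    n = N δ
    n≢0 : ¬ (n ≡ 0#)
    n≢0 e = z≢z₁ (cong₂ _,_ (x-y≡0⇒x≡y (cong proj₁ (N≡0⇒0 δ e))) (x-y≡0⇒x≡y (cong proj₂ (N≡0⇒0 δ e))))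
    n⁻¹ = proj₁ (inv n n≢0)
    r = proj₁ (η *ᴷ σ δ)
    s = r * n⁻¹
    real : η *ᴷ σ δ ≡ ι r
    real = cong (r ,_) (begin
      proj₂ (η *ᴷ σ δ)
        ≡⟨ solve 5 (λ c x w x₁ w₁ →
             (:- (x :+ c :* w) :- c :* w₁) :* (:- (w :- w₁)) :+ (x :+ x₁ :+ w₁) :* ((x :- x₁) :+ (w :- w₁)) :+ (x :+ x₁ :+ w₁) :* (:- (w :- w₁))
             := (x :* x :+ x :* w :+ c :* (w :* w)) :- (x₁ :* x₁ :+ x₁ :* w₁ :+ c :* (w₁ :* w₁))) refl c x w x₁ w₁ ⟩
      N z + - N z₁  ≡⟨ cong (_+ - N z₁) Nz≡Nz₁ ⟩
      N z₁ + - N z₁ ≡⟨ -‿inverseʳ (N z₁) ⟩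
      0# ∎)
    sδ≡η : ι s *ᴷ δ ≡ η
    sδ≡η = begin
      ι (r * n⁻¹) *ᴷ δ             ≡⟨ cong (_*ᴷ δ) (ι-* r n⁻¹) ⟩
      ι r *ᴷ ι n⁻¹ *ᴷ δ            ≡⟨ cong (λ u → u *ᴷ ι n⁻¹ *ᴷ δ) (sym real) ⟩
      η *ᴷ σ δ *ᴷ ι n⁻¹ *ᴷ δ       ≡⟨ KT.solve 4 (λ a b d e → a KT.:* b KT.:* d KT.:* e KT.:= a KT.:* ((e KT.:* b) KT.:* d)) refl η (σ δ) (ι n⁻¹) δ ⟩
      η *ᴷ (δ *ᴷ σ δ *ᴷ ι n⁻¹)     ≡⟨ cong (λ u → η *ᴷ (u *ᴷ ι n⁻¹)) (norm δ) ⟩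
      η *ᴷ (ι n *ᴷ ι n⁻¹)          ≡⟨ cong (η *ᴷ_) (trans (sym (ι-* n n⁻¹)) (cong ι (proj₂ (inv n n≢0)))) ⟩
      η *ᴷ (1# , 0#)               ≡⟨ KT.*-identityʳ η ⟩
      η                            ∎

  fibre : Carrier → ℤ
  fibre t = ∑K (λ z → 𝟙 (N z ≟ t))

  -- In a nonempty fibre with base point z₁, the summand 1 accounts for z₁ and the summand q for the
  -- parameters s of Hilbert 90.
  fibre-≤ : ∀ t → fibre t ℤ.≤ 1ℤ ℤ.+ q
  fibre-≤ t with Enumeration.any? EK (λ z → N z ≟ t)
  ... | no empty = subst (ℤ._≤ 1ℤ ℤ.+ q)
        (sym (trans (∑-cong (elems EK) (λ z → 𝟙-no (N z ≟ t) (λ e → empty (z , e)))) (∑-zero (elems EK))))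
        (ℤP.≤-trans (ℤ.+≤+ ℕ.z≤n) (ℤP.+-monoʳ-≤ 1ℤ (ℤP.≤-trans (ℤ.+≤+ ℕ.z≤n) 2≤q)))
  ... | yes (z₁ , refl) = subst (fibre (N z₁) ℤ.≤_) total (∑-mono (elems EK) bound)
    where
    open ≡-Reasoning
    conj≢0 : ∀ s → ¬ ((s + 1# , - 1#) ≡ (0# , 0#))
    conj≢0 s e = 0≢1 (sym (trans (solve 1 (λ o → o := :- (:- o)) refl 1#)
                             (trans (cong (λ z → - z) (cong proj₂ e)) (solve 0 (:- con 0ℤ := con 0ℤ) refl))))
    point : Carrier → K
    point s = z₁ *ᴷ (s , 1#) *ᴷ proj₁ (KT.inv (s + 1# , - 1#) (conj≢0 s))
    on-point : ∀ z → ¬ (z ≡ z₁) → N z ≡ N z₁ → Σ Carrier λ s → z ≡ point s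
    on-point z z≢z₁ e = proj₁ h , (begin
      z               ≡⟨ sym (KT.*-identityʳ z) ⟩
      z *ᴷ (1# , 0#)  ≡⟨ cong (z *ᴷ_) (sym (proj₂ i)) ⟩
      z *ᴷ (y *ᴷ proj₁ i) ≡⟨ sym (*ᴷ-assoc z y (proj₁ i)) ⟩
      z *ᴷ y *ᴷ proj₁ i ≡⟨ cong (_*ᴷ proj₁ i) (proj₂ h) ⟩
      point (proj₁ h) ∎)
      where
      h = hilbert90 z₁ z z≢z₁ e
      y = (proj₁ h + 1# , - 1#)
      i = KT.inv y (conj≢0 (proj₁ h))
    bound : ∀ z → 𝟙 (N z ≟ N z₁) ℤ.≤ 𝟙 (z ≟ᴷ z₁) ℤ.+ ∑F (λ s → 𝟙 (z ≟ᴷ point s))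
    bound z = 𝟙-≤-+∑ E (N z ≟ N z₁) (z ≟ᴷ z₁) (λ s → z ≟ᴷ point s) (λ e z≢z₁ → on-point z z≢z₁ e)
    total : ∑K (λ z → 𝟙 (z ≟ᴷ z₁) ℤ.+ ∑F (λ s → 𝟙 (z ≟ᴷ point s))) ≡ 1ℤ ℤ.+ q
    total = trans (∑-+ (elems EK) _ _) (cong₂ ℤ._+_ (∑-δ EK z₁)
              (trans (∑-comm (elems EK) (elems E) _) (∑-cong (elems E) (λ s → ∑-δ EK (point s)))))

  fibre-0 : fibre 0# ≡ 1ℤ
  fibre-0 = trans (∑-cong (elems EK) (λ z → 𝟙-⇔ (N z ≟ 0#) (z ≟ᴷ (0# , 0#)) (N≡0⇒0 z)
              (λ { refl → solve 1 (λ c → 0ₚ :* 0ₚ :+ 0ₚ :* 0ₚ :+ c :* (0ₚ :* 0ₚ) := 0ₚ) refl c }))) (∑-δ EK _)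

  ∑-fibre : ∑F fibre ≡ q ℤ.* q
  ∑-fibre = trans (∑-comm (elems E) (elems EK) _)
    (trans (∑-cong (elems EK) (λ z → trans (∑-cong (elems E) (λ t → 𝟙-⇔ (N z ≟ t) (t ≟ N z) sym sym)) (∑-δ E (N z)))) card-K)

  -- The fibres over t ≠ 0 have at most q + 1 elements each, and the total forces equality.
  fibre-size : ∀ t → fibre t ≡ 1ℤ ℤ.+ q ℤ.- q ℤ.* 𝟙 (t ≟ 0#)
  fibre-size t = sym (ℤP.i-j≡0⇒i≡j (1ℤ ℤ.+ q ℤ.- q ℤ.* 𝟙 (t ≟ 0#)) (fibre t) (ℤP.≤-antisym defect≤0 (defect-nonneg t)))
    where
    open ≡-Reasoning
    defect : Carrier → ℤ
    defect t = (1ℤ ℤ.+ q ℤ.- q ℤ.* 𝟙 (t ≟ 0#)) ℤ.- fibre t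
    defect-nonneg : ∀ t → 0ℤ ℤ.≤ defect t
    defect-nonneg t with t ≟ 0#
    ... | yes refl = ℤP.≤-reflexive (sym (trans (cong (λ f → (1ℤ ℤ.+ q ℤ.- q ℤ.* 1ℤ) ℤ.- f) fibre-0) (arith q)))
      where
      arith : ∀ q → (1ℤ ℤ.+ q ℤ.- q ℤ.* 1ℤ) ℤ.- 1ℤ ≡ 0ℤ
      arith = ℤS.solve-∀
    ... | no _ = ℤP.i≤j⇒0≤j-i (subst (fibre t ℤ.≤_) (arith q) (fibre-≤ t))
      where
      arith : ∀ q → 1ℤ ℤ.+ q ≡ 1ℤ ℤ.+ q ℤ.- q ℤ.* 0ℤ
      arith = ℤS.solve-∀
    ∑-defect : ∑F defect ≡ 0ℤ
    ∑-defect = begin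
      ∑F defect
        ≡⟨ ∑-cong (elems E) (λ t → arith₁ q (𝟙 (t ≟ 0#)) (fibre t)) ⟩
      ∑F (λ t → 1ℤ ℤ.+ q ℤ.+ (ℤ.- q ℤ.* 𝟙 (t ≟ 0#) ℤ.+ ℤ.- 1ℤ ℤ.* fibre t))
        ≡⟨ trans (∑-+ (elems E) _ _) (cong₂ ℤ._+_ (Enumeration.∑-const E (1ℤ ℤ.+ q)) (∑-+ (elems E) _ _)) ⟩
      (1ℤ ℤ.+ q) ℤ.* q ℤ.+ (∑F (λ t → ℤ.- q ℤ.* 𝟙 (t ≟ 0#)) ℤ.+ ∑F (λ t → ℤ.- 1ℤ ℤ.* fibre t))
        ≡⟨ cong₂ (λ a b → (1ℤ ℤ.+ q) ℤ.* q ℤ.+ (a ℤ.+ b))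
             (trans (∑-*ˡ (elems E) (ℤ.- q) _) (cong (ℤ.- q ℤ.*_) (∑-δ E 0#)))
             (trans (∑-*ˡ (elems E) (ℤ.- 1ℤ) fibre) (cong (ℤ.- 1ℤ ℤ.*_) ∑-fibre)) ⟩
      (1ℤ ℤ.+ q) ℤ.* q ℤ.+ (ℤ.- q ℤ.* 1ℤ ℤ.+ ℤ.- 1ℤ ℤ.* (q ℤ.* q))
        ≡⟨ arith₂ q ⟩
      0ℤ ∎
      where
      arith₁ : ∀ q d f → (1ℤ ℤ.+ q ℤ.- q ℤ.* d) ℤ.- f ≡ 1ℤ ℤ.+ q ℤ.+ (ℤ.- q ℤ.* d ℤ.+ ℤ.- 1ℤ ℤ.* f)
      arith₁ = ℤS.solve-∀
      arith₂ : ∀ q → (1ℤ ℤ.+ q) ℤ.* q ℤ.+ (ℤ.- q ℤ.* 1ℤ ℤ.+ ℤ.- 1ℤ ℤ.* (q ℤ.* q)) ≡ 0ℤ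
      arith₂ = ℤS.solve-∀
    defect≤0 : defect t ℤ.≤ 0ℤ
    defect≤0 = subst (defect t ℤ.≤_) ∑-defect (Enumeration.nonneg-summand E defect defect-nonneg t)

  -- The argument of g vanishes when N(z) = -y / a, a value taken once if y = 0 and q + 1 times
  -- otherwise.
  ∑-norm : ∀ {a} → ¬ (a ≡ 0#) → ∀ y → ∑K (λ z → g (a * N z + y)) ≡ ℤ.- q ℤ.* g y
  ∑-norm {a} a≢0 y with inv a a≢0
  ... | a⁻¹ , aa⁻¹≡1 = begin
    ∑K (λ z → g (a * N z + y))
      ≡⟨ ∑-cong (elems EK) (λ z → cong (λ d → q ℤ.* d ℤ.+ ℤ.- 1ℤ) (𝟙-⇔ (a * N z + y ≟ 0#) (N z ≟ t) (to z) (from z))) ⟩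
    ∑K (λ z → q ℤ.* 𝟙 (N z ≟ t) ℤ.+ ℤ.- 1ℤ)
      ≡⟨ trans (∑-+ (elems EK) _ _) (cong₂ ℤ._+_ (∑-*ˡ (elems EK) q _) (trans (Enumeration.∑-const EK (ℤ.- 1ℤ)) (cong (ℤ.- 1ℤ ℤ.*_) card-K))) ⟩
    q ℤ.* fibre t ℤ.+ ℤ.- 1ℤ ℤ.* (q ℤ.* q)
      ≡⟨ cong (λ f → q ℤ.* f ℤ.+ ℤ.- 1ℤ ℤ.* (q ℤ.* q)) (trans (fibre-size t) (cong (λ d → 1ℤ ℤ.+ q ℤ.- q ℤ.* d) (𝟙-⇔ (t ≟ 0#) (y ≟ 0#) t≡0⇒ ⇒t≡0))) ⟩
    q ℤ.* (1ℤ ℤ.+ q ℤ.- q ℤ.* 𝟙 (y ≟ 0#)) ℤ.+ ℤ.- 1ℤ ℤ.* (q ℤ.* q)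
      ≡⟨ arith q (𝟙 (y ≟ 0#)) ⟩
    ℤ.- q ℤ.* g y ∎
    where
    open ≡-Reasoning
    arith : ∀ q d → q ℤ.* (1ℤ ℤ.+ q ℤ.- q ℤ.* d) ℤ.+ ℤ.- 1ℤ ℤ.* (q ℤ.* q) ≡ ℤ.- q ℤ.* (q ℤ.* d ℤ.- 1ℤ)
    arith = ℤS.solve-∀
    t = - y * a⁻¹
    at≡-y : a * t ≡ - y
    at≡-y = trans (solve 3 (λ a y b → a :* ((:- y) :* b) := (:- y) :* (a :* b)) refl a y a⁻¹) (trans (cong (- y *_) aa⁻¹≡1) (*-identityʳ _))
    to : ∀ z → a * N z + y ≡ 0# → N z ≡ t
    to z e = x-y≡0⇒x≡y (*-cancel-0 a≢0 (trans (solve 3 (λ a n t → a :* (n :- t) := a :* n :- a :* t) refl a (N z) t)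
      (trans (cong (λ u → a * N z + - u) at≡-y) (trans (solve 2 (λ n y → n :- (:- y) := n :+ y) refl (a * N z) y) e))))
    from : ∀ z → N z ≡ t → a * N z + y ≡ 0#
    from z e = trans (cong (λ n → a * n + y) e) (trans (cong (_+ y) at≡-y) (-‿inverseˡ y))
    t≡0⇒ : t ≡ 0# → y ≡ 0#
    t≡0⇒ e = trans (solve 1 (λ y → y := :- (:- y)) refl y) (trans (cong (λ u → - u) (trans (sym at≡-y) (trans (cong (a *_) e) (zeroʳ a))))
               (solve 0 (:- con 0ℤ := con 0ℤ) refl))
    ⇒t≡0 : y ≡ 0# → t ≡ 0#
    ⇒t≡0 e = trans (cong (λ u → - u * a⁻¹) e) (solve 1 (λ b → (:- con 0ℤ) :* b := con 0ℤ) refl a⁻¹)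

  extension : QuadraticExtension 𝔽 E
  extension = record
    { 𝕂 = 𝕂 ; EK = EK ; ι = ι ; σ = σ ; N = N ; Tr = Tr ; θ = 0# , 1#
    ; ι-+ = λ x y → cong (x + y ,_) (sym (+-identityˡ 0#))
    ; ι-* = ι-*
    ; ι-1 = refl
    ; ι-inj = cong proj₁
    ; σ-+ = λ (x , w) (x′ , w′) → cong₂ _,_
        (solve 4 (λ x w x′ w′ → (x :+ x′) :+ (w :+ w′) := (x :+ w) :+ (x′ :+ w′)) refl x w x′ w′)
        (solve 2 (λ w w′ → :- (w :+ w′) := :- w :+ :- w′) refl w w′)
    ; σ-* = λ (x , w) (x′ , w′) → cong₂ _,_
        (solve 5 (λ c x w x′ w′ → (x :* x′ :- c :* (w :* w′)) :+ (x :* w′ :+ w :* x′ :+ w :* w′) :=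
                    (x :+ w) :* (x′ :+ w′) :- c :* ((:- w) :* (:- w′))) refl c x w x′ w′)
        (solve 4 (λ x w x′ w′ → :- (x :* w′ :+ w :* x′ :+ w :* w′) :=
                    (x :+ w) :* (:- w′) :+ (:- w) :* (x′ :+ w′) :+ (:- w) :* (:- w′)) refl x w x′ w′)
    ; σ-σ = λ (x , w) → cong₂ _,_ (solve 2 (λ x w → (x :+ w) :- w := x) refl x w) (solve 1 (λ w → :- (:- w) := w) refl w)
    ; σ-ι = λ x → cong₂ _,_ (+-identityʳ x) (solve 0 (:- con 0ℤ := con 0ℤ) refl)
    ; norm = norm
    ; trace = λ (x , w) → cong₂ _,_ (solve 2 (λ x w → x :+ (x :+ w) := x :+ x :+ w) refl x w) (-‿inverseʳ w)
    ; Tr-θ = solve 1 (λ o → con 0ℤ :+ con 0ℤ :+ o := o) refl 1#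
    ; card-K = card-K
    ; ∑-norm = ∑-norm }

-- Diagonalisation of Hermitian forms and their character sums

module HermitianForms (𝔽 : Field) (E : Enumeration (Field.Carrier 𝔽)) (X : QuadraticExtension 𝔽 E) where
  private module F = FiniteFieldTheory 𝔽 E
  open QuadraticExtension X
  open FiniteFieldTheory 𝕂 EK hiding (g)
  open F using (g) renaming (q to q₀)

  private
    0ₚ 1ₚ : ∀ {n} → Polynomial n
    0ₚ = con 0ℤ
    1ₚ = con 1ℤ

  σ-0 : σ 0# ≡ 0#
  σ-0 = +-cancel-0 (trans (sym (σ-+ 0# 0#)) (cong σ (+-identityˡ 0#)))

  ι-0 : ι F.0# ≡ 0#
  ι-0 = +-cancel-0 (trans (sym (ι-+ F.0# F.0#)) (cong ι (F.+-identityˡ F.0#)))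

  ι≡0 : ∀ {x} → ι x ≡ 0# → x ≡ F.0#
  ι≡0 e = ι-inj (trans e (sym ι-0))

  ι-neg : ∀ x → ι (F.- x) ≡ - ι x
  ι-neg x = x-y≡0⇒x≡y (trans (solve 2 (λ a b → a :- :- b := a :+ b) refl (ι (F.- x)) (ι x))
                        (trans (sym (ι-+ (F.- x) x)) (trans (cong ι (F.-‿inverseˡ x)) ι-0)))

  σ-1 : σ 1# ≡ 1#
  σ-1 = trans (cong σ (sym ι-1)) (trans (σ-ι F.1#) ι-1)

  Tr-+ : ∀ z y → Tr (z + y) ≡ Tr z F.+ Tr y
  Tr-+ z y = ι-inj (begin
    ι (Tr (z + y))          ≡⟨ sym (trace (z + y)) ⟩
    z + y + σ (z + y)       ≡⟨ cong (z + y +_) (σ-+ z y) ⟩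
    z + y + (σ z + σ y)     ≡⟨ solve 4 (λ z y a b → z :+ y :+ (a :+ b) := (z :+ a) :+ (y :+ b)) refl z y (σ z) (σ y) ⟩
    (z + σ z) + (y + σ y)   ≡⟨ cong₂ _+_ (trace z) (trace y) ⟩
    ι (Tr z) + ι (Tr y)     ≡⟨ sym (ι-+ (Tr z) (Tr y)) ⟩
    ι (Tr z F.+ Tr y)       ∎)
    where open ≡-Reasoning

  Tr-ι* : ∀ x z → Tr (ι x * z) ≡ x F.* Tr z
  Tr-ι* x z = ι-inj (begin
    ι (Tr (ι x * z))          ≡⟨ sym (trace _) ⟩
    ι x * z + σ (ι x * z)     ≡⟨ cong (ι x * z +_) (trans (σ-* (ι x) z) (cong (_* σ z) (σ-ι x))) ⟩
    ι x * z + ι x * σ z       ≡⟨ sym (distribˡ (ι x) z (σ z)) ⟩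
    ι x * (z + σ z)           ≡⟨ cong (ι x *_) (trace z) ⟩
    ι x * ι (Tr z)            ≡⟨ sym (ι-* x (Tr z)) ⟩
    ι (x F.* Tr z)            ∎)
    where open ≡-Reasoning

  Tr-0 : Tr 0# ≡ F.0#
  Tr-0 = F.+-cancel-0 (trans (sym (Tr-+ 0# 0#)) (cong Tr (+-identityˡ 0#)))

  ∑K : (Carrier → ℤ) → ℤ
  ∑K = ∑∈ EK

  ∑K-translate : ∀ m (f : Carrier → ℤ) → ∑K (λ z → f (z + m)) ≡ ∑K f
  ∑K-translate m = Enumeration.∑-bij EK (_+ m) (_+ - m)
    (λ z → solve 2 (λ z m → (z :+ m) :- m := z) refl z m)
    (λ z → solve 2 (λ z m → (z :- m) :+ m := z) refl z m)

  -- Since θ has trace 1, a nonzero value κ can be scaled to one of trace 1; this is the shift that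
  -- `orthogonality` requires.
  Tr-attains-1 : ∀ κ → ¬ (κ ≡ 0#) → ∃ λ y → κ * y ≡ θ
  Tr-attains-1 κ κ≢0 with inv κ κ≢0
  ... | κ⁻¹ , e = κ⁻¹ * θ , trans (sym (*-assoc κ κ⁻¹ θ)) (trans (cong (_* θ) e) (*-identityˡ θ))

  ∑-trace-form : ∀ κ β → ∑K (λ y → g (Tr (κ * σ y + β))) ≡ 𝟙 (κ ≟ 0#) ℤ.* (q₀ ℤ.* q₀ ℤ.* g (Tr β))
  ∑-trace-form κ β with κ ≟ 0#
  ... | yes refl = begin
    ∑K (λ y → g (Tr (0# * σ y + β)))    ≡⟨ ∑-cong (elems EK) (λ y → cong (λ z → g (Tr z)) (solve 2 (λ s β → con 0ℤ :* s :+ β := β) refl (σ y) β)) ⟩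
    ∑K (λ y → g (Tr β))                 ≡⟨ Enumeration.∑-const EK (g (Tr β)) ⟩
    g (Tr β) ℤ.* q                      ≡⟨ cong (g (Tr β) ℤ.*_) card-K ⟩
    g (Tr β) ℤ.* (q₀ ℤ.* q₀)            ≡⟨ arith (g (Tr β)) q₀ ⟩
    1ℤ ℤ.* (q₀ ℤ.* q₀ ℤ.* g (Tr β))     ∎
    where
    open ≡-Reasoning
    arith : ∀ a b → a ℤ.* (b ℤ.* b) ≡ 1ℤ ℤ.* (b ℤ.* b ℤ.* a)
    arith = ℤS.solve-∀
  ... | no κ≢0 with Tr-attains-1 κ κ≢0
  ...   | y₁ , κy₁≡θ = trans
    (F.orthogonality EK (λ y → Tr (κ * σ y + β)) (λ t y → y + ι t * σ y₁) F.1#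
       (λ t y → trans (cong (λ u → y + ι t * σ y₁ + u * σ y₁) (ι-neg t))
                  (solve 3 (λ y t s → y :+ t :* s :+ (:- t) :* s := y) refl y (ι t) (σ y₁)))
       (λ e → F.0≢1 (sym e)) shift)
    (sym (ℤP.*-zeroˡ (q₀ ℤ.* q₀ ℤ.* g (Tr β))))
    where
    open ≡-Reasoning
    shift : ∀ t y → Tr (κ * σ (y + ι t * σ y₁) + β) ≡ Tr (κ * σ y + β) F.+ t F.* F.1#
    shift t y = begin
      Tr (κ * σ (y + ι t * σ y₁) + β)        ≡⟨ cong (λ u → Tr (κ * u + β)) (trans (σ-+ y (ι t * σ y₁)) (cong (σ y +_) (trans (σ-* (ι t) (σ y₁)) (cong₂ _*_ (σ-ι t) (σ-σ y₁))))) ⟩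
      Tr (κ * (σ y + ι t * y₁) + β)          ≡⟨ cong Tr (solve 5 (λ κ s t y β → κ :* (s :+ t :* y) :+ β := (κ :* s :+ β) :+ t :* (κ :* y)) refl κ (σ y) (ι t) y₁ β) ⟩
      Tr ((κ * σ y + β) + ι t * (κ * y₁))    ≡⟨ Tr-+ _ _ ⟩
      Tr (κ * σ y + β) F.+ Tr (ι t * (κ * y₁)) ≡⟨ cong (Tr (κ * σ y + β) F.+_) (trans (Tr-ι* t (κ * y₁)) (cong (t F.*_) (trans (cong Tr κy₁≡θ) Tr-θ))) ⟩
      Tr (κ * σ y + β) F.+ t F.* F.1#        ∎

  -- For az ≠ 0 the inner sum runs over a nonconstant trace and vanishes, so only z = 0 contributes.
  ∑-trace-pairing : ∀ {a} → ¬ (a ≡ 0#) → ∀ β → ∑K (λ z → ∑K (λ y → g (Tr (a * z * σ y + β)))) ≡ q₀ ℤ.* q₀ ℤ.* g (Tr β)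
  ∑-trace-pairing {a} a≢0 β = trans
    (∑-cong (elems EK) (λ z → trans (∑-trace-form (a * z) β)
      (cong (ℤ._* (q₀ ℤ.* q₀ ℤ.* g (Tr β))) (𝟙-⇔ (a * z ≟ 0#) (z ≟ 0#) (*-cancel-0 a≢0) (λ e → trans (cong (a *_) e) (zeroʳ a))))))
    (Enumeration.∑-δ* EK 0# (λ _ → q₀ ℤ.* q₀ ℤ.* g (Tr β)))

  record Hermitian (n : ℕ) : Set where
    field
      b      : V n → V n → Carrier
      h      : V n → F.Carrier
      b-⊕ˡ   : ∀ u v w → b (u ⊕ v) w ≡ b u w + b v w
      b-⊙ˡ   : ∀ t u v → b (t ⊙ u) v ≡ t * b u v
      b-sym  : ∀ u v → b v u ≡ σ (b u v)
      b-diag : ∀ v → b v v ≡ ι (h v)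

    b-⊕ʳ : ∀ u v w → b u (v ⊕ w) ≡ b u v + b u w
    b-⊕ʳ u v w = trans (b-sym (v ⊕ w) u) (trans (cong σ (b-⊕ˡ v w u))
                   (trans (σ-+ (b v u) (b w u)) (cong₂ _+_ (sym (b-sym v u)) (sym (b-sym w u)))))

    b-⊙ʳ : ∀ t u v → b u (t ⊙ v) ≡ σ t * b u v
    b-⊙ʳ t u v = trans (b-sym (t ⊙ v) u) (trans (cong σ (b-⊙ˡ t v u))
                   (trans (σ-* t (b v u)) (cong (σ t *_) (sym (b-sym v u)))))

    normSum : ℤ
    normSum = ∑V (λ v → g (h v))

    -- Equal to (q₀ - 1) q₀^(2n) times the number of vectors in the radical. It accompanies
    -- `normSum` through the induction so that the exponent found there can be recognised as the
    -- dimension of the radical.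
    traceSum : ℤ
    traceSum = ∑V (λ v → ∑V (λ u → g (Tr (b v u))))

    expand : ∀ e z v y u → b (z ⊙ e ⊕ v) (y ⊙ e ⊕ u) ≡ b e e * z * σ y + z * b e u + σ y * b v e + b v u
    expand e z v y u = begin
      b (z ⊙ e ⊕ v) (y ⊙ e ⊕ u)
        ≡⟨ trans (b-⊕ˡ (z ⊙ e) v _) (cong₂ _+_ (trans (b-⊙ˡ z e _) (cong (z *_) (right e))) (right v)) ⟩
      z * (σ y * b e e + b e u) + (σ y * b v e + b v u)
        ≡⟨ solve 6 (λ z y p q r s → z :* (y :* p :+ q) :+ (y :* r :+ s) := p :* z :* y :+ z :* q :+ y :* r :+ s) refl
             z (σ y) (b e e) (b e u) (b v e) (b v u) ⟩
      b e e * z * σ y + z * b e u + σ y * b v e + b v u ∎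
      where
      open ≡-Reasoning
      right : ∀ x → b x (y ⊙ e ⊕ u) ≡ σ y * b x e + b x u
      right x = trans (b-⊕ʳ x (y ⊙ e) u) (cong (_+ b x u) (b-⊙ʳ y x e))

    ∑-trace-radical : ∀ v (d : Dec (∀ u → b v u ≡ 0#)) →
      ∑V (λ u → g (Tr (b v u))) ≡ (q₀ ℤ.- 1ℤ) ℤ.* (q₀ ℤ.^ n ℤ.* q₀ ℤ.^ n) ℤ.* 𝟙 d
    ∑-trace-radical v (yes v⊥) = begin
      ∑V (λ u → g (Tr (b v u)))  ≡⟨ ∑-cong (elems (Vecᵉ EK n)) (λ u → trans (cong g (trans (cong Tr (v⊥ u)) Tr-0)) F.g-0) ⟩
      ∑V {n} (λ u → q₀ ℤ.- 1ℤ)   ≡⟨ ∑V-const {n} (q₀ ℤ.- 1ℤ) ⟩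
      (q₀ ℤ.- 1ℤ) ℤ.* q ℤ.^ n    ≡⟨ cong ((q₀ ℤ.- 1ℤ) ℤ.*_) (trans (cong (ℤ._^ n) card-K) (square-^ n)) ⟩
      (q₀ ℤ.- 1ℤ) ℤ.* (q₀ ℤ.^ n ℤ.* q₀ ℤ.^ n) ≡⟨ sym (ℤP.*-identityʳ _) ⟩
      (q₀ ℤ.- 1ℤ) ℤ.* (q₀ ℤ.^ n ℤ.* q₀ ℤ.^ n) ℤ.* 1ℤ ∎
      where
      open ≡-Reasoning
      arith : ∀ q r → q ℤ.* q ℤ.* (r ℤ.* r) ≡ q ℤ.* r ℤ.* (q ℤ.* r)
      arith = ℤS.solve-∀
      square-^ : ∀ n → (q₀ ℤ.* q₀) ℤ.^ n ≡ q₀ ℤ.^ n ℤ.* q₀ ℤ.^ n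
      square-^ zero    = refl
      square-^ (suc n) = trans (cong (q₀ ℤ.* q₀ ℤ.*_) (square-^ n)) (arith q₀ (q₀ ℤ.^ n))
    ∑-trace-radical v (no ¬v⊥) with Enumeration.any? (Vecᵉ EK n) (λ u → Dec.¬? (b v u ≟ 0#))
    ... | no ¬∃ = ⊥-elim (¬v⊥ (λ u → Dec.decidable-stable (b v u ≟ 0#) (λ ≢0 → ¬∃ (u , ≢0))))
    ... | yes (u₀ , κ≢0) with Tr-attains-1 (b v u₀) κ≢0
    ...   | y , κy≡θ = trans
      -- The form is conjugate-linear in its second argument, so the scalar σ y comes out as y, and
      -- the shift by σ y ⊙ u₀ changes the value by θ, whose trace is 1.
      (F.orthogonality (Vecᵉ EK n) (λ u → Tr (b v u)) (λ t u → u ⊕ ι t ⊙ (σ y ⊙ u₀)) F.1#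
        (λ t u → trans (cong (λ s → (u ⊕ ι t ⊙ (σ y ⊙ u₀)) ⊕ s ⊙ (σ y ⊙ u₀)) (ι-neg t)) (⊕-⊙-cancel (ι t) u (σ y ⊙ u₀)))
        (λ e → F.0≢1 (sym e)) shift)
      (sym (ℤP.*-zeroʳ ((q₀ ℤ.- 1ℤ) ℤ.* (q₀ ℤ.^ n ℤ.* q₀ ℤ.^ n))))
      where
      open ≡-Reasoning
      shift : ∀ t u → Tr (b v (u ⊕ ι t ⊙ (σ y ⊙ u₀))) ≡ Tr (b v u) F.+ t F.* F.1#
      shift t u = begin
        Tr (b v (u ⊕ ι t ⊙ (σ y ⊙ u₀)))            ≡⟨ cong Tr (b-⊕ʳ v u _) ⟩
        Tr (b v u + b v (ι t ⊙ (σ y ⊙ u₀)))        ≡⟨ cong (λ s → Tr (b v u + s)) (trans (b-⊙ʳ (ι t) v _) (cong₂ _*_ (σ-ι t) (trans (b-⊙ʳ (σ y) v u₀) (cong (_* b v u₀) (σ-σ y))))) ⟩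
        Tr (b v u + ι t * (y * b v u₀))            ≡⟨ Tr-+ _ _ ⟩
        Tr (b v u) F.+ Tr (ι t * (y * b v u₀))     ≡⟨ cong (Tr (b v u) F.+_) (trans (Tr-ι* t _) (cong (t F.*_) (trans (cong Tr (trans (*-comm y _) κy≡θ)) Tr-θ))) ⟩
        Tr (b v u) F.+ t F.* F.1#                  ∎

  lift : ∀ {n} → V n → V (suc n)
  lift w = 0# ∷ w

  lift-⊕ : ∀ {n} (u v : V n) → lift (u ⊕ v) ≡ lift u ⊕ lift v
  lift-⊕ u v = cong (_∷ (u ⊕ v)) (sym (+-identityˡ 0#))

  lift-⊙ : ∀ {n} t (u : V n) → lift (t ⊙ u) ≡ t ⊙ lift u
  lift-⊙ t u = cong (_∷ (t ⊙ u)) (sym (zeroʳ t))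

  -- For each leading coordinate z, the translation of the remaining coordinates by zu is a
  -- bijection.
  ∑V-split : ∀ {n} (u : V n) (f : V (suc n) → ℤ) →
    ∑V f ≡ ∑K (λ z → ∑V (λ w → f (z ⊙ (1# ∷ u) ⊕ lift w)))
  ∑V-split {n} u f = trans (∑-∷ EK n f) (∑-cong (elems EK) (λ z →
    trans (sym (∑V-translate u z (λ w → f (z ∷ w))))
          (∑-cong (elems (Vecᵉ EK n)) (λ w → cong f (cong₂ _∷_
             (solve 1 (λ z → z := z :* 1ₚ :+ 0ₚ) refl z) (⊕-comm w (z ⊙ u)))))))

  module _ {n} (B : Hermitian (suc n)) where
    open Hermitian B

    restrict : Hermitian n
    restrict = record
      { b = λ u v → b (lift u) (lift v)
      ; h = λ v → h (lift v)
      ; b-⊕ˡ = λ u v w → trans (cong (λ x → b x (lift w)) (lift-⊕ u v)) (b-⊕ˡ _ _ _)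
      ; b-⊙ˡ = λ t u v → trans (cong (λ x → b x (lift v)) (lift-⊙ t u)) (b-⊙ˡ _ _ _)
      ; b-sym = λ u v → b-sym _ _
      ; b-diag = λ v → b-diag _ }

    -- The Hermitian complement of a vector e = (1 , u) with h e ≠ 0, in the coordinates of K^n.
    module Pivot (u : V n) (a⁻¹ : F.Carrier) (aa⁻¹≡1 : h (1# ∷ u) F.* a⁻¹ ≡ F.1#) where
      private
        e = 1# ∷ u
        a = h e
        i = ι a⁻¹

      ιa*i≡1 : ι a * i ≡ 1#
      ιa*i≡1 = trans (sym (ι-* a a⁻¹)) (trans (cong ι aa⁻¹≡1) ι-1)

      a≢0 : ¬ (a ≡ F.0#)
      a≢0 a≡0 = F.0≢1 (trans (sym (F.zeroˡ a⁻¹)) (trans (cong (F._* a⁻¹) (sym a≡0)) aa⁻¹≡1))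

      ιa≢0 : ¬ (ι a ≡ 0#)
      ιa≢0 eq = a≢0 (ι≡0 eq)

      -- The Schur complement b(v , w) - b(v , e) b(e , w) / h(e): the restriction of b to the
      -- orthogonal space of e, carried to K^n by projecting each `lift v` along e.
      complement : Hermitian n
      complement = record
        { b = λ v w → b (lift v) (lift w) + - (i * (b (lift v) e * b e (lift w)))
        ; h = λ v → h (lift v) F.+ F.- (a⁻¹ F.* N (b (lift v) e))
        ; b-⊕ˡ = λ x v w → trans (cong (λ y → b y (lift w) + - (i * (b y e * b e (lift w)))) (lift-⊕ x v))
            (trans (cong₂ (λ p r → p + - (i * (r * b e (lift w)))) (b-⊕ˡ (lift x) (lift v) (lift w)) (b-⊕ˡ (lift x) (lift v) e))
              (solve 6 (λ i r a b c d → (a :+ b) :- i :* ((c :+ d) :* r) := (a :- i :* (c :* r)) :+ (b :- i :* (d :* r))) refl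
                 i (b e (lift w)) (b (lift x) (lift w)) (b (lift v) (lift w)) (b (lift x) e) (b (lift v) e)))
        ; b-⊙ˡ = λ t v w → trans (cong (λ y → b y (lift w) + - (i * (b y e * b e (lift w)))) (lift-⊙ t v))
            (trans (cong₂ (λ p r → p + - (i * (r * b e (lift w)))) (b-⊙ˡ t (lift v) (lift w)) (b-⊙ˡ t (lift v) e))
              (solve 5 (λ i r t a c → t :* a :- i :* (t :* c :* r) := t :* (a :- i :* (c :* r))) refl
                 i (b e (lift w)) t (b (lift v) (lift w)) (b (lift v) e)))
        ; b-sym = λ v w → trans (cong₂ _+_ (b-sym (lift v) (lift w)) (sym (trans (σ-neg (i * (b (lift v) e * b e (lift w))))
              (cong -_ (trans (trans (σ-* i _) (cong₂ _*_ (σ-ι a⁻¹) (trans (σ-* _ _) (cong₂ _*_ (sym (b-sym (lift v) e)) (sym (b-sym e (lift w)))))))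
                         (cong (i *_) (*-comm (b e (lift v)) (b (lift w) e))))))))
              (sym (σ-+ _ _))
        ; b-diag = λ v → trans (cong₂ _+_ (b-diag (lift v))
              (trans (cong (λ s → - (i * (b (lift v) e * s))) (b-sym (lift v) e))
                (trans (cong (λ s → - (i * s)) (norm (b (lift v) e)))
                  (trans (cong -_ (sym (ι-* a⁻¹ (N (b (lift v) e))))) (sym (ι-neg _))))))
              (sym (ι-+ _ _)) }
        where
        σ-neg : ∀ z → σ (- z) ≡ - σ z
        σ-neg z = x-y≡0⇒x≡y (trans (solve 2 (λ a b → a :- :- b := a :+ b) refl (σ (- z)) (σ z))
                    (trans (sym (σ-+ (- z) z)) (trans (cong σ (-‿inverseˡ z)) σ-0)))

      private
        module C = Hermitian complement
        -- The coefficient of e in the orthogonal projection of `lift w` onto the line of e.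
        m : V n → Carrier
        m w = i * b (lift w) e

      σ-m : ∀ w → σ (m w) ≡ i * b e (lift w)
      σ-m w = trans (σ-* i _) (cong₂ _*_ (σ-ι a⁻¹) (sym (b-sym (lift w) e)))

      complete-square : ∀ z v y w → b (z ⊙ e ⊕ lift v) (y ⊙ e ⊕ lift w) ≡ ι a * (z + m v) * σ (y + m w) + C.b v w
      complete-square z v y w = begin
        b (z ⊙ e ⊕ lift v) (y ⊙ e ⊕ lift w)
          ≡⟨ expand e z (lift v) y (lift w) ⟩
        b e e * z * σ y + z * P + σ y * R + S
          ≡⟨ cong (λ k → k * z * σ y + z * P + σ y * R + S) (b-diag e) ⟩
        ι a * z * σ y + z * P + σ y * R + S
          ≡⟨ solve 6 (λ a z y P R S → a :* z :* y :+ z :* P :+ y :* R :+ S := a :* z :* y :+ con 1ℤ :* z :* P :+ con 1ℤ :* y :* R :+ S) refl (ι a) z (σ y) P R S ⟩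
        ι a * z * σ y + 1# * z * P + 1# * σ y * R + S
          ≡⟨ cong (λ o → ι a * z * σ y + o * z * P + o * σ y * R + S) (sym ιa*i≡1) ⟩
        ι a * z * σ y + ι a * i * z * P + ι a * i * σ y * R + S
          ≡⟨ solve 7 (λ a z y P R S i → a :* z :* y :+ a :* i :* z :* P :+ a :* i :* y :* R :+ S :=
               a :* (z :+ i :* R) :* (y :+ i :* P) :+ (S :- (a :* i) :* (i :* (R :* P)))) refl (ι a) z (σ y) P R S i ⟩
        ι a * (z + m v) * (σ y + i * P) + (S + - (ι a * i * (i * (R * P))))
          ≡⟨ cong₂ (λ s o → ι a * (z + m v) * s + (S + - (o * (i * (R * P))))) (sym (trans (σ-+ y (m w)) (cong (σ y +_) (σ-m w)))) ιa*i≡1 ⟩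
        ι a * (z + m v) * σ (y + m w) + (S + - (1# * (i * (R * P))))
          ≡⟨ cong (λ t → ι a * (z + m v) * σ (y + m w) + (S + - t)) (*-identityˡ _) ⟩
        ι a * (z + m v) * σ (y + m w) + C.b v w ∎
        where
        open ≡-Reasoning
        P = b e (lift w)
        R = b (lift v) e
        S = b (lift v) (lift w)

      complete-square-h : ∀ z v → h (z ⊙ e ⊕ lift v) ≡ a F.* N (z + m v) F.+ C.h v
      complete-square-h z v = ι-inj (begin
        ι (h (z ⊙ e ⊕ lift v))                       ≡⟨ sym (b-diag _) ⟩
        b (z ⊙ e ⊕ lift v) (z ⊙ e ⊕ lift v)          ≡⟨ complete-square z v z v ⟩
        ι a * (z + m v) * σ (z + m v) + C.b v v      ≡⟨ cong₂ _+_ (trans (*-assoc _ _ _) (trans (cong (ι a *_) (norm (z + m v))) (sym (ι-* a _)))) (C.b-diag v) ⟩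
        ι (a F.* N (z + m v)) + ι (C.h v)            ≡⟨ sym (ι-+ _ _) ⟩
        ι (a F.* N (z + m v) F.+ C.h v)              ∎)
        where open ≡-Reasoning

      -- With the square completed and z translated by m w, the sum over z is an instance of
      -- `∑-norm`.
      normSum-pivot : normSum ≡ ℤ.- q₀ ℤ.* C.normSum
      normSum-pivot = begin
        ∑V (λ v → g (h v))
          ≡⟨ ∑V-split u _ ⟩
        ∑K (λ z → ∑V (λ w → g (h (z ⊙ e ⊕ lift w))))
          ≡⟨ ∑-comm (elems EK) (elems (Vecᵉ EK n)) _ ⟩
        ∑V (λ w → ∑K (λ z → g (h (z ⊙ e ⊕ lift w))))
          ≡⟨ ∑-cong (elems (Vecᵉ EK n)) (λ w → trans (∑-cong (elems EK) (λ z → cong g (complete-square-h z w)))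
               (trans (∑K-translate (m w) (λ z → g (a F.* N z F.+ C.h w))) (∑-norm a≢0 (C.h w)))) ⟩
        ∑V (λ w → ℤ.- q₀ ℤ.* g (C.h w))
          ≡⟨ ∑-*ˡ (elems (Vecᵉ EK n)) (ℤ.- q₀) _ ⟩
        ℤ.- q₀ ℤ.* C.normSum ∎
        where open ≡-Reasoning

      traceSum-pivot : traceSum ≡ q₀ ℤ.* q₀ ℤ.* C.traceSum
      traceSum-pivot = begin
        ∑V (λ v → ∑V (λ w → g (Tr (b v w))))
          ≡⟨ ∑V-split u _ ⟩
        ∑K (λ z → ∑V (λ v → ∑V (λ w → g (Tr (b (z ⊙ e ⊕ lift v) w)))))
          ≡⟨ ∑-comm (elems EK) (elems (Vecᵉ EK n)) _ ⟩
        ∑V (λ v → ∑K (λ z → ∑V (λ w → g (Tr (b (z ⊙ e ⊕ lift v) w)))))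
          ≡⟨ ∑-cong (elems (Vecᵉ EK n)) (λ v → trans (∑-cong (elems EK) (λ z →
               trans (∑V-split u _) (∑-comm (elems EK) (elems (Vecᵉ EK n)) _)))
               (trans (∑-comm (elems EK) (elems (Vecᵉ EK n)) _)
                 (trans (∑-cong (elems (Vecᵉ EK n)) (inner v)) (∑-*ˡ (elems (Vecᵉ EK n)) (q₀ ℤ.* q₀) _)))) ⟩
        ∑V (λ v → q₀ ℤ.* q₀ ℤ.* ∑V (λ w → g (Tr (C.b v w))))
          ≡⟨ ∑-*ˡ (elems (Vecᵉ EK n)) (q₀ ℤ.* q₀) _ ⟩
        q₀ ℤ.* q₀ ℤ.* C.traceSum ∎
        where
        open ≡-Reasoning
        inner : ∀ v w → ∑K (λ z → ∑K (λ y → g (Tr (b (z ⊙ e ⊕ lift v) (y ⊙ e ⊕ lift w))))) ≡ q₀ ℤ.* q₀ ℤ.* g (Tr (C.b v w))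
        inner v w = begin
          ∑K (λ z → ∑K (λ y → g (Tr (b (z ⊙ e ⊕ lift v) (y ⊙ e ⊕ lift w)))))
            ≡⟨ ∑-cong (elems EK) (λ z → trans (∑-cong (elems EK) (λ y → cong (λ t → g (Tr t)) (complete-square z v y w)))
                 (∑K-translate (m w) (λ y → g (Tr (ι a * (z + m v) * σ y + C.b v w))))) ⟩
          ∑K (λ z → ∑K (λ y → g (Tr (ι a * (z + m v) * σ y + C.b v w))))
            ≡⟨ ∑K-translate (m v) (λ z → ∑K (λ y → g (Tr (ι a * z * σ y + C.b v w)))) ⟩
          ∑K (λ z → ∑K (λ y → g (Tr (ι a * z * σ y + C.b v w))))
            ≡⟨ ∑-trace-pairing ιa≢0 (C.b v w) ⟩
          q₀ ℤ.* q₀ ℤ.* g (Tr (C.b v w)) ∎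

    module Degenerate (h≡0 : ∀ u → h (1# ∷ u) ≡ F.0#) where
      private
        e : V (suc n)
        e = 1# ∷ 𝟎
        module C = Hermitian restrict

      bee≡0 : b e e ≡ 0#
      bee≡0 = trans (b-diag e) (trans (cong ι (h≡0 𝟎)) ι-0)

      -- All vectors e + tw have leading coordinate 1, so N(t) h(w) + Tr(t σ(β)) = 0 for every t,
      -- with β = b(e , w). This first forces h(w) = 0, although w itself has leading coordinate 0;
      -- then the trace term vanishes for every t, which is impossible for β ≠ 0.
      e⊥ : ∀ w → b e (lift w) ≡ 0#
      e⊥ w with b e (lift w) ≟ 0#
      ... | yes β≡0 = β≡0
      ... | no β≢0 with Tr-attains-1 (b e (lift w)) β≢0
      ...   | y , βy≡θ = ⊥-elim (F.0≢1 (trans (sym (ι≡0 (trans (sym (trace θ)) θ+σθ≡0))) Tr-θ))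
        where
        open ≡-Reasoning
        β = b e (lift w)
        d = ι (h (lift w))
        vanish : ∀ t → t * σ t * d + t * σ β + σ t * β ≡ 0#
        vanish t = begin
          t * σ t * d + t * σ β + σ t * β
            ≡⟨ cong₂ (λ d′ s → t * σ t * d′ + t * s + σ t * β) (sym (b-diag (lift w))) (sym (b-sym e (lift w))) ⟩
          t * σ t * b (lift w) (lift w) + t * b (lift w) e + σ t * β
            ≡⟨ solve 5 (λ t s x y z → t :* s :* x :+ t :* y :+ s :* z := (x :* t :* s :+ t :* y :+ s :* z) :+ con 0ℤ) refl
                 t (σ t) (b (lift w) (lift w)) (b (lift w) e) β ⟩
          b (lift w) (lift w) * t * σ t + t * b (lift w) e + σ t * β + 0#
            ≡⟨ cong (b (lift w) (lift w) * t * σ t + t * b (lift w) e + σ t * β +_) (sym bee≡0) ⟩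
          b (lift w) (lift w) * t * σ t + t * b (lift w) e + σ t * β + b e e
            ≡⟨ sym (expand (lift w) t e t e) ⟩
          b (t ⊙ lift w ⊕ e) (t ⊙ lift w ⊕ e)
            ≡⟨ b-diag _ ⟩
          ι (h (t ⊙ lift w ⊕ e))
            ≡⟨ cong (λ x → ι (h x)) (cong₂ _∷_ (solve 1 (λ t → t :* 0ₚ :+ 1ₚ := 1ₚ) refl t) (⊕-identityʳ (t ⊙ w))) ⟩
          ι (h (1# ∷ t ⊙ w))
            ≡⟨ trans (cong ι (h≡0 (t ⊙ w))) ι-0 ⟩
          0# ∎
        -- Polarising vanish at t, 1 and t + 1 isolates the trace of t.
        d≡0 : d ≡ 0#
        d≡0 = begin
          d                       ≡⟨ sym (*-identityˡ d) ⟩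
          1# * d                  ≡⟨ cong (_* d) (sym (trans (trace θ) (trans (cong ι Tr-θ) ι-1))) ⟩
          (θ + σ θ) * d           ≡⟨ solve 5 (λ t s d β γ → (t :+ s) :* d :=
                                       ((t :+ 1ₚ) :* (s :+ 1ₚ) :* d :+ (t :+ 1ₚ) :* γ :+ (s :+ 1ₚ) :* β)
                                       :- (t :* s :* d :+ t :* γ :+ s :* β) :- (1ₚ :* 1ₚ :* d :+ 1ₚ :* γ :+ 1ₚ :* β)) refl θ (σ θ) d β (σ β) ⟩
          ((θ + 1#) * (σ θ + 1#) * d + (θ + 1#) * σ β + (σ θ + 1#) * β)
            + - (θ * σ θ * d + θ * σ β + σ θ * β) + - (1# * 1# * d + 1# * σ β + 1# * β)
                                  ≡⟨ cong₂ (λ s o → ((θ + 1#) * s * d + (θ + 1#) * σ β + s * β)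
                                       + - (θ * σ θ * d + θ * σ β + σ θ * β) + - (1# * o * d + 1# * σ β + o * β))
                                       (trans (cong (σ θ +_) (sym σ-1)) (sym (σ-+ θ 1#))) (sym σ-1) ⟩
          ((θ + 1#) * σ (θ + 1#) * d + (θ + 1#) * σ β + σ (θ + 1#) * β)
            + - (θ * σ θ * d + θ * σ β + σ θ * β) + - (1# * σ 1# * d + 1# * σ β + σ 1# * β)
                                  ≡⟨ cong₂ (λ x y → x + - y + - (1# * σ 1# * d + 1# * σ β + σ 1# * β)) (vanish (θ + 1#)) (vanish θ) ⟩
          0# + - 0# + - (1# * σ 1# * d + 1# * σ β + σ 1# * β)
                                  ≡⟨ cong (λ x → 0# + - 0# + - x) (vanish 1#) ⟩
          0# + - 0# + - 0#        ≡⟨ solve 0 (0ₚ :- 0ₚ :- 0ₚ := 0ₚ) refl ⟩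
          0#                      ∎
        θ+σθ≡0 : θ + σ θ ≡ 0#
        θ+σθ≡0 = begin
          θ + σ θ                              ≡⟨ cong (λ x → x + σ x) (sym βy≡θ) ⟩
          β * y + σ (β * y)                    ≡⟨ cong (β * y +_) (σ-* β y) ⟩
          β * y + σ β * σ y                    ≡⟨ solve 4 (λ β y γ s → β :* y :+ γ :* s := s :* y :* 0ₚ :+ s :* γ :+ y :* β) refl β y (σ β) (σ y) ⟩
          σ y * y * 0# + σ y * σ β + y * β     ≡⟨ cong (λ x → σ y * y * x + σ y * σ β + y * β) (sym d≡0) ⟩
          σ y * y * d + σ y * σ β + y * β      ≡⟨ cong (λ x → σ y * x * d + σ y * σ β + x * β) (sym (σ-σ y)) ⟩
          σ y * σ (σ y) * d + σ y * σ β + σ (σ y) * β ≡⟨ vanish (σ y) ⟩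
          0#                                   ∎

      ⊥e : ∀ w → b (lift w) e ≡ 0#
      ⊥e w = trans (b-sym e (lift w)) (trans (cong σ (e⊥ w)) σ-0)

      drop-head : ∀ z v y w → b (z ⊙ e ⊕ lift v) (y ⊙ e ⊕ lift w) ≡ C.b v w
      drop-head z v y w = begin
        b (z ⊙ e ⊕ lift v) (y ⊙ e ⊕ lift w)
          ≡⟨ expand e z (lift v) y (lift w) ⟩
        b e e * z * σ y + z * b e (lift w) + σ y * b (lift v) e + C.b v w
          ≡⟨ cong₂ (λ p r → p * z * σ y + z * r + σ y * b (lift v) e + C.b v w) bee≡0 (e⊥ w) ⟩
        0# * z * σ y + z * 0# + σ y * b (lift v) e + C.b v w
          ≡⟨ cong (λ r → 0# * z * σ y + z * 0# + σ y * r + C.b v w) (⊥e v) ⟩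
        0# * z * σ y + z * 0# + σ y * 0# + C.b v w
          ≡⟨ solve 3 (λ z y x → 0ₚ :* z :* y :+ z :* 0ₚ :+ y :* 0ₚ :+ x := x) refl z (σ y) (C.b v w) ⟩
        C.b v w ∎
        where open ≡-Reasoning

      drop-head-h : ∀ z v → h (z ⊙ e ⊕ lift v) ≡ C.h v
      drop-head-h z v = ι-inj (trans (sym (b-diag _)) (trans (drop-head z v z v) (C.b-diag v)))

      private
        ∑K-const : ∀ k → ∑K (λ _ → k) ≡ q₀ ℤ.* q₀ ℤ.* k
        ∑K-const k = trans (Enumeration.∑-const EK k) (trans (cong (k ℤ.*_) card-K) (ℤP.*-comm k _))

      normSum-degenerate : normSum ≡ q₀ ℤ.* q₀ ℤ.* C.normSum
      normSum-degenerate = trans (∑V-split 𝟎 _)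
        (trans (∑-cong (elems EK) (λ z → ∑-cong (elems (Vecᵉ EK n)) (λ w → cong g (drop-head-h z w)))) (∑K-const C.normSum))

      traceSum-degenerate : traceSum ≡ q₀ ℤ.* q₀ ℤ.* (q₀ ℤ.* q₀ ℤ.* C.traceSum)
      traceSum-degenerate = trans (∑V-split 𝟎 _)
        (trans (∑-cong (elems EK) (λ z → trans (∑-cong (elems (Vecᵉ EK n)) (λ v →
                  trans (∑V-split 𝟎 _)
                    (trans (∑-cong (elems EK) (λ y → ∑-cong (elems (Vecᵉ EK n)) (λ w → cong (λ t → g (Tr t)) (drop-head z v y w))))
                           (∑K-const (∑V (λ w → g (Tr (C.b v w))))))))
                  (∑-*ˡ (elems (Vecᵉ EK n)) (q₀ ℤ.* q₀) _)))
               (∑K-const (q₀ ℤ.* q₀ ℤ.* C.traceSum)))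

  -- k is the dimension of the radical of the form.
  character-sums : ∀ n (B : Hermitian n) → ∃ λ k →
    Hermitian.normSum B ≡ (q₀ ℤ.- 1ℤ) ℤ.* (ℤ.- q₀) ℤ.^ (n ℕ.+ k) ×
    Hermitian.traceSum B ≡ (q₀ ℤ.- 1ℤ) ℤ.* (q₀ ℤ.^ (n ℕ.+ k) ℤ.* q₀ ℤ.^ (n ℕ.+ k))
  character-sums zero B = 0 ,
    trans (ℤP.+-identityʳ _) (trans (cong g (ι≡0 (trans (sym (b-diag [])) b[]≡0))) (trans F.g-0 (arith₁ q₀))) ,
    trans (trans (ℤP.+-identityʳ _) (ℤP.+-identityʳ _)) (trans (cong g (trans (cong Tr b[]≡0) Tr-0)) (trans F.g-0 (arith₂ q₀)))
    where
    open Hermitian B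
    b[]≡0 : b [] [] ≡ 0#
    b[]≡0 = +-cancel-0 (sym (b-⊕ˡ [] [] []))
    arith₁ : ∀ q → q ℤ.- 1ℤ ≡ (q ℤ.- 1ℤ) ℤ.* 1ℤ
    arith₁ = ℤS.solve-∀
    arith₂ : ∀ q → q ℤ.- 1ℤ ≡ (q ℤ.- 1ℤ) ℤ.* (1ℤ ℤ.* 1ℤ)
    arith₂ = ℤS.solve-∀
  -- Pivots are sought only among vectors with leading coordinate 1. Then the complement has
  -- coordinates in K^n, and if there is no pivot, the first basis vector already lies in the
  -- radical.
  character-sums (suc n) B with Enumeration.any? (Vecᵉ EK n) (λ u → Dec.¬? (Hermitian.h B (1# ∷ u) F.≟ F.0#))
  ... | yes (u , h≢0) with character-sums n (Pivot.complement B u _ (proj₂ (F.inv _ h≢0)))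
  ...   | k , norm≡ , trace≡ = k ,
    trans (Pivot.normSum-pivot B u _ (proj₂ (F.inv _ h≢0))) (trans (cong (ℤ.- q₀ ℤ.*_) norm≡) (arith₁ (ℤ.- q₀) (q₀ ℤ.- 1ℤ) ((ℤ.- q₀) ℤ.^ (n ℕ.+ k)))) ,
    trans (Pivot.traceSum-pivot B u _ (proj₂ (F.inv _ h≢0))) (trans (cong (q₀ ℤ.* q₀ ℤ.*_) trace≡) (arith₂ q₀ (q₀ ℤ.^ (n ℕ.+ k)) (q₀ ℤ.- 1ℤ)))
    where
    arith₁ : ∀ p s r → p ℤ.* (s ℤ.* r) ≡ s ℤ.* (p ℤ.* r)
    arith₁ = ℤS.solve-∀
    arith₂ : ∀ q r s → q ℤ.* q ℤ.* (s ℤ.* (r ℤ.* r)) ≡ s ℤ.* (q ℤ.* r ℤ.* (q ℤ.* r))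
    arith₂ = ℤS.solve-∀
  -- Both n and k grow by one, so the exponent grows by two: the factor q² of the norm sum is (-q)²,
  -- and the trace sum gains q⁴.
  character-sums (suc n) B | no ¬pivot with character-sums n (restrict B)
  ...   | k , norm≡ , trace≡ = suc k ,
    trans (Degenerate.normSum-degenerate B h≡0) (trans (cong (q₀ ℤ.* q₀ ℤ.*_) norm≡)
      (trans (arith₁ q₀ ((ℤ.- q₀) ℤ.^ (n ℕ.+ k))) (cong (λ j → (q₀ ℤ.- 1ℤ) ℤ.* (ℤ.- q₀ ℤ.* (ℤ.- q₀) ℤ.^ j)) (sym (ℕP.+-suc n k))))) ,
    trans (Degenerate.traceSum-degenerate B h≡0) (trans (cong (λ t → q₀ ℤ.* q₀ ℤ.* (q₀ ℤ.* q₀ ℤ.* t)) trace≡)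
      (trans (arith₂ q₀ (q₀ ℤ.^ (n ℕ.+ k))) (cong (λ j → (q₀ ℤ.- 1ℤ) ℤ.* (q₀ ℤ.* q₀ ℤ.^ j ℤ.* (q₀ ℤ.* q₀ ℤ.^ j))) (sym (ℕP.+-suc n k)))))
    where
    h≡0 : ∀ u → Hermitian.h B (1# ∷ u) ≡ F.0#
    h≡0 u = Dec.decidable-stable (Hermitian.h B (1# ∷ u) F.≟ F.0#) (λ h≢0 → ¬pivot (u , h≢0))
    arith₁ : ∀ q r → q ℤ.* q ℤ.* ((q ℤ.- 1ℤ) ℤ.* r) ≡ (q ℤ.- 1ℤ) ℤ.* (ℤ.- q ℤ.* (ℤ.- q ℤ.* r))
    arith₁ = ℤS.solve-∀
    arith₂ : ∀ q r → q ℤ.* q ℤ.* (q ℤ.* q ℤ.* ((q ℤ.- 1ℤ) ℤ.* (r ℤ.* r))) ≡ (q ℤ.- 1ℤ) ℤ.* (q ℤ.* (q ℤ.* r) ℤ.* (q ℤ.* (q ℤ.* r)))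
    arith₂ = ℤS.solve-∀

-- Symmetric bilinear forms and their Hermitian extension

module SymmetricForms (𝔽 : Field) (E : Enumeration (Field.Carrier 𝔽)) where
  open FiniteFieldTheory 𝔽 E

  record SymmetricForm (n : ℕ) : Set where
    field
      β     : V n → V n → Carrier
      β-⊕ˡ  : ∀ u v w → β (u ⊕ v) w ≡ β u w + β v w
      β-⊙ˡ  : ∀ t u v → β (t ⊙ u) v ≡ t * β u v
      β-sym : ∀ u v → β u v ≡ β v u

    β-⊕ʳ : ∀ u v w → β u (v ⊕ w) ≡ β u v + β u w
    β-⊕ʳ u v w = trans (β-sym u (v ⊕ w)) (trans (β-⊕ˡ v w u) (cong₂ _+_ (β-sym v u) (β-sym w u)))

    β-⊙ʳ : ∀ t u v → β u (t ⊙ v) ≡ t * β u v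
    β-⊙ʳ t u v = trans (β-sym u (t ⊙ v)) (trans (β-⊙ˡ t v u) (cong (t *_) (β-sym v u)))

    radical? : ∀ x → Dec (∀ y → β x y ≡ 0#)
    radical? x = Enumeration.all? (Vecᵉ E n) (λ y → β x y ≟ 0#)

    ρ : V n → ℤ
    ρ x = 𝟙 (radical? x)

    radicalSize : ℤ
    radicalSize = ∑V ρ

    radicalSize-nonneg : 0ℤ ℤ.≤ radicalSize
    radicalSize-nonneg = Enumeration.∑-nonneg (Vecᵉ E n) ρ (λ x → 𝟙-nonneg (radical? x))

    -- The constant k allows a sum over two variables to be evaluated one variable at a time, as in
    -- `pencil-bound`.
    ∑-row : ∀ x k → ∑V (λ y → g (β x y + k)) ≡ q ℤ.^ n ℤ.* ρ x ℤ.* g k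
    ∑-row x k = row (radical? x)
      where
      open ≡-Reasoning
      arith : ∀ a b → a ℤ.* b ≡ b ℤ.* 1ℤ ℤ.* a
      arith = ℤS.solve-∀
      arith₀ : ∀ a b → 0ℤ ≡ b ℤ.* 0ℤ ℤ.* a
      arith₀ = ℤS.solve-∀
      row : (d : Dec (∀ y → β x y ≡ 0#)) → ∑V (λ y → g (β x y + k)) ≡ q ℤ.^ n ℤ.* 𝟙 d ℤ.* g k
      row (yes x⊥) = begin
        ∑V (λ y → g (β x y + k))  ≡⟨ ∑-cong (elems (Vecᵉ E n)) (λ y → cong g (trans (cong (_+ k) (x⊥ y)) (+-identityˡ k))) ⟩
        ∑V {n} (λ y → g k)        ≡⟨ ∑V-const {n} (g k) ⟩
        g k ℤ.* q ℤ.^ n           ≡⟨ arith (g k) (q ℤ.^ n) ⟩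
        q ℤ.^ n ℤ.* 1ℤ ℤ.* g k    ∎
      row (no ¬x⊥) with Enumeration.any? (Vecᵉ E n) (λ y → Dec.¬? (β x y ≟ 0#))
      ... | no ¬∃ = ⊥-elim (¬x⊥ (λ y → Dec.decidable-stable (β x y ≟ 0#) (λ ≢0 → ¬∃ (y , ≢0))))
      ... | yes (y₀ , ≢0) = trans
        (orthogonality (Vecᵉ E n) (λ y → β x y + k) (λ t y → y ⊕ t ⊙ y₀) (β x y₀) (λ t y → ⊕-⊙-cancel t y y₀) ≢0
          (λ t y → trans (cong (_+ k) (trans (β-⊕ʳ x y (t ⊙ y₀)) (cong (β x y +_) (β-⊙ʳ t x y₀))))
                     (solve 3 (λ a b k → a :+ b :+ k := a :+ k :+ b) refl (β x y) (t * β x y₀) k)))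
        (arith₀ (g k) (q ℤ.^ n))

    ∑-form : ∑V (λ x → ∑V (λ y → g (β x y))) ≡ (q ℤ.- 1ℤ) ℤ.* q ℤ.^ n ℤ.* radicalSize
    ∑-form = trans (∑-cong (elems (Vecᵉ E n)) step) (∑-*ˡ (elems (Vecᵉ E n)) ((q ℤ.- 1ℤ) ℤ.* q ℤ.^ n) ρ)
      where
      arith : ∀ a b c → a ℤ.* b ℤ.* c ≡ c ℤ.* a ℤ.* b
      arith = ℤS.solve-∀
      step : ∀ x → ∑V (λ y → g (β x y)) ≡ (q ℤ.- 1ℤ) ℤ.* q ℤ.^ n ℤ.* ρ x
      step x = trans (∑-cong (elems (Vecᵉ E n)) (λ y → cong g (sym (+-identityʳ (β x y)))))
                 (trans (∑-row x 0#) (trans (cong (q ℤ.^ n ℤ.* ρ x ℤ.*_) g-0) (arith (q ℤ.^ n) (ρ x) (q ℤ.- 1ℤ))))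

    module _ (c : Carrier) (irreducible : Irreducible c) where
      private
        module A = AdjoinRoot 𝔽 E c irreducible
        module VK = VectorTheory A.𝕂
        module H = HermitianForms 𝔽 E A.extension
        Eⱽ = Vecᵉ E n

        re im : ∀ {n} → Vec A.K n → V n
        re = Vec.map proj₁
        im = Vec.map proj₂

        re-⊕ : ∀ {n} (u v : VK.V n) → re (u VK.⊕ v) ≡ re u ⊕ re v
        re-⊕ []      []      = refl
        re-⊕ (x ∷ u) (y ∷ v) = cong (_ ∷_) (re-⊕ u v)

        im-⊕ : ∀ {n} (u v : VK.V n) → im (u VK.⊕ v) ≡ im u ⊕ im v
        im-⊕ []      []      = refl
        im-⊕ (x ∷ u) (y ∷ v) = cong (_ ∷_) (im-⊕ u v)

        re-⊙ : ∀ {n} p r (u : VK.V n) → re ((p , r) VK.⊙ u) ≡ p ⊙ re u ⊕ (- (c * r)) ⊙ im u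
        re-⊙ p r []            = refl
        re-⊙ p r ((x , w) ∷ u) = cong₂ _∷_
          (solve 5 (λ c p r x w → p :* x :- c :* (r :* w) := p :* x :+ (:- (c :* r)) :* w) refl c p r x w) (re-⊙ p r u)

        im-⊙ : ∀ {n} p r (u : VK.V n) → im ((p , r) VK.⊙ u) ≡ r ⊙ re u ⊕ (p + r) ⊙ im u
        im-⊙ p r []            = refl
        im-⊙ p r ((x , w) ∷ u) = cong₂ _∷_
          (solve 4 (λ p r x w → p :* w :+ r :* x :+ r :* w := r :* x :+ (p :+ r) :* w) refl p r x w) (im-⊙ p r u)

        real : ∀ {n} → V n → Vec A.K n
        real = Vec.map A.ι

        re-real : ∀ {n} (v : V n) → re (real v) ≡ v
        re-real []      = refl
        re-real (x ∷ v) = cong (x ∷_) (re-real v)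

        im-real : ∀ {n} (v : V n) → im (real v) ≡ 𝟎
        im-real []      = refl
        im-real (x ∷ v) = cong (0# ∷_) (im-real v)

        ∑-re-im : ∀ n (f : V n → V n → ℤ) → ∑∈ (Vecᵉ A.EK n) (λ z → f (re z) (im z)) ≡ ∑V (λ x → ∑V (f x))
        ∑-re-im zero f = sym (ℤP.+-identityʳ _)
        ∑-re-im (suc n) f = begin
          ∑∈ (Vecᵉ A.EK (suc n)) (λ z → f (re z) (im z))
            ≡⟨ trans (∑-∷ A.EK n _) (∑-× E E _) ⟩
          ∑F (λ x → ∑F (λ w → ∑∈ (Vecᵉ A.EK n) (λ z → f (x ∷ re z) (w ∷ im z))))
            ≡⟨ ∑-cong (elems E) (λ x → trans (∑-cong (elems E) (λ w → ∑-re-im n (λ u v → f (x ∷ u) (w ∷ v))))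
                 (∑-comm (elems E) (elems (Vecᵉ E n)) (λ w u → ∑V (λ v → f (x ∷ u) (w ∷ v))))) ⟩
          ∑F (λ x → ∑V (λ u → ∑F (λ w → ∑V (λ v → f (x ∷ u) (w ∷ v)))))
            ≡⟨ ∑-cong (elems E) (λ x → ∑-cong (elems (Vecᵉ E n)) (λ u → sym (∑-∷ E n (f (x ∷ u))))) ⟩
          ∑F (λ x → ∑V (λ u → ∑V (f (x ∷ u))))
            ≡⟨ sym (∑-∷ E n (λ u → ∑V (f u))) ⟩
          ∑V (λ x → ∑V (f x)) ∎
          where open ≡-Reasoning

        β-𝟎ʳ : ∀ x → β x 𝟎 ≡ 0#
        β-𝟎ʳ x = +-cancel-0 (trans (sym (β-⊕ʳ x 𝟎 𝟎)) (cong (β x) (⊕-identityʳ 𝟎)))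

        -- The coordinates of the sesquilinear extension β(x , x′) + σ(θ) β(x , w′) + θ β(w , x′) +
        -- θσ(θ) β(w , w′), expanded by σ(θ) = 1 - θ and θσ(θ) = c. On the diagonal the θ-coordinate
        -- cancels by symmetry.
        b₁ b₂ : V n → V n → V n → V n → Carrier
        b₁ x w x′ w′ = β x x′ + β x w′ + c * β w w′
        b₂ x w x′ w′ = β w x′ + - β x w′

        β-⊕⊙ˡ : ∀ s t u v w → β (s ⊙ u ⊕ t ⊙ v) w ≡ s * β u w + t * β v w
        β-⊕⊙ˡ s t u v w = trans (β-⊕ˡ _ _ w) (cong₂ _+_ (β-⊙ˡ s u w) (β-⊙ˡ t v w))

      hermitian : H.Hermitian n
      hermitian = record
        { b = λ z y → b₁ (re z) (im z) (re y) (im y) , b₂ (re z) (im z) (re y) (im y)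
        ; h = λ z → β (re z) (re z) + β (re z) (im z) + c * β (im z) (im z)
        ; b-⊕ˡ = λ u v w → trans (cong₂ (λ x y → b₁ x y (re w) (im w) , b₂ x y (re w) (im w)) (re-⊕ u v) (im-⊕ u v))
            (additive (re u) (im u) (re v) (im v) (re w) (im w))
        ; b-⊙ˡ = λ (p , r) u w → trans (cong₂ (λ x y → b₁ x y (re w) (im w) , b₂ x y (re w) (im w)) (re-⊙ p r u) (im-⊙ p r u))
            (homogeneous p r (re u) (im u) (re w) (im w))
        ; b-sym = λ u v → conjugate (re u) (im u) (re v) (im v)
        ; b-diag = λ v → cong (β (re v) (re v) + β (re v) (im v) + c * β (im v) (im v) ,_) (trans (cong (_+ - β (re v) (im v)) (β-sym (im v) (re v))) (-‿inverseʳ _)) }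
        where
        additive : ∀ x w x′ w′ y u → (b₁ (x ⊕ x′) (w ⊕ w′) y u , b₂ (x ⊕ x′) (w ⊕ w′) y u) ≡
                                     (b₁ x w y u + b₁ x′ w′ y u , b₂ x w y u + b₂ x′ w′ y u)
        additive x w x′ w′ y u rewrite β-⊕ˡ x x′ y | β-⊕ˡ x x′ u | β-⊕ˡ w w′ y | β-⊕ˡ w w′ u = cong₂ _,_
          (solve 7 (λ c xy x′y xu x′u wu w′u → (xy :+ x′y) :+ (xu :+ x′u) :+ c :* (wu :+ w′u) :=
             (xy :+ xu :+ c :* wu) :+ (x′y :+ x′u :+ c :* w′u)) refl c (β x y) (β x′ y) (β x u) (β x′ u) (β w u) (β w′ u))
          (solve 4 (λ wy w′y xu x′u → (wy :+ w′y) :- (xu :+ x′u) := (wy :- xu) :+ (w′y :- x′u)) refl (β w y) (β w′ y) (β x u) (β x′ u))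
        homogeneous : ∀ p r x w y u →
          (b₁ (p ⊙ x ⊕ (- (c * r)) ⊙ w) (r ⊙ x ⊕ (p + r) ⊙ w) y u , b₂ (p ⊙ x ⊕ (- (c * r)) ⊙ w) (r ⊙ x ⊕ (p + r) ⊙ w) y u) ≡
          (p , r) A.*ᴷ (b₁ x w y u , b₂ x w y u)
        homogeneous p r x w y u
          rewrite β-⊕⊙ˡ p (- (c * r)) x w y | β-⊕⊙ˡ p (- (c * r)) x w u | β-⊕⊙ˡ r (p + r) x w y | β-⊕⊙ˡ r (p + r) x w u = cong₂ _,_
          (solve 7 (λ c p r xy xu wy wu → (p :* xy :+ (:- (c :* r)) :* wy) :+ (p :* xu :+ (:- (c :* r)) :* wu) :+ c :* (r :* xu :+ (p :+ r) :* wu) :=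
             p :* (xy :+ xu :+ c :* wu) :- c :* (r :* (wy :- xu))) refl c p r (β x y) (β x u) (β w y) (β w u))
          (solve 7 (λ c p r xy xu wy wu → (r :* xy :+ (p :+ r) :* wy) :- (p :* xu :+ (:- (c :* r)) :* wu) :=
             p :* (wy :- xu) :+ r :* (xy :+ xu :+ c :* wu) :+ r :* (wy :- xu)) refl c p r (β x y) (β x u) (β w y) (β w u))
        conjugate : ∀ x w x′ w′ → (b₁ x′ w′ x w , b₂ x′ w′ x w) ≡ A.σ (b₁ x w x′ w′ , b₂ x w x′ w′)
        conjugate x w x′ w′ rewrite β-sym x′ x | β-sym x′ w | β-sym w′ w | β-sym w′ x = cong₂ _,_
          (solve 5 (λ c xx xw wx ww → xx :+ wx :+ c :* ww := (xx :+ xw :+ c :* ww) :+ (wx :- xw)) refl c (β x x′) (β x w′) (β w x′) (β w w′))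
          (solve 2 (λ xw wx → xw :- wx := :- (wx :- xw)) refl (β x w′) (β w x′))

      normSum : ℤ
      normSum = ∑V (λ x → ∑V (λ w → g (β x x + β x w + c * β w w)))

      private
        module HB = H.Hermitian hermitian

        normSum-hermitian : HB.normSum ≡ normSum
        normSum-hermitian = ∑-re-im n (λ x w → g (β x x + β x w + c * β w w))

        0ᴷ : A.K
        0ᴷ = 0# , 0#

        hermitian-radical? : ∀ z → Dec (∀ u → HB.b z u ≡ 0ᴷ)
        hermitian-radical? z = Enumeration.all? (Vecᵉ A.EK n) (λ u → HB.b z u A.≟ᴷ 0ᴷ)

        -- The radical of the extension is the extension of the radical: paired with a real vector
        -- y, the form has β(re z , y) and β(im z , y) as its two coordinates. Hence the square of
        -- `radicalSize` below.
        ρ-hermitian : ∀ z → 𝟙 (hermitian-radical? z) ≡ ρ (re z) ℤ.* ρ (im z)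
        ρ-hermitian z = trans (𝟙-⇔ (hermitian-radical? z) (radical? (re z) ×-dec radical? (im z)) to from)
                              (𝟙-× (radical? (re z)) (radical? (im z)))
          where
          b-real : ∀ y → HB.b z (real y) ≡ (β (re z) y , β (im z) y)
          b-real y rewrite re-real y | im-real y | β-𝟎ʳ (re z) | β-𝟎ʳ (im z) = cong₂ _,_
            (solve 2 (λ c x → x :+ con 0ℤ :+ c :* con 0ℤ := x) refl c (β (re z) y))
            (solve 1 (λ x → x :- con 0ℤ := x) refl (β (im z) y))
          to : (∀ u → HB.b z u ≡ 0ᴷ) → (∀ y → β (re z) y ≡ 0#) × (∀ y → β (im z) y ≡ 0#)
          to z⊥ = (λ y → cong proj₁ (trans (sym (b-real y)) (z⊥ (real y))))
                , (λ y → cong proj₂ (trans (sym (b-real y)) (z⊥ (real y))))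
          from : (∀ y → β (re z) y ≡ 0#) × (∀ y → β (im z) y ≡ 0#) → ∀ u → HB.b z u ≡ 0ᴷ
          from (x⊥ , w⊥) u rewrite x⊥ (re u) | x⊥ (im u) | w⊥ (re u) | w⊥ (im u) = cong₂ _,_
            (solve 1 (λ c → con 0ℤ :+ con 0ℤ :+ c :* con 0ℤ := con 0ℤ) refl c)
            (solve 0 (con 0ℤ :- con 0ℤ := con 0ℤ) refl)

        Q : ℤ
        Q = q ℤ.^ n

        traceSum-hermitian : HB.traceSum ≡ (q ℤ.- 1ℤ) ℤ.* (Q ℤ.* Q) ℤ.* (radicalSize ℤ.* radicalSize)
        traceSum-hermitian = begin
          HB.traceSum
            ≡⟨ ∑-cong (elems (Vecᵉ A.EK n)) (λ z → trans (HB.∑-trace-radical z (hermitian-radical? z)) (cong (M ℤ.*_) (ρ-hermitian z))) ⟩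
          ∑∈ (Vecᵉ A.EK n) (λ z → M ℤ.* (ρ (re z) ℤ.* ρ (im z)))
            ≡⟨ ∑-*ˡ (elems (Vecᵉ A.EK n)) M _ ⟩
          M ℤ.* ∑∈ (Vecᵉ A.EK n) (λ z → ρ (re z) ℤ.* ρ (im z))
            ≡⟨ cong (M ℤ.*_) (∑-re-im n (λ x w → ρ x ℤ.* ρ w)) ⟩
          M ℤ.* ∑V (λ x → ∑V (λ w → ρ x ℤ.* ρ w))
            ≡⟨ cong (M ℤ.*_) (trans (∑-cong (elems Eⱽ) (λ x → ∑-*ˡ (elems Eⱽ) (ρ x) ρ)) (∑-*ʳ (elems Eⱽ) radicalSize ρ)) ⟩
          M ℤ.* (radicalSize ℤ.* radicalSize) ∎
          where
          open ≡-Reasoning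
          M = (q ℤ.- 1ℤ) ℤ.* (Q ℤ.* Q)

      -- The trace sum is known twice: from the induction as (q - 1) q^(2n + 2k), and from the
      -- radical as (q - 1) q^(2n) times the square of its size. Comparison ties the exponent of the
      -- norm sum to the size of the radical of β.
      radical-dimension : ∃ λ k → radicalSize ≡ q ℤ.^ k × normSum ≡ (q ℤ.- 1ℤ) ℤ.* (ℤ.- q) ℤ.^ (n ℕ.+ k)
      radical-dimension with H.character-sums n hermitian
      ... | k , norm≡ , trace≡ = k , ℤ-square-injective radicalSize-nonneg (q^-nonneg k) R²≡ , trans (sym normSum-hermitian) norm≡
        where
        open ≡-Reasoning
        R = radicalSize
        arith : ∀ p Q r → p ℤ.* (Q ℤ.* r ℤ.* (Q ℤ.* r)) ≡ p ℤ.* (Q ℤ.* Q) ℤ.* (r ℤ.* r)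
        arith = ℤS.solve-∀
        instance
          M-nonZero : ℤ.NonZero ((q ℤ.- 1ℤ) ℤ.* (Q ℤ.* Q))
          M-nonZero = ℤP.i*j≢0 (q ℤ.- 1ℤ) (Q ℤ.* Q) {{q-1-nonZero}} {{ℤP.i*j≢0 Q Q {{q^-nonZero n}} {{q^-nonZero n}}}}
        R²≡ : R ℤ.* R ≡ q ℤ.^ k ℤ.* q ℤ.^ k
        R²≡ = ℤP.*-cancelˡ-≡ ((q ℤ.- 1ℤ) ℤ.* (Q ℤ.* Q)) (R ℤ.* R) (q ℤ.^ k ℤ.* q ℤ.^ k) (begin
          (q ℤ.- 1ℤ) ℤ.* (Q ℤ.* Q) ℤ.* (R ℤ.* R)                    ≡⟨ sym traceSum-hermitian ⟩
          HB.traceSum                                               ≡⟨ trace≡ ⟩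
          (q ℤ.- 1ℤ) ℤ.* (q ℤ.^ (n ℕ.+ k) ℤ.* q ℤ.^ (n ℕ.+ k))      ≡⟨ cong (λ t → (q ℤ.- 1ℤ) ℤ.* (t ℤ.* t)) (ℤP.^-distribˡ-+-* q n k) ⟩
          (q ℤ.- 1ℤ) ℤ.* (Q ℤ.* q ℤ.^ k ℤ.* (Q ℤ.* q ℤ.^ k))        ≡⟨ arith (q ℤ.- 1ℤ) Q (q ℤ.^ k) ⟩
          (q ℤ.- 1ℤ) ℤ.* (Q ℤ.* Q) ℤ.* (q ℤ.^ k ℤ.* q ℤ.^ k)        ∎)

-- Counting functionals on the square of a Sidon space

-- The multiplication A × A → A² of a Sidon space A, in coordinates.
record SidonProduct (𝔽 : Field) (E : Enumeration (Field.Carrier 𝔽)) (n m : ℕ) : Set where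
  open FiniteFieldTheory 𝔽 E
  field
    μ       : V n → V n → V m
    μ-⊕ˡ    : ∀ u v w → μ (u ⊕ v) w ≡ μ u w ⊕ μ v w
    μ-⊙ˡ    : ∀ t u v → μ (t ⊙ u) v ≡ t ⊙ μ u v
    μ-comm  : ∀ u v → μ u v ≡ μ v u
    μ-zero  : ∀ x y → μ x y ≡ 𝟎 → x ≡ 𝟎 ⊎ y ≡ 𝟎
    -- The quadratic may well have roots in L; that no solution lies in A comes from the Sidon
    -- property and not from the irreducibility over F alone.
    μ-norm  : ∀ c → Irreducible c → ∀ x w → μ x x ⊕ μ x w ⊕ c ⊙ μ w w ≡ 𝟎 → x ≡ 𝟎 × w ≡ 𝟎
    -- The kernel of (x , y) ↦ ax + by is reduced to the trivial line through (b , -a), so aA + bA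
    -- has dimension 2n - 1.
    μ-sidon : ∀ a b → ¬ (a ≡ 𝟎) → (∀ t → ¬ (b ≡ t ⊙ a)) → ∀ x y → μ a x ⊕ μ b y ≡ 𝟎 →
              ∃ λ t → x ≡ t ⊙ b × y ≡ (- t) ⊙ a

module IrreducibleQuadratic (𝔽 : Field) (E : Enumeration (Field.Carrier 𝔽)) where
  open FiniteFieldTheory 𝔽 E

  -- s ↦ s² + s takes the value 0 at both 0 and -1, so it is not surjective.
  irreducible-quadratic : ∃ Irreducible
  irreducible-quadratic with Enumeration.any? E (λ c → Enumeration.all? E (λ s → Dec.¬? (s * s + s + c ≟ 0#)))
  ... | yes found = found
  -- Pairs (s , c) with s² + s + c = 0 number q, one for each s. If every c had a root, the two
  -- roots at c = 0 would bring their number to at least q + 1.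
  ... | no ¬found = ⊥-elim (ℤP.<⇒≱ (ℤP.suc[i]≤j⇒i<j (ℤP.≤-refl {1ℤ ℤ.+ q})) (subst₂ ℤ._≤_ lower upper (∑-mono (elems E) bound)))
    where
    roots : Carrier → ℤ
    roots c = ∑F (λ s → 𝟙 (s * s + s + c ≟ 0#))
    lower : ∑F (λ c → 𝟙 (c ≟ 0#) ℤ.+ 1ℤ) ≡ 1ℤ ℤ.+ q
    lower = trans (∑-+ (elems E) _ _) (cong (ℤ._+ q) (∑-δ E 0#))
    upper : ∑F roots ≡ q
    upper = trans (∑-comm (elems E) (elems E) _) (∑-cong (elems E) (λ s →
      trans (∑-cong (elems E) (λ c → 𝟙-⇔ (s * s + s + c ≟ 0#) (c ≟ - (s * s + s))
               (λ e → x-y≡0⇒x≡y (trans (solve 2 (λ s c → c :- (:- (s :* s :+ s)) := s :* s :+ s :+ c) refl s c) e))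
               (λ e → trans (cong (s * s + s +_) e) (-‿inverseʳ _))))
            (∑-δ E (- (s * s + s)))))
    two-roots : ∑F (λ s → 𝟙 (s ≟ 0#) ℤ.+ 𝟙 (s ≟ - 1#)) ≡ ℤ.+ 2
    two-roots = trans (∑-+ (elems E) _ _) (cong₂ ℤ._+_ (∑-δ E 0#) (∑-δ E (- 1#)))
    -1≢0 : ¬ (0# ≡ - 1#)
    -1≢0 e = 0≢1 (trans (solve 0 (con 0ℤ := :- con 0ℤ) refl) (trans (cong -_ e) (solve 1 (λ o → :- (:- o) := o) refl 1#)))
    root? : ∀ c → Dec (∃ λ s → s * s + s + c ≡ 0#)
    root? c = Enumeration.any? E (λ s → s * s + s + c ≟ 0#)
    bound : ∀ c → 𝟙 (c ≟ 0#) ℤ.+ 1ℤ ℤ.≤ roots c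
    bound c with c ≟ 0#
    ... | yes refl = subst (ℤ._≤ roots 0#) two-roots (∑-mono (elems E) at)
      where
      at : ∀ s → 𝟙 (s ≟ 0#) ℤ.+ 𝟙 (s ≟ - 1#) ℤ.≤ 𝟙 (s * s + s + 0# ≟ 0#)
      at s with s ≟ 0# | s ≟ - 1#
      ... | yes refl | yes 0≡-1 = ⊥-elim (-1≢0 0≡-1)
      ... | yes refl | no _     = ℤP.≤-reflexive (sym (𝟙-yes (0# * 0# + 0# + 0# ≟ 0#) (solve 0 (con 0ℤ :* con 0ℤ :+ con 0ℤ :+ con 0ℤ := con 0ℤ) refl)))
      ... | no _     | yes refl = ℤP.≤-reflexive (sym (𝟙-yes ((- 1#) * (- 1#) + - 1# + 0# ≟ 0#) (solve 0 ((:- con 1ℤ) :* (:- con 1ℤ) :+ :- con 1ℤ :+ con 0ℤ := con 0ℤ) refl)))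
      ... | no _     | no _     = 𝟙-nonneg (s * s + s + 0# ≟ 0#)
    ... | no _ = 𝟙-≤-∑ E (yes tt) (λ s → s * s + s + c ≟ 0#) (λ _ → Dec.decidable-stable (root? c)
                   (λ ¬root → ¬found (c , λ s e → ¬root (s , e))))

-- Moments of the corank over all functionals

module SidonCounting (𝔽 : Field) (E : Enumeration (Field.Carrier 𝔽)) {n m : ℕ} (S : SidonProduct 𝔽 E n m) where
  open FiniteFieldTheory 𝔽 E
  open SymmetricForms 𝔽 E
  open IrreducibleQuadratic 𝔽 E
  open SidonProduct S

  private
    Eₙ = Vecᵉ E n
    Eₘ = Vecᵉ E m
    Q M : ℤ
    Q = q ℤ.^ n
    M = q ℤ.^ m
    c = proj₁ irreducible-quadratic
    irreducible = proj₂ irreducible-quadratic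

  form : V m → SymmetricForm n
  form φ = record
    { β     = λ x y → dot φ (μ x y)
    ; β-⊕ˡ  = λ u v w → trans (cong (dot φ) (μ-⊕ˡ u v w)) (dot-⊕ʳ φ _ _)
    ; β-⊙ˡ  = λ t u v → trans (cong (dot φ) (μ-⊙ˡ t u v)) (dot-⊙ʳ t φ _)
    ; β-sym = λ u v → cong (dot φ) (μ-comm u v) }

  private module Form φ = SymmetricForm (form φ)

  productSum normSum : V m → ℤ
  productSum φ = ∑V {n} (λ x → ∑V (λ y → g (dot φ (μ x y))))
  normSum φ = Form.normSum φ c irreducible

  -- L has no zero divisors, so xy = 0 has 2Q - 1 solutions: Q with x = 0, and Q - 1 more with y =
  -- 0.
  ∑-productSum : ∑V productSum ≡ (q ℤ.- 1ℤ) ℤ.* M ℤ.* (Q ℤ.+ Q ℤ.- 1ℤ)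
  ∑-productSum = begin
    ∑V (λ φ → ∑V {n} (λ x → ∑V (λ y → g (dot φ (μ x y)))))
      ≡⟨ trans (∑-comm (elems Eₘ) (elems Eₙ) _) (∑-cong (elems Eₙ) (λ x → ∑-comm (elems Eₘ) (elems Eₙ) _)) ⟩
    ∑V {n} (λ x → ∑V {n} (λ y → ∑V (λ φ → g (dot φ (μ x y)))))
      ≡⟨ ∑-cong (elems Eₙ) (λ x → trans (∑-cong (elems Eₙ) (λ y → trans (∑V-dot (μ x y)) (cong ((q ℤ.- 1ℤ) ℤ.* M ℤ.*_) (indicator x y))))
           (∑-*ˡ (elems Eₙ) ((q ℤ.- 1ℤ) ℤ.* M) _)) ⟩
    ∑V {n} (λ x → (q ℤ.- 1ℤ) ℤ.* M ℤ.* ∑V {n} (λ y → 𝟙 (x ≟ᵥ 𝟎) ℤ.+ (1ℤ ℤ.- 𝟙 (x ≟ᵥ 𝟎)) ℤ.* 𝟙 (y ≟ᵥ 𝟎)))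
      ≡⟨ ∑-*ˡ (elems Eₙ) ((q ℤ.- 1ℤ) ℤ.* M) _ ⟩
    (q ℤ.- 1ℤ) ℤ.* M ℤ.* ∑V {n} (λ x → ∑V {n} (λ y → 𝟙 (x ≟ᵥ 𝟎) ℤ.+ (1ℤ ℤ.- 𝟙 (x ≟ᵥ 𝟎)) ℤ.* 𝟙 (y ≟ᵥ 𝟎)))
      ≡⟨ cong ((q ℤ.- 1ℤ) ℤ.* M ℤ.*_) (trans (∑-cong (elems Eₙ) row) count) ⟩
    (q ℤ.- 1ℤ) ℤ.* M ℤ.* (Q ℤ.+ Q ℤ.- 1ℤ) ∎
    where
    open ≡-Reasoning
    𝟙-zero-product : ∀ {P₁ P₂ P₃ : Set} (d₁ : Dec P₁) (d₂ : Dec P₂) (d₃ : Dec P₃) → (P₁ → P₂ ⊎ P₃) → (P₂ → P₁) → (P₃ → P₁) →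
      𝟙 d₁ ≡ 𝟙 d₂ ℤ.+ (1ℤ ℤ.- 𝟙 d₂) ℤ.* 𝟙 d₃
    𝟙-zero-product d₁ (yes p₂) (yes _)  _ f _ = 𝟙-yes d₁ (f p₂)
    𝟙-zero-product d₁ (yes p₂) (no _)   _ f _ = 𝟙-yes d₁ (f p₂)
    𝟙-zero-product d₁ (no _)   (yes p₃) _ _ f = 𝟙-yes d₁ (f p₃)
    𝟙-zero-product d₁ (no ¬p₂) (no ¬p₃) f _ _ = 𝟙-no d₁ (λ p₁ → [ ¬p₂ , ¬p₃ ]′ (f p₁))
    μ-𝟎ˡ : ∀ y → μ 𝟎 y ≡ 𝟎
    μ-𝟎ˡ y = trans (cong (λ x → μ x y) (sym (⊙-zeroˡ 𝟎))) (trans (μ-⊙ˡ 0# 𝟎 y) (⊙-zeroˡ _))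
    indicator : ∀ x y → 𝟙 (μ x y ≟ᵥ 𝟎) ≡ 𝟙 (x ≟ᵥ 𝟎) ℤ.+ (1ℤ ℤ.- 𝟙 (x ≟ᵥ 𝟎)) ℤ.* 𝟙 (y ≟ᵥ 𝟎)
    indicator x y = 𝟙-zero-product (μ x y ≟ᵥ 𝟎) (x ≟ᵥ 𝟎) (y ≟ᵥ 𝟎) (μ-zero x y)
      (λ e → trans (cong (λ z → μ z y) e) (μ-𝟎ˡ y)) (λ e → trans (cong (μ x) e) (trans (μ-comm x 𝟎) (μ-𝟎ˡ x)))
    row : ∀ x → ∑V {n} (λ y → 𝟙 (x ≟ᵥ 𝟎) ℤ.+ (1ℤ ℤ.- 𝟙 (x ≟ᵥ 𝟎)) ℤ.* 𝟙 (y ≟ᵥ 𝟎)) ≡ (Q ℤ.- 1ℤ) ℤ.* 𝟙 (x ≟ᵥ 𝟎) ℤ.+ 1ℤ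
    row x = trans (∑-+ (elems Eₙ) _ _) (trans (cong₂ ℤ._+_ (∑V-const {n} (𝟙 (x ≟ᵥ 𝟎)))
      (trans (∑-*ˡ (elems Eₙ) (1ℤ ℤ.- 𝟙 (x ≟ᵥ 𝟎)) _) (cong ((1ℤ ℤ.- 𝟙 (x ≟ᵥ 𝟎)) ℤ.*_) (∑-δ Eₙ 𝟎)))) (arith (𝟙 (x ≟ᵥ 𝟎)) Q))
      where
      arith : ∀ d Q → d ℤ.* Q ℤ.+ (1ℤ ℤ.- d) ℤ.* 1ℤ ≡ (Q ℤ.- 1ℤ) ℤ.* d ℤ.+ 1ℤ
      arith = ℤS.solve-∀
    count : ∑V {n} (λ x → (Q ℤ.- 1ℤ) ℤ.* 𝟙 (x ≟ᵥ 𝟎) ℤ.+ 1ℤ) ≡ Q ℤ.+ Q ℤ.- 1ℤ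
    count = trans (∑-+ (elems Eₙ) _ _) (trans (cong₂ ℤ._+_
      (trans (∑-*ˡ (elems Eₙ) (Q ℤ.- 1ℤ) _) (cong ((Q ℤ.- 1ℤ) ℤ.*_) (∑-δ Eₙ 𝟎))) (card-Vec E n)) (arith Q))
      where
      arith : ∀ Q → (Q ℤ.- 1ℤ) ℤ.* 1ℤ ℤ.+ Q ≡ Q ℤ.+ Q ℤ.- 1ℤ
      arith = ℤS.solve-∀

  -- By `μ-norm` only the pair (0 , 0) survives the sum over φ.
  ∑-normSum : ∑V normSum ≡ (q ℤ.- 1ℤ) ℤ.* M
  ∑-normSum = begin
    ∑V normSum
      ≡⟨ trans (∑-comm (elems Eₘ) (elems Eₙ) _) (∑-cong (elems Eₙ) (λ x → ∑-comm (elems Eₘ) (elems Eₙ) _)) ⟩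
    ∑V {n} (λ x → ∑V {n} (λ w → ∑V (λ φ → g (dot φ (μ x x) + dot φ (μ x w) + c * dot φ (μ w w)))))
      ≡⟨ ∑-cong (elems Eₙ) (λ x → trans (∑-cong (elems Eₙ) (λ w → trans (∑-cong (elems Eₘ) (λ φ → cong g (collect φ x w)))
           (trans (∑V-dot (N x w)) (trans (cong ((q ℤ.- 1ℤ) ℤ.* M ℤ.*_) (indicator x w)) (sym (ℤP.*-assoc ((q ℤ.- 1ℤ) ℤ.* M) _ _))))))
           (trans (∑-*ˡ (elems Eₙ) ((q ℤ.- 1ℤ) ℤ.* M ℤ.* 𝟙 (x ≟ᵥ 𝟎)) _)
             (trans (cong ((q ℤ.- 1ℤ) ℤ.* M ℤ.* 𝟙 (x ≟ᵥ 𝟎) ℤ.*_) (∑-δ Eₙ 𝟎)) (ℤP.*-identityʳ _)))) ⟩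
    ∑V {n} (λ x → (q ℤ.- 1ℤ) ℤ.* M ℤ.* 𝟙 (x ≟ᵥ 𝟎))
      ≡⟨ trans (∑-*ˡ (elems Eₙ) ((q ℤ.- 1ℤ) ℤ.* M) _) (trans (cong ((q ℤ.- 1ℤ) ℤ.* M ℤ.*_) (∑-δ Eₙ 𝟎)) (ℤP.*-identityʳ _)) ⟩
    (q ℤ.- 1ℤ) ℤ.* M ∎
    where
    open ≡-Reasoning
    N : V n → V n → V m
    N x w = μ x x ⊕ μ x w ⊕ c ⊙ μ w w
    collect : ∀ φ x w → dot φ (μ x x) + dot φ (μ x w) + c * dot φ (μ w w) ≡ dot φ (N x w)
    collect φ x w = sym (trans (dot-⊕ʳ φ _ _) (cong₂ _+_ (dot-⊕ʳ φ _ _) (dot-⊙ʳ c φ _)))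
    μ-𝟎𝟎 : μ 𝟎 𝟎 ≡ 𝟎
    μ-𝟎𝟎 = trans (cong (λ x → μ x 𝟎) (sym (⊙-zeroˡ 𝟎))) (trans (μ-⊙ˡ 0# 𝟎 𝟎) (⊙-zeroˡ _))
    indicator : ∀ x w → 𝟙 (N x w ≟ᵥ 𝟎) ≡ 𝟙 (x ≟ᵥ 𝟎) ℤ.* 𝟙 (w ≟ᵥ 𝟎)
    indicator x w = trans (𝟙-⇔ (N x w ≟ᵥ 𝟎) (x ≟ᵥ 𝟎 ×-dec w ≟ᵥ 𝟎) (μ-norm c irreducible x w)
      (λ { (refl , refl) → trans (cong (λ z → z ⊕ z ⊕ c ⊙ z) μ-𝟎𝟎) (trans (cong₂ _⊕_ (⊕-identityʳ 𝟎) (⊙-zeroʳ c)) (⊕-identityʳ 𝟎)) }))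
      (𝟙-× (x ≟ᵥ 𝟎) (w ≟ᵥ 𝟎))

  Independent : V n → V n → Set
  Independent a b = ¬ (a ≡ 𝟎) × (∀ t → ¬ (b ≡ t ⊙ a))

  -- The map (x , y) ↦ ax + by has a kernel of at most q elements; the sum on the left counts the functionals
  -- that vanish on its image aA + bA.
  pencil-bound : ∀ a b → Independent a b → Q ℤ.* Q ℤ.* ∑V (λ ψ → Form.ρ ψ b ℤ.* Form.ρ ψ a) ℤ.≤ q ℤ.* M
  pencil-bound a b (a≢0 , indep) = ℤP.*-cancelˡ-≤-pos (Q ℤ.* Q ℤ.* ∑V (λ ψ → Form.ρ ψ b ℤ.* Form.ρ ψ a)) (q ℤ.* M) (q ℤ.- 1ℤ) {{ℤ.positive 0<q-1}}
    (subst₂ ℤ._≤_ (sym byForms) byPairs (∑-mono (elems Eₙ) (λ x → ∑-mono (elems Eₙ) (λ y → bound x y))))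
    where
    open ≡-Reasoning
    zero? : ∀ x y → Dec (μ a x ⊕ μ b y ≡ 𝟎)
    zero? x y = μ a x ⊕ μ b y ≟ᵥ 𝟎
    -- A functional ψ annihilates aA + bA exactly when a and b both lie in the radical of its form,
    -- which the product of the two values of ρ records.
    perForm : ∀ ψ → ∑V {n} (λ x → ∑V {n} (λ y → g (dot ψ (μ a x ⊕ μ b y)))) ≡ (q ℤ.- 1ℤ) ℤ.* (Q ℤ.* Q) ℤ.* (Form.ρ ψ b ℤ.* Form.ρ ψ a)
    perForm ψ = begin
      ∑V {n} (λ x → ∑V {n} (λ y → g (dot ψ (μ a x ⊕ μ b y))))
        ≡⟨ ∑-cong (elems Eₙ) (λ x → trans (∑-cong (elems Eₙ) (λ y → cong g (trans (dot-⊕ʳ ψ _ _) (+-comm _ _))))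
             (trans (Form.∑-row ψ b (dot ψ (μ a x))) (cong (λ t → Q ℤ.* Form.ρ ψ b ℤ.* g t) (sym (+-identityʳ _))))) ⟩
      ∑V {n} (λ x → Q ℤ.* Form.ρ ψ b ℤ.* g (dot ψ (μ a x) + 0#))
        ≡⟨ trans (∑-*ˡ (elems Eₙ) (Q ℤ.* Form.ρ ψ b) _) (cong (Q ℤ.* Form.ρ ψ b ℤ.*_) (trans (Form.∑-row ψ a 0#) (cong (Q ℤ.* Form.ρ ψ a ℤ.*_) g-0))) ⟩
      Q ℤ.* Form.ρ ψ b ℤ.* (Q ℤ.* Form.ρ ψ a ℤ.* (q ℤ.- 1ℤ))
        ≡⟨ arith Q (Form.ρ ψ b) (Form.ρ ψ a) (q ℤ.- 1ℤ) ⟩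
      (q ℤ.- 1ℤ) ℤ.* (Q ℤ.* Q) ℤ.* (Form.ρ ψ b ℤ.* Form.ρ ψ a) ∎
      where
      arith : ∀ Q s t p → Q ℤ.* s ℤ.* (Q ℤ.* t ℤ.* p) ≡ p ℤ.* (Q ℤ.* Q) ℤ.* (s ℤ.* t)
      arith = ℤS.solve-∀
    count : ℤ
    count = ∑V (λ ψ → Form.ρ ψ b ℤ.* Form.ρ ψ a)
    byForms : (q ℤ.- 1ℤ) ℤ.* (Q ℤ.* Q ℤ.* count) ≡ ∑V {n} (λ x → ∑V {n} (λ y → (q ℤ.- 1ℤ) ℤ.* M ℤ.* 𝟙 (zero? x y)))
    byForms = begin
      (q ℤ.- 1ℤ) ℤ.* (Q ℤ.* Q ℤ.* count)
        ≡⟨ trans (sym (ℤP.*-assoc (q ℤ.- 1ℤ) (Q ℤ.* Q) count)) (sym (∑-*ˡ (elems Eₘ) ((q ℤ.- 1ℤ) ℤ.* (Q ℤ.* Q)) _)) ⟩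
      ∑V (λ ψ → (q ℤ.- 1ℤ) ℤ.* (Q ℤ.* Q) ℤ.* (Form.ρ ψ b ℤ.* Form.ρ ψ a))
        ≡⟨ ∑-cong (elems Eₘ) (λ ψ → sym (perForm ψ)) ⟩
      ∑V (λ ψ → ∑V {n} (λ x → ∑V {n} (λ y → g (dot ψ (μ a x ⊕ μ b y)))))
        ≡⟨ trans (∑-comm (elems Eₘ) (elems Eₙ) _) (∑-cong (elems Eₙ) (λ x → ∑-comm (elems Eₘ) (elems Eₙ) _)) ⟩
      ∑V {n} (λ x → ∑V {n} (λ y → ∑V (λ ψ → g (dot ψ (μ a x ⊕ μ b y)))))
        ≡⟨ ∑-cong (elems Eₙ) (λ x → ∑-cong (elems Eₙ) (λ y → ∑V-dot (μ a x ⊕ μ b y))) ⟩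
      ∑V {n} (λ x → ∑V {n} (λ y → (q ℤ.- 1ℤ) ℤ.* M ℤ.* 𝟙 (zero? x y))) ∎
    _≟²_ = Enumeration._≟_ (Eₙ ×ᵉ Eₙ)
    hits : V n → V n → ℤ
    hits x y = ∑F (λ t → 𝟙 ((x , y) ≟² (t ⊙ b , (- t) ⊙ a)))
    bound : ∀ x y → (q ℤ.- 1ℤ) ℤ.* M ℤ.* 𝟙 (zero? x y) ℤ.≤ (q ℤ.- 1ℤ) ℤ.* M ℤ.* hits x y
    bound x y = ℤP.*-monoˡ-≤-nonNeg ((q ℤ.- 1ℤ) ℤ.* M) {{ℤ.nonNegative (ℤP.<⇒≤ 0<M′)}}
      (𝟙-≤-∑ E (zero? x y) (λ t → (x , y) ≟² (t ⊙ b , (- t) ⊙ a))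
        (λ e → let (t , x≡ , y≡) = μ-sidon a b a≢0 indep x y e in t , cong₂ _,_ x≡ y≡))
      where
      0<M′ : 0ℤ ℤ.< (q ℤ.- 1ℤ) ℤ.* M
      0<M′ = subst (ℤ._< (q ℤ.- 1ℤ) ℤ.* M) (ℤP.*-zeroʳ (q ℤ.- 1ℤ)) (ℤP.*-monoˡ-<-pos (q ℤ.- 1ℤ) {{ℤ.positive 0<q-1}} (0<q^ m))
    byPairs : ∑V {n} (λ x → ∑V {n} (λ y → (q ℤ.- 1ℤ) ℤ.* M ℤ.* hits x y)) ≡ (q ℤ.- 1ℤ) ℤ.* (q ℤ.* M)
    byPairs = begin
      ∑V {n} (λ x → ∑V {n} (λ y → (q ℤ.- 1ℤ) ℤ.* M ℤ.* hits x y))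
        ≡⟨ trans (∑-cong (elems Eₙ) (λ x → ∑-*ˡ (elems Eₙ) ((q ℤ.- 1ℤ) ℤ.* M) (hits x))) (∑-*ˡ (elems Eₙ) ((q ℤ.- 1ℤ) ℤ.* M) _) ⟩
      (q ℤ.- 1ℤ) ℤ.* M ℤ.* ∑V {n} (λ x → ∑V {n} (hits x))
        ≡⟨ cong ((q ℤ.- 1ℤ) ℤ.* M ℤ.*_) (trans (sym (∑-× Eₙ Eₙ (λ (x , y) → hits x y))) (trans (∑-comm (elems (Eₙ ×ᵉ Eₙ)) (elems E) _)
             (∑-cong (elems E) (λ t → ∑-δ (Eₙ ×ᵉ Eₙ) (t ⊙ b , (- t) ⊙ a))))) ⟩
      (q ℤ.- 1ℤ) ℤ.* M ℤ.* q
        ≡⟨ arith (q ℤ.- 1ℤ) M q ⟩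
      (q ℤ.- 1ℤ) ℤ.* (q ℤ.* M) ∎
      where
      arith : ∀ p M q → p ℤ.* M ℤ.* q ≡ p ℤ.* (q ℤ.* M)
      arith = ℤS.solve-∀

  zero-form : ∀ x y → dot 𝟎 (μ x y) ≡ 0#
  zero-form x y = dot-𝟎ˡ (μ x y)

  ρ-zero-form : ∀ x → Form.ρ 𝟎 x ≡ 1ℤ
  ρ-zero-form x = 𝟙-yes (Form.radical? 𝟎 x) (zero-form x)

  private
    vanishing-nonneg : ∀ a b ψ → 0ℤ ℤ.≤ Form.ρ ψ b ℤ.* Form.ρ ψ a
    vanishing-nonneg a b ψ = subst (0ℤ ℤ.≤_) (𝟙-× (Form.radical? ψ b) (Form.radical? ψ a))
      (𝟙-nonneg (Form.radical? ψ b ×-dec Form.radical? ψ a))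

  -- The functional 0 annihilates aA + bA, so the count in `pencil-bound` is at least 1. In
  -- exponents this is 2n ≤ m + 1.
  dimension-bound : ∀ a b → Independent a b → Q ℤ.* Q ℤ.≤ q ℤ.* M
  dimension-bound a b indep = ℤP.≤-trans
    (subst (ℤ._≤ Q ℤ.* Q ℤ.* ∑V (λ ψ → Form.ρ ψ b ℤ.* Form.ρ ψ a)) (ℤP.*-identityʳ (Q ℤ.* Q)) (ℤP.*-monoˡ-≤-nonNeg (Q ℤ.* Q) {{QQ≥0}}
      (subst (ℤ._≤ ∑V (λ ψ → Form.ρ ψ b ℤ.* Form.ρ ψ a)) (cong₂ ℤ._*_ (ρ-zero-form b) (ρ-zero-form a))
        (Enumeration.nonneg-summand Eₘ _ (vanishing-nonneg a b) 𝟎))))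
    (pencil-bound a b indep)
    where
    QQ≥0 : ℤ.NonNegative (Q ℤ.* Q)
    QQ≥0 = ℤ.nonNegative (subst (0ℤ ℤ.≤_) (ℤP.^-distribˡ-+-* q n n) (q^-nonneg (n ℕ.+ n)))

  -- In exponents m = 2n - 1, the one value that `dimension-bound` leaves to be excluded.
  module _ (tight : q ℤ.* M ≡ Q ℤ.* Q) where

    -- Independent a and b in the radical of φ would give two functionals, 0 and φ, annihilating aA
    -- + bA, while tightness allows only one because aA + bA then fills the whole space.
    radical-dependent : ∀ φ → ¬ (φ ≡ 𝟎) → ∀ a b → (∀ y → dot φ (μ a y) ≡ 0#) → (∀ y → dot φ (μ b y) ≡ 0#) → ¬ Independent a b
    radical-dependent φ φ≢0 a b a⊥ b⊥ indep = ℤP.<⇒≱ {ℤ.+ 1} {ℤ.+ 2} (ℤ.+<+ (ℕ.s≤s (ℕ.s≤s ℕ.z≤n))) (ℤP.≤-trans two≤ ≤one)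
      where
      count : ℤ
      count = ∑V (λ ψ → Form.ρ ψ b ℤ.* Form.ρ ψ a)
      QQ>0 : ℤ.Positive (Q ℤ.* Q)
      QQ>0 = ℤ.positive (subst (0ℤ ℤ.<_) (ℤP.^-distribˡ-+-* q n n) (0<q^ (n ℕ.+ n)))
      ≤one : count ℤ.≤ 1ℤ
      ≤one = ℤP.*-cancelˡ-≤-pos count 1ℤ (Q ℤ.* Q) {{QQ>0}} (subst (Q ℤ.* Q ℤ.* count ℤ.≤_) (trans tight (sym (ℤP.*-identityʳ _))) (pencil-bound a b indep))
      bound : ∀ ψ → 𝟙 (ψ ≟ᵥ 𝟎) ℤ.+ 𝟙 (ψ ≟ᵥ φ) ℤ.≤ Form.ρ ψ b ℤ.* Form.ρ ψ a
      bound ψ = cases (ψ ≟ᵥ 𝟎) (ψ ≟ᵥ φ)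
        where
        cases : (d : Dec (ψ ≡ 𝟎)) (e : Dec (ψ ≡ φ)) → 𝟙 d ℤ.+ 𝟙 e ℤ.≤ Form.ρ ψ b ℤ.* Form.ρ ψ a
        cases (yes ψ≡0)  (yes ψ≡φ)  = ⊥-elim (φ≢0 (trans (sym ψ≡φ) ψ≡0))
        cases (yes refl) (no _)     = ℤP.≤-reflexive (sym (cong₂ ℤ._*_ (ρ-zero-form b) (ρ-zero-form a)))
        cases (no _)     (yes refl) = ℤP.≤-reflexive (sym (cong₂ ℤ._*_ (𝟙-yes (Form.radical? φ b) b⊥) (𝟙-yes (Form.radical? φ a) a⊥)))
        cases (no _)     (no _)     = vanishing-nonneg a b ψ
      two≤ : ℤ.+ 2 ℤ.≤ count
      two≤ = subst (ℤ._≤ count) (trans (∑-+ (elems Eₘ) _ _) (cong₂ ℤ._+_ (∑-δ Eₘ 𝟎) (∑-δ Eₘ φ))) (∑-mono (elems Eₘ) bound)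

    -- Either the radical is zero, or it lies on the line of any of its nonzero vectors.
    radicalSize≤q : ∀ φ → ¬ (φ ≡ 𝟎) → Form.radicalSize φ ℤ.≤ q
    radicalSize≤q φ φ≢0 with Enumeration.any? Eₙ (λ a → Dec.¬? (a ≟ᵥ 𝟎) ×-dec Form.radical? φ a)
    ... | no ¬a = ℤP.≤-trans (subst (Form.radicalSize φ ℤ.≤_) (∑-δ Eₙ 𝟎) (∑-mono (elems Eₙ) bound)) (ℤP.≤-trans {1ℤ} {ℤ.+ 2} (ℤ.+≤+ (ℕ.s≤s ℕ.z≤n)) 2≤q)
      where
      bound : ∀ x → Form.ρ φ x ℤ.≤ 𝟙 (x ≟ᵥ 𝟎)
      bound x = ℤP.≤-trans (𝟙-≤-+∑ E (Form.radical? φ x) (x ≟ᵥ 𝟎) {R = λ _ → ⊥} (λ _ → no (λ r → r)) (λ x⊥ x≢0 → ⊥-elim (¬a (x , x≢0 , x⊥))))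
        (ℤP.≤-reflexive (trans (cong (λ z → 𝟙 (x ≟ᵥ 𝟎) ℤ.+ z) (∑-zero (elems E))) (ℤP.+-identityʳ _)))
    ... | yes (a , a≢0 , a⊥) = subst (Form.radicalSize φ ℤ.≤_)
            (trans (∑-comm (elems Eₙ) (elems E) _) (∑-cong (elems E) (λ t → ∑-δ Eₙ (t ⊙ a)))) (∑-mono (elems Eₙ) bound)
      where
      bound : ∀ x → Form.ρ φ x ℤ.≤ ∑F (λ t → 𝟙 (x ≟ᵥ t ⊙ a))
      bound x = 𝟙-≤-∑ E (Form.radical? φ x) (λ t → x ≟ᵥ t ⊙ a) (λ x⊥ → Dec.decidable-stable
        (Enumeration.any? E (λ t → x ≟ᵥ t ⊙ a))
        (λ ¬∃ → radical-dependent φ φ≢0 a x a⊥ x⊥ (a≢0 , λ t e → ¬∃ (t , e))))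

    -- ε = (-1)^n.
    corank-relation : ∀ ε → ε ℤ.* ε ≡ 1ℤ → (ℤ.- q) ℤ.^ n ≡ ε ℤ.* Q → ∀ φ → ¬ (φ ≡ 𝟎) →
      (q ℤ.+ 1ℤ) ℤ.* productSum φ ℤ.+ (q ℤ.- 1ℤ) ℤ.* ε ℤ.* normSum φ ≡ (q ℤ.- 1ℤ) ℤ.* (ℤ.+ 2 ℤ.* q ℤ.* Q)
    corank-relation ε ε²≡1 sign φ φ≢0 = begin
      (q ℤ.+ 1ℤ) ℤ.* productSum φ ℤ.+ (q ℤ.- 1ℤ) ℤ.* ε ℤ.* normSum φ
        ≡⟨ cong₂ (λ s t → (q ℤ.+ 1ℤ) ℤ.* s ℤ.+ (q ℤ.- 1ℤ) ℤ.* ε ℤ.* t)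
             (trans (Form.∑-form φ) (cong ((q ℤ.- 1ℤ) ℤ.* Q ℤ.*_) size≡))
             (trans norm≡ (cong ((q ℤ.- 1ℤ) ℤ.*_) (trans (ℤP.^-distribˡ-+-* (ℤ.- q) n k) (cong (ℤ._* (ℤ.- q) ℤ.^ k) sign)))) ⟩
      (q ℤ.+ 1ℤ) ℤ.* ((q ℤ.- 1ℤ) ℤ.* Q ℤ.* q ℤ.^ k) ℤ.+ (q ℤ.- 1ℤ) ℤ.* ε ℤ.* ((q ℤ.- 1ℤ) ℤ.* (ε ℤ.* Q ℤ.* (ℤ.- q) ℤ.^ k))
        ≡⟨ arith q Q ε (q ℤ.^ k) ((ℤ.- q) ℤ.^ k) ⟩
      (q ℤ.- 1ℤ) ℤ.* Q ℤ.* ((q ℤ.+ 1ℤ) ℤ.* q ℤ.^ k ℤ.+ ε ℤ.* ε ℤ.* (q ℤ.- 1ℤ) ℤ.* (ℤ.- q) ℤ.^ k)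
        ≡⟨ cong (λ e → (q ℤ.- 1ℤ) ℤ.* Q ℤ.* ((q ℤ.+ 1ℤ) ℤ.* q ℤ.^ k ℤ.+ e ℤ.* (q ℤ.- 1ℤ) ℤ.* (ℤ.- q) ℤ.^ k)) ε²≡1 ⟩
      (q ℤ.- 1ℤ) ℤ.* Q ℤ.* ((q ℤ.+ 1ℤ) ℤ.* q ℤ.^ k ℤ.+ 1ℤ ℤ.* (q ℤ.- 1ℤ) ℤ.* (ℤ.- q) ℤ.^ k)
        ≡⟨ small k (subst (ℤ._≤ q) size≡ (radicalSize≤q φ φ≢0)) ⟩
      (q ℤ.- 1ℤ) ℤ.* (ℤ.+ 2 ℤ.* q ℤ.* Q) ∎
      where
      open ≡-Reasoning
      dimension = Form.radical-dimension φ c irreducible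
      k = proj₁ dimension
      size≡ = proj₁ (proj₂ dimension)
      norm≡ = proj₂ (proj₂ dimension)
      arith : ∀ q Q ε s t → (q ℤ.+ 1ℤ) ℤ.* ((q ℤ.- 1ℤ) ℤ.* Q ℤ.* s) ℤ.+ (q ℤ.- 1ℤ) ℤ.* ε ℤ.* ((q ℤ.- 1ℤ) ℤ.* (ε ℤ.* Q ℤ.* t)) ≡
                          (q ℤ.- 1ℤ) ℤ.* Q ℤ.* ((q ℤ.+ 1ℤ) ℤ.* s ℤ.+ ε ℤ.* ε ℤ.* (q ℤ.- 1ℤ) ℤ.* t)
      arith = ℤS.solve-∀
      arith₀ : ∀ q Q → (q ℤ.- 1ℤ) ℤ.* Q ℤ.* ((q ℤ.+ 1ℤ) ℤ.* 1ℤ ℤ.+ 1ℤ ℤ.* (q ℤ.- 1ℤ) ℤ.* 1ℤ) ≡ (q ℤ.- 1ℤ) ℤ.* (ℤ.+ 2 ℤ.* q ℤ.* Q)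
      arith₀ = ℤS.solve-∀
      arith₁ : ∀ q Q → (q ℤ.- 1ℤ) ℤ.* Q ℤ.* ((q ℤ.+ 1ℤ) ℤ.* (q ℤ.* 1ℤ) ℤ.+ 1ℤ ℤ.* (q ℤ.- 1ℤ) ℤ.* (ℤ.- q ℤ.* 1ℤ)) ≡ (q ℤ.- 1ℤ) ℤ.* (ℤ.+ 2 ℤ.* q ℤ.* Q)
      arith₁ = ℤS.solve-∀
      -- The weights q + 1 and q - 1 are chosen so that (q + 1) q^k + (q - 1) (-q)^k equals 2q both
      -- for k = 0 and for k = 1; the number of functionals with each corank is thereby eliminated.
      small : ∀ k → q ℤ.^ k ℤ.≤ q → (q ℤ.- 1ℤ) ℤ.* Q ℤ.* ((q ℤ.+ 1ℤ) ℤ.* q ℤ.^ k ℤ.+ 1ℤ ℤ.* (q ℤ.- 1ℤ) ℤ.* (ℤ.- q) ℤ.^ k) ≡ (q ℤ.- 1ℤ) ℤ.* (ℤ.+ 2 ℤ.* q ℤ.* Q)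
      small zero          _ = arith₀ q Q
      small (suc zero)    _ = arith₁ q Q
      small (suc (suc k)) q^k≤q = ⊥-elim (ℤP.<⇒≱ (q^-mono-< {1} {suc (suc k)} (ℕ.s≤s (ℕ.s≤s ℕ.z≤n))) (subst (q ℤ.^ suc (suc k) ℤ.≤_) (sym (ℤP.*-identityʳ q)) q^k≤q))

    -- The corank relation summed over all functionals. The last summand corrects for φ = 0, whose
    -- form vanishes identically and violates the bound on the radical.
    moment-identity : ∀ ε → ε ℤ.* ε ≡ 1ℤ → (ℤ.- q) ℤ.^ n ≡ ε ℤ.* Q →
      (q ℤ.+ 1ℤ) ℤ.* ((q ℤ.- 1ℤ) ℤ.* M ℤ.* (Q ℤ.+ Q ℤ.- 1ℤ)) ℤ.+ (q ℤ.- 1ℤ) ℤ.* ε ℤ.* ((q ℤ.- 1ℤ) ℤ.* M) ≡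
      (q ℤ.- 1ℤ) ℤ.* (ℤ.+ 2 ℤ.* q ℤ.* Q) ℤ.* M ℤ.+
        ((q ℤ.+ 1ℤ) ℤ.* ((q ℤ.- 1ℤ) ℤ.* Q ℤ.* Q) ℤ.+ (q ℤ.- 1ℤ) ℤ.* ε ℤ.* ((q ℤ.- 1ℤ) ℤ.* Q ℤ.* Q) ℤ.- (q ℤ.- 1ℤ) ℤ.* (ℤ.+ 2 ℤ.* q ℤ.* Q))
    moment-identity ε ε²≡1 sign = begin
      (q ℤ.+ 1ℤ) ℤ.* ((q ℤ.- 1ℤ) ℤ.* M ℤ.* (Q ℤ.+ Q ℤ.- 1ℤ)) ℤ.+ (q ℤ.- 1ℤ) ℤ.* ε ℤ.* ((q ℤ.- 1ℤ) ℤ.* M)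
        ≡⟨ sym (cong₂ (λ s t → (q ℤ.+ 1ℤ) ℤ.* s ℤ.+ (q ℤ.- 1ℤ) ℤ.* ε ℤ.* t) ∑-productSum ∑-normSum) ⟩
      (q ℤ.+ 1ℤ) ℤ.* ∑V productSum ℤ.+ (q ℤ.- 1ℤ) ℤ.* ε ℤ.* ∑V normSum
        ≡⟨ sym (trans (∑-+ (elems Eₘ) _ _) (cong₂ ℤ._+_ (∑-*ˡ (elems Eₘ) (q ℤ.+ 1ℤ) productSum) (∑-*ˡ (elems Eₘ) ((q ℤ.- 1ℤ) ℤ.* ε) normSum))) ⟩
      ∑V T
        ≡⟨ ∑-cong (elems Eₘ) (λ φ → split φ (φ ≟ᵥ 𝟎)) ⟩
      ∑V {m} (λ φ → generic ℤ.+ 𝟙 (φ ≟ᵥ 𝟎) ℤ.* (T₀ ℤ.- generic))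
        ≡⟨ trans (∑-+ (elems Eₘ) _ _) (cong₂ ℤ._+_ (∑V-const {m} generic) (Enumeration.∑-δ* Eₘ 𝟎 (λ _ → T₀ ℤ.- generic))) ⟩
      generic ℤ.* M ℤ.+ (T₀ ℤ.- generic) ∎
      where
      open ≡-Reasoning
      generic T₀ : ℤ
      generic = (q ℤ.- 1ℤ) ℤ.* (ℤ.+ 2 ℤ.* q ℤ.* Q)
      T₀ = (q ℤ.+ 1ℤ) ℤ.* ((q ℤ.- 1ℤ) ℤ.* Q ℤ.* Q) ℤ.+ (q ℤ.- 1ℤ) ℤ.* ε ℤ.* ((q ℤ.- 1ℤ) ℤ.* Q ℤ.* Q)
      T : V m → ℤ
      T φ = (q ℤ.+ 1ℤ) ℤ.* productSum φ ℤ.+ (q ℤ.- 1ℤ) ℤ.* ε ℤ.* normSum φ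
      double : (f : V n → V n → Carrier) → (∀ x y → f x y ≡ 0#) → ∑V {n} (λ x → ∑V {n} (λ y → g (f x y))) ≡ (q ℤ.- 1ℤ) ℤ.* Q ℤ.* Q
      double f f≡0 = trans (∑-cong (elems Eₙ) (λ x → ∑V-kernel {n} (f x) (f≡0 x))) (∑V-const {n} ((q ℤ.- 1ℤ) ℤ.* Q))
      T𝟎 : T 𝟎 ≡ T₀
      T𝟎 = cong₂ (λ s t → (q ℤ.+ 1ℤ) ℤ.* s ℤ.+ (q ℤ.- 1ℤ) ℤ.* ε ℤ.* t) (double _ zero-form)
        (double _ (λ x w → trans (cong₂ (λ a b → a + b + c * dot 𝟎 (μ w w)) (zero-form x x) (zero-form x w))
          (trans (cong (λ a → 0# + 0# + c * a) (zero-form w w)) (solve 1 (λ c → con 0ℤ :+ con 0ℤ :+ c :* con 0ℤ := con 0ℤ) refl c))))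
      arith₁ : ∀ a b → a ≡ b ℤ.+ 1ℤ ℤ.* (a ℤ.- b)
      arith₁ = ℤS.solve-∀
      arith₀ : ∀ a b → b ≡ b ℤ.+ 0ℤ ℤ.* (a ℤ.- b)
      arith₀ = ℤS.solve-∀
      split : ∀ φ (d : Dec (φ ≡ 𝟎)) → T φ ≡ generic ℤ.+ 𝟙 d ℤ.* (T₀ ℤ.- generic)
      split φ (yes refl) = trans T𝟎 (arith₁ T₀ generic)
      split φ (no φ≢0)   = trans (corank-relation ε ε²≡1 sign φ φ≢0) (arith₀ T₀ generic)

-- The contradiction between the moments when m = 2n - 1

module _ (𝔽 : Field) (E : Enumeration (Field.Carrier 𝔽)) where
  open FiniteFieldTheory 𝔽 E

  private
    power-sign : ∀ n → ((ℤ.- q) ℤ.^ n ≡ 1ℤ ℤ.* q ℤ.^ n) ⊎ ((ℤ.- q) ℤ.^ n ≡ ℤ.- 1ℤ ℤ.* q ℤ.^ n)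
    power-sign zero    = inj₁ refl
    power-sign (suc n) with power-sign n
    ... | inj₁ e = inj₂ (trans (cong (ℤ.- q ℤ.*_) e) (arith q (q ℤ.^ n)))
      where
      arith : ∀ q Q → ℤ.- q ℤ.* (1ℤ ℤ.* Q) ≡ ℤ.- 1ℤ ℤ.* (q ℤ.* Q)
      arith = ℤS.solve-∀
    ... | inj₂ e = inj₁ (trans (cong (ℤ.- q ℤ.*_) e) (arith q (q ℤ.^ n)))
      where
      arith : ∀ q Q → ℤ.- q ℤ.* (ℤ.- 1ℤ ℤ.* Q) ≡ 1ℤ ℤ.* (q ℤ.* Q)
      arith = ℤS.solve-∀

    nonZero-product : ∀ {a b} → ¬ (a ≡ 0ℤ) → ¬ (b ≡ 0ℤ) → ¬ (a ℤ.* b ≡ 0ℤ)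
    nonZero-product {a} a≢0 b≢0 ab≡0 = [ a≢0 , b≢0 ]′ (ℤP.i*j≡0⇒i≡0∨j≡0 a ab≡0)

    q^≢ : ∀ {i j} → i ℕ.< j → ¬ (q ℤ.^ j ℤ.- q ℤ.^ i ≡ 0ℤ)
    q^≢ {i} {j} i<j e = ℤP.<⇒≢ (q^-mono-< i<j) (sym (ℤP.i-j≡0⇒i≡j (q ℤ.^ j) (q ℤ.^ i) e))

  sidon-product-bound : ∀ {n m} → SidonProduct 𝔽 E n m → 3 ℕ.≤ n → 2 ℕ.* n ℕ.≤ m
  sidon-product-bound {suc (suc k)} {m} S (ℕ.s≤s (ℕ.s≤s 1≤k)) = ℕP.≮⇒≥ m≮2n
    where
    n′ = suc k
    n = suc n′
    open SidonCounting 𝔽 E S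
    P : ℤ
    P = q ℤ.^ n′
    e₀ e₁ : V n
    e₀ = 1# ∷ 𝟎
    e₁ = 0# ∷ 1# ∷ 𝟎
    independent : Independent e₀ e₁
    independent = (λ e → 0≢1 (sym (cong Vec.head e)))
                , (λ t e → 0≢1 (sym (trans (cong (λ v → Vec.head (Vec.tail v)) e) (zeroʳ t))))
    bound : n ℕ.+ n ℕ.≤ suc m
    bound = ℕP.≮⇒≥ (λ lt → ℤP.<⇒≱ (q^-mono-< lt)
      (subst (ℤ._≤ q ℤ.^ suc m) (sym (ℤP.^-distribˡ-+-* q n n)) (dimension-bound e₀ e₁ independent)))
    m≮2n : ¬ (m ℕ.< 2 ℕ.* n)
    m≮2n m<2n = contradictory (power-sign n)
      where
      m≡ : m ≡ n′ ℕ.+ n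
      m≡ = ℕP.suc-injective (ℕP.≤-antisym (subst (suc m ℕ.≤_) (cong (n ℕ.+_) (ℕP.+-identityʳ n)) m<2n) bound)
      M≡ : q ℤ.^ m ≡ P ℤ.* (q ℤ.* P)
      M≡ = trans (cong (q ℤ.^_) m≡) (ℤP.^-distribˡ-+-* q n′ n)
      tight : q ℤ.* q ℤ.^ m ≡ q ℤ.^ n ℤ.* q ℤ.^ n
      tight = trans (cong (q ℤ.*_) M≡) (sym (ℤP.*-assoc q P (q ℤ.* P)))
      q≢0 : ¬ (q ≡ 0ℤ)
      q≢0 e = ℤP.<⇒≢ 0<q (sym e)
      P≢0 : ¬ (P ≡ 0ℤ)
      P≢0 e = ℤP.<⇒≢ (0<q^ n′) (sym e)
      q-1≢0 : ¬ (q ℤ.- 1ℤ ≡ 0ℤ)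
      q-1≢0 e = ℤP.<⇒≢ 0<q-1 (sym e)
      -- The difference of the two sides of `moment-identity` with Q = qP, M = qP² and ε = 1. The
      -- factor with `q ℤ.* 1ℤ` is written so as to match the unfolding of q^1 in `q^≢`; `odd` is
      -- the case ε = -1.
      even : ∀ q P → ((q ℤ.+ 1ℤ) ℤ.* ((q ℤ.- 1ℤ) ℤ.* (P ℤ.* (q ℤ.* P)) ℤ.* (q ℤ.* P ℤ.+ q ℤ.* P ℤ.- 1ℤ)) ℤ.+ (q ℤ.- 1ℤ) ℤ.* 1ℤ ℤ.* ((q ℤ.- 1ℤ) ℤ.* (P ℤ.* (q ℤ.* P)))) ℤ.-
        ((q ℤ.- 1ℤ) ℤ.* (ℤ.+ 2 ℤ.* q ℤ.* (q ℤ.* P)) ℤ.* (P ℤ.* (q ℤ.* P)) ℤ.+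
          ((q ℤ.+ 1ℤ) ℤ.* ((q ℤ.- 1ℤ) ℤ.* (q ℤ.* P) ℤ.* (q ℤ.* P)) ℤ.+ (q ℤ.- 1ℤ) ℤ.* 1ℤ ℤ.* ((q ℤ.- 1ℤ) ℤ.* (q ℤ.* P) ℤ.* (q ℤ.* P)) ℤ.- (q ℤ.- 1ℤ) ℤ.* (ℤ.+ 2 ℤ.* q ℤ.* (q ℤ.* P))))
        ≡ ℤ.+ 2 ℤ.* ((q ℤ.- 1ℤ) ℤ.* (q ℤ.* (P ℤ.* ((q ℤ.* P ℤ.- 1ℤ) ℤ.* (P ℤ.- q ℤ.* 1ℤ)))))
      even = ℤS.solve-∀
      odd : ∀ q P → ((q ℤ.+ 1ℤ) ℤ.* ((q ℤ.- 1ℤ) ℤ.* (P ℤ.* (q ℤ.* P)) ℤ.* (q ℤ.* P ℤ.+ q ℤ.* P ℤ.- 1ℤ)) ℤ.+ (q ℤ.- 1ℤ) ℤ.* ℤ.- 1ℤ ℤ.* ((q ℤ.- 1ℤ) ℤ.* (P ℤ.* (q ℤ.* P)))) ℤ.-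
        ((q ℤ.- 1ℤ) ℤ.* (ℤ.+ 2 ℤ.* q ℤ.* (q ℤ.* P)) ℤ.* (P ℤ.* (q ℤ.* P)) ℤ.+
          ((q ℤ.+ 1ℤ) ℤ.* ((q ℤ.- 1ℤ) ℤ.* (q ℤ.* P) ℤ.* (q ℤ.* P)) ℤ.+ (q ℤ.- 1ℤ) ℤ.* ℤ.- 1ℤ ℤ.* ((q ℤ.- 1ℤ) ℤ.* (q ℤ.* P) ℤ.* (q ℤ.* P)) ℤ.- (q ℤ.- 1ℤ) ℤ.* (ℤ.+ 2 ℤ.* q ℤ.* (q ℤ.* P))))
        ≡ ℤ.+ 2 ℤ.* ((q ℤ.- 1ℤ) ℤ.* (q ℤ.* (q ℤ.* (P ℤ.* ((P ℤ.- 1ℤ) ℤ.* (P ℤ.- 1ℤ))))))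
      odd = ℤS.solve-∀
      identity : ∀ ε → ε ℤ.* ε ≡ 1ℤ → (ℤ.- q) ℤ.^ n ≡ ε ℤ.* q ℤ.^ n → _
      identity ε ε²≡1 sign = ℤP.i≡j⇒i-j≡0 (subst
        (λ M → (q ℤ.+ 1ℤ) ℤ.* ((q ℤ.- 1ℤ) ℤ.* M ℤ.* (q ℤ.* P ℤ.+ q ℤ.* P ℤ.- 1ℤ)) ℤ.+ (q ℤ.- 1ℤ) ℤ.* ε ℤ.* ((q ℤ.- 1ℤ) ℤ.* M) ≡
          (q ℤ.- 1ℤ) ℤ.* (ℤ.+ 2 ℤ.* q ℤ.* (q ℤ.* P)) ℤ.* M ℤ.+
            ((q ℤ.+ 1ℤ) ℤ.* ((q ℤ.- 1ℤ) ℤ.* (q ℤ.* P) ℤ.* (q ℤ.* P)) ℤ.+ (q ℤ.- 1ℤ) ℤ.* ε ℤ.* ((q ℤ.- 1ℤ) ℤ.* (q ℤ.* P) ℤ.* (q ℤ.* P)) ℤ.- (q ℤ.- 1ℤ) ℤ.* (ℤ.+ 2 ℤ.* q ℤ.* (q ℤ.* P))))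
        M≡ (moment-identity tight ε ε²≡1 sign))
      contradictory : ((ℤ.- q) ℤ.^ n ≡ 1ℤ ℤ.* q ℤ.^ n) ⊎ ((ℤ.- q) ℤ.^ n ≡ ℤ.- 1ℤ ℤ.* q ℤ.^ n) → ⊥
      -- The hypothesis n ≥ 3 does its work here: it gives 1 < n - 1 and so P ≠ q, whereas for n = 2
      -- the factor P - q is zero.
      contradictory (inj₁ sign) = nonZero-product {ℤ.+ 2} (λ ()) (nonZero-product q-1≢0 (nonZero-product q≢0 (nonZero-product P≢0
        (nonZero-product (q^≢ {0} {n} (ℕ.s≤s ℕ.z≤n)) (q^≢ {1} {n′} (ℕ.s≤s 1≤k))))))
        (trans (sym (even q P)) (identity 1ℤ refl sign))
      contradictory (inj₂ sign) = nonZero-product {ℤ.+ 2} (λ ()) (nonZero-product q-1≢0 (nonZero-product q≢0 (nonZero-product q≢0 (nonZero-product P≢0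
        (nonZero-product (q^≢ {0} {n′} (ℕ.s≤s ℕ.z≤n)) (q^≢ {0} {n′} (ℕ.s≤s ℕ.z≤n)))))))
        (trans (sym (odd q P)) (identity (ℤ.- 1ℤ) refl sign))

-- Coordinates on a Sidon space over a finite field

Finᵉ : ∀ k → Enumeration (Fin k)
Finᵉ zero    = record { elems = [] ; _≟_ = FinP._≟_ ; ∑-δ = λ () }
Finᵉ (suc k) = record
  { elems = zero ∷ map suc (elems (Finᵉ k))
  ; _≟_   = FinP._≟_
  ; ∑-δ   = λ
    { zero    → cong (ℤ._+_ 1ℤ) (trans (∑-map suc (elems (Finᵉ k)) _)
                  (trans (∑-cong (elems (Finᵉ k)) (λ i → 𝟙-no (suc i FinP.≟ zero) (λ ()))) (∑-zero (elems (Finᵉ k)))))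
    ; (suc a) → trans (ℤP.+-identityˡ _) (trans (∑-map suc (elems (Finᵉ k)) _)
                  (trans (∑-cong (elems (Finᵉ k)) (λ i → 𝟙-⇔ (suc i FinP.≟ suc a) (Enumeration._≟_ (Finᵉ k) i a) FinP.suc-injective (cong suc)))
                         (∑-δ (Finᵉ k) a))) } }

-- A field in its own right in place of the predicate F: elements of L paired with membership proofs
-- would have neither a decidable equality nor, in general, unique proofs.
record FiniteModel (L : Field) (F : Pred L) : Set₁ where
  private module L = Field L
  field
    𝔽 : Field
    E : Enumeration (Field.Carrier 𝔽)
  open Field 𝔽
  field
    ι     : Carrier → L.Carrier
    ι-+   : ∀ x y → ι (x + y) ≡ ι x L.+ ι y
    ι-*   : ∀ x y → ι (x * y) ≡ ι x L.* ι y
    ι-neg : ∀ x → ι (- x) ≡ L.- ι x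
    ι-0   : ι 0# ≡ L.0#
    ι-1   : ι 1# ≡ L.1#
    ι-inj : ∀ {x y} → ι x ≡ ι y → x ≡ y
    ι∈    : ∀ x → F (ι x)
    ι-sur : ∀ x → F x → ∃ λ i → ι i ≡ x

module _ (L : Field) (F : Pred L) (isSubfield : IsSubfield L F) where
  open FieldTheory L
  open IsSubfield isSubfield

  private
    record Listing (P : Carrier → Set) : Set where
      field
        k   : ℕ
        val : Fin k → Carrier
        inj : ∀ {i j} → val i ≡ val j → i ≡ j
        val∈ : ∀ i → F (val i)
        sur : ∀ x → P x → F x → ∃ λ i → val i ≡ x

    ¬¬-lem : {A : Set} → ¬ ¬ Dec A
    ¬¬-lem ¬d = ¬d (no (λ a → ¬d (yes a)))

    -- Equality in L and membership in F need not be decidable, so repetitions and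
    -- superfluous elements can only be removed from the given list up to double negation.
    listing : (xs : List Carrier) → ¬ ¬ Listing (_∈ xs)
    listing [] ¬l = ¬l (record { k = 0 ; val = λ () ; inj = λ { {()} } ; val∈ = λ () ; sur = λ _ () })
    listing (x ∷ xs) ¬l = listing xs λ l → ¬¬-lem {F x} λ F? → ¬¬-lem {∃ λ i → Listing.val l i ≡ x} λ old? → ¬l (extend l F? old?)
      where
      extend : (l : Listing (_∈ xs)) → Dec (F x) → Dec (∃ λ i → Listing.val l i ≡ x) → Listing (_∈ (x ∷ xs))
      extend l (no ¬Fx) _ = record
        { k = k ; val = val ; inj = inj ; val∈ = val∈
        ; sur = λ { y (here refl) Fy → ⊥-elim (¬Fx Fy) ; y (there y∈) Fy → sur y y∈ Fy } }
        where open Listing l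
      extend l (yes Fx) (yes (i , vi≡x)) = record
        { k = k ; val = val ; inj = inj ; val∈ = val∈
        ; sur = λ { y (here refl) Fy → i , vi≡x ; y (there y∈) Fy → sur y y∈ Fy } }
        where open Listing l
      extend l (yes Fx) (no new) = record
        { k = suc k
        ; val = λ { zero → x ; (suc i) → val i }
        ; inj = λ { {zero} {zero} _ → refl ; {zero} {suc j} e → ⊥-elim (new (j , sym e))
                  ; {suc i} {zero} e → ⊥-elim (new (i , e)) ; {suc i} {suc j} e → cong suc (inj e) }
        ; val∈ = λ { zero → Fx ; (suc i) → val∈ i }
        ; sur = λ { y (here refl) Fy → zero , refl
                  ; y (there y∈) Fy → let (i , e) = sur y y∈ Fy in suc i , e } }
        where open Listing l

  finiteModel : IsFinite L F → ¬ ¬ FiniteModel L F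
  finiteModel (xs , complete) ¬model = listing xs (λ l → ¬model (model l))
    where
    model : Listing (_∈ xs) → FiniteModel L F
    model l = record
      { 𝔽 = record
        { Carrier = Fin k
        ; _+_ = λ i j → index (+∈ (val∈ i) (val∈ j))
        ; _*_ = λ i j → index (*∈ (val∈ i) (val∈ j))
        ; -_ = λ i → index (-∈ (val∈ i))
        ; 0# = index 0∈ ; 1# = index 1∈
        -- The ring laws are pulled back from L along the injective homomorphism `val`.
        ; isCommutativeRing = RingMonomorphism.isCommutativeRing
            {R₁ = record { _≈_ = _≡_ ; _+_ = λ i j → index (+∈ (val∈ i) (val∈ j)) ; _*_ = λ i j → index (*∈ (val∈ i) (val∈ j))
                         ; -_ = λ i → index (-∈ (val∈ i)) ; 0# = index 0∈ ; 1# = index 1∈ }}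
            {R₂ = CommutativeRing.rawRing commutativeRing} {val}
            (record
              { isRingHomomorphism = record
                { isSemiringHomomorphism = record
                  { isNearSemiringHomomorphism = record
                    { +-isMonoidHomomorphism = record
                      { isMagmaHomomorphism = record
                        { isRelHomomorphism = record { cong = cong val } ; homo = λ _ _ → val-index _ }
                      ; ε-homo = val-index _ }
                    ; *-homo = λ _ _ → val-index _ }
                  ; 1#-homo = val-index _ }
                ; -‿homo = λ _ → val-index _ }
              ; injective = inj })
            isCommutativeRing
        ; 0≢1 = λ e → 0≢1 (trans (sym (val-index 0∈)) (trans (cong val e) (val-index 1∈)))
        ; inv = λ i i≢0 → let vi≢0 = λ e → i≢0 (inj (trans e (sym (val-index 0∈)))) in
            index (inv∈ (val∈ i) vi≢0) ,
            inj (trans (val-index _) (trans (cong (val i *_) (val-index _)) (trans (proj₂ (inv (val i) vi≢0)) (sym (val-index 1∈))))) }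
      ; E = Finᵉ k
      ; ι = val
      ; ι-+ = λ _ _ → val-index _ ; ι-* = λ _ _ → val-index _ ; ι-neg = λ _ → val-index _
      ; ι-0 = val-index _ ; ι-1 = val-index _ ; ι-inj = inj ; ι∈ = val∈
      ; ι-sur = λ x Fx → sur x (complete x Fx) Fx }
      where
      open Listing l
      index : ∀ {x} → F x → Fin k
      index {x} Fx = proj₁ (sur x (complete x Fx) Fx)
      val-index : ∀ {x} (Fx : F x) → val (index Fx) ≡ x
      val-index {x} Fx = proj₂ (sur x (complete x Fx) Fx)

-- Coordinates over the model and the consequences of the Sidon property

module _ (L : Field) (F : Pred L) (isSubfield : IsSubfield L F) (F-finite : FiniteModel L F) where
  private module L = FieldTheory L
  open FiniteModel F-finite
  open FiniteFieldTheory 𝔽 E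
  open L using () renaming (Carrier to ∣L∣; solve to solveᴸ; _:=_ to _≔_; _:+_ to _⊞_; _:*_ to _⊡_; :-_ to ⊟_; con to conᴸ)

  eval : ∀ {n} → (Fin n → ∣L∣) → V n → ∣L∣
  eval v []      = L.0#
  eval v (x ∷ u) = ι x L.* v zero L.+ eval (λ i → v (suc i)) u

  eval-⊕ : ∀ {n} (v : Fin n → ∣L∣) (u w : V n) → eval v (u ⊕ w) ≡ eval v u L.+ eval v w
  eval-⊕ v []      []      = sym (L.+-identityˡ L.0#)
  eval-⊕ v (x ∷ u) (y ∷ w) = trans (cong₂ (λ a b → a L.* v zero L.+ b) (ι-+ x y) (eval-⊕ _ u w))
    (solveᴸ 5 (λ x y v a b → (x ⊞ y) ⊡ v ⊞ (a ⊞ b) ≔ (x ⊡ v ⊞ a) ⊞ (y ⊡ v ⊞ b)) refl (ι x) (ι y) (v zero) _ _)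

  eval-⊙ : ∀ {n} (v : Fin n → ∣L∣) t (u : V n) → eval v (t ⊙ u) ≡ ι t L.* eval v u
  eval-⊙ v t []      = sym (L.zeroʳ (ι t))
  eval-⊙ v t (x ∷ u) = trans (cong₂ (λ a b → a L.* v zero L.+ b) (ι-* t x) (eval-⊙ _ t u))
    (solveᴸ 4 (λ t x v a → t ⊡ x ⊡ v ⊞ t ⊡ a ≔ t ⊡ (x ⊡ v ⊞ a)) refl (ι t) (ι x) (v zero) _)

  eval-𝟎 : ∀ {n} (v : Fin n → ∣L∣) → eval v 𝟎 ≡ L.0#
  eval-𝟎 {zero}  v = refl
  eval-𝟎 {suc n} v = trans (cong₂ (λ a b → a L.* v zero L.+ b) ι-0 (eval-𝟎 (λ i → v (suc i))))
    (solveᴸ 1 (λ v → conᴸ 0ℤ ⊡ v ⊞ conᴸ 0ℤ ≔ conᴸ 0ℤ) refl (v zero))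

  eval-lincomb : ∀ {n} (v : Fin n → ∣L∣) (u : V n) → eval v u ≡ lincomb L n (λ i → ι (Vec.lookup u i)) v
  eval-lincomb v []      = refl
  eval-lincomb v (x ∷ u) = cong (ι x L.* v zero L.+_) (eval-lincomb _ u)

  lincomb-eval : ∀ n (v c : Fin n → ∣L∣) → (∀ i → F (c i)) → ∃ λ u → eval v u ≡ lincomb L n c v
  lincomb-eval zero    v c c∈ = [] , refl
  lincomb-eval (suc n) v c c∈ =
    let (x , ιx≡c) = ι-sur (c zero) (c∈ zero)
        (u , eq)   = lincomb-eval n (λ i → v (suc i)) (λ i → c (suc i)) (λ i → c∈ (suc i))
    in x ∷ u , cong₂ (λ a b → a L.* v zero L.+ b) ιx≡c eq

  module Coordinates (B : Pred L) {n : ℕ} (hasDim : HasDim L F B n) where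
    private v = proj₁ hasDim

    ⟦_⟧ : V n → ∣L∣
    ⟦_⟧ = eval v

    ⟦⟧-zero : ∀ u → ⟦ u ⟧ ≡ L.0# → u ≡ 𝟎
    ⟦⟧-zero u e = all-zero u (λ i → ι-inj (trans (independent (λ i → ι (Vec.lookup u i)) (λ i → ι∈ _) (trans (sym (eval-lincomb v u)) e) i) (sym ι-0)))
      where
      independent = proj₁ (proj₂ (proj₂ hasDim))
      all-zero : ∀ {n} (u : V n) → (∀ i → Vec.lookup u i ≡ 0#) → u ≡ 𝟎
      all-zero []      _ = refl
      all-zero (x ∷ u) h = cong₂ _∷_ (h zero) (all-zero u (λ i → h (suc i)))

    coordinates : ∀ b → B b → ∃ λ u → ⟦ u ⟧ ≡ b
    coordinates b b∈ =
      let (c , c∈ , b≡) = proj₂ (proj₂ (proj₂ hasDim)) b b∈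
          (u , eq)      = lincomb-eval n v c c∈
      in u , trans eq (sym b≡)

    ⟦⟧-inj : ∀ {u w} → ⟦ u ⟧ ≡ ⟦ w ⟧ → u ≡ w
    ⟦⟧-inj {u} {w} e = begin
      u                          ≡⟨ sym (⊕-⊙-cancel (- 1#) u w) ⟩
      (u ⊕ (- 1#) ⊙ w) ⊕ (- (- 1#)) ⊙ w ≡⟨ cong₂ _⊕_ (⟦⟧-zero _ difference) (trans (cong (_⊙ w) (solve 1 (λ o → :- (:- o) := o) refl 1#)) (⊙-identity w)) ⟩
      𝟎 ⊕ w                      ≡⟨ trans (⊕-comm 𝟎 w) (⊕-identityʳ w) ⟩
      w                          ∎
      where
      open ≡-Reasoning
      difference : ⟦ u ⊕ (- 1#) ⊙ w ⟧ ≡ L.0#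
      difference = trans (eval-⊕ v u _) (trans (cong₂ L._+_ e (trans (eval-⊙ v (- 1#) w) (cong (L._* ⟦ w ⟧) (trans (ι-neg 1#) (cong L.-_ ι-1)))))
        (solveᴸ 1 (λ b → b ⊞ (⊟ conᴸ 1ℤ) ⊡ b ≔ conᴸ 0ℤ) refl ⟦ w ⟧))

    ⟦⟧∈ : IsSubspace L F B → ∀ u → B ⟦ u ⟧
    ⟦⟧∈ sub u = go v (proj₁ (proj₂ hasDim)) u
      where
      go : ∀ {k} (v : Fin k → ∣L∣) → (∀ i → B (v i)) → (u : V k) → B (eval v u)
      go v v∈ []      = IsSubspace.0∈ sub
      go v v∈ (x ∷ u) = IsSubspace.+∈ sub (IsSubspace.·∈ sub (ι∈ x) (v∈ zero)) (go _ (λ i → v∈ (suc i)) u)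

  module _ (A : Pred L) (isSubspace : IsSubspace L F A) (isSidon : IsSidon L F A)
           {n m : ℕ} (dimA : HasDim L F A n) (dimSq : HasDim L F (Sq L F A) m) where
    private
      module A = Coordinates A dimA
      module A² = Coordinates (Sq L F A) dimSq
      module Sub = IsSubspace isSubspace
      va = proj₁ dimA
      vs = proj₁ dimSq
    open A using () renaming (⟦_⟧ to ⟦_⟧ᴬ)
    open A² using () renaming (⟦_⟧ to ⟦_⟧²)

    Dilate : ∣L∣ → Pred L
    Dilate x = _∩_ L F A (_·S_ L F x A)

    -- The form in which the Sidon hypothesis is applied: each use exhibits two members of A ∩ xA
    -- and concludes that their ratio lies in F. A nonzero p rules out dimension 0.
    sidon-line : ∀ x → ¬ F x → ∀ {p p′} → Dilate x p → Dilate x p′ → ¬ (p ≡ L.0#) → ∃ λ t → F t × p′ ≡ t L.* p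
    sidon-line x x∉F {p} {p′} p∈ p′∈ p≢0 with isSidon x x∉F
    ... | zero , (v , _ , _ , span) , _ = ⊥-elim (p≢0 (proj₂ (proj₂ (span p p∈))))
    ... | suc (suc d) , _ , ℕ.s≤s ()
    ... | suc zero , (v , _ , _ , span) , _ with span p p∈ | span p′ p′∈
    ...   | c , c∈ , p≡ | c′ , c′∈ , p′≡ = c′ zero L.* c⁻¹ , IsSubfield.*∈ isSubfield (c′∈ zero) (IsSubfield.inv∈ isSubfield (c∈ zero) c≢0) , (begin
        p′                                            ≡⟨ p′≡ ⟩
        c′ zero L.* w L.+ L.0#                        ≡⟨ solveᴸ 2 (λ c w → c ⊡ w ⊞ conᴸ 0ℤ ≔ c ⊡ (conᴸ 1ℤ ⊡ w)) refl (c′ zero) w ⟩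
        c′ zero L.* (L.1# L.* w)                      ≡⟨ cong (λ o → c′ zero L.* (o L.* w)) (sym (proj₂ (L.inv (c zero) c≢0))) ⟩
        c′ zero L.* (c zero L.* c⁻¹ L.* w)            ≡⟨ solveᴸ 4 (λ c′ c i w → c′ ⊡ (c ⊡ i ⊡ w) ≔ c′ ⊡ i ⊡ (c ⊡ w ⊞ conᴸ 0ℤ)) refl (c′ zero) (c zero) c⁻¹ w ⟩
        c′ zero L.* c⁻¹ L.* (c zero L.* w L.+ L.0#)   ≡⟨ cong (c′ zero L.* c⁻¹ L.*_) (sym p≡) ⟩
        c′ zero L.* c⁻¹ L.* p                         ∎)
      where
      open ≡-Reasoning
      w = v zero
      c≢0 : ¬ (c zero ≡ L.0#)
      c≢0 e = p≢0 (trans p≡ (trans (cong (λ a → a L.* w L.+ L.0#) e) (solveᴸ 1 (λ w → conᴸ 0ℤ ⊡ w ⊞ conᴸ 0ℤ ≔ conᴸ 0ℤ) refl w)))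
      c⁻¹ = proj₁ (L.inv (c zero) c≢0)

    private
      product∈ : ∀ x y → Sq L F A (⟦ x ⟧ᴬ L.* ⟦ y ⟧ᴬ)
      product∈ x y = 1 , (λ _ → L.1#) , (λ _ → ⟦ x ⟧ᴬ) , (λ _ → ⟦ y ⟧ᴬ) , (λ _ → IsSubfield.1∈ isSubfield) ,
        (λ _ → A.⟦⟧∈ isSubspace x) , (λ _ → A.⟦⟧∈ isSubspace y) ,
        solveᴸ 1 (λ a → a ≔ conᴸ 1ℤ ⊡ a ⊞ conᴸ 0ℤ) refl _

      μ : V n → V n → V m
      μ x y = proj₁ (A².coordinates _ (product∈ x y))

      ⟦μ⟧ : ∀ x y → ⟦ μ x y ⟧² ≡ ⟦ x ⟧ᴬ L.* ⟦ y ⟧ᴬ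
      ⟦μ⟧ x y = proj₂ (A².coordinates _ (product∈ x y))

      ⟦⟧≢0 : ∀ {u} → ¬ (u ≡ 𝟎) → ¬ (⟦ u ⟧ᴬ ≡ L.0#)
      ⟦⟧≢0 u≢0 e = u≢0 (A.⟦⟧-zero _ e)

      ⟦𝟎⟧² : ⟦ 𝟎 ⟧² ≡ L.0#
      ⟦𝟎⟧² = eval-𝟎 vs

      ratio∉F⇒≢0 : ∀ {x i} → ¬ F (x L.* i) → ¬ (x ≡ L.0#)
      ratio∉F⇒≢0 {i = i} ∉ refl = ∉ (subst F (sym (L.zeroˡ i)) (IsSubfield.0∈ isSubfield))

      μ-zero : ∀ x y → μ x y ≡ 𝟎 → x ≡ 𝟎 ⊎ y ≡ 𝟎
      μ-zero x y e with x ≟ᵥ 𝟎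
      ... | yes x≡0 = inj₁ x≡0
      ... | no x≢0  = inj₂ (A.⟦⟧-zero y (L.*-cancel-0 (⟦⟧≢0 x≢0) (trans (sym (⟦μ⟧ x y)) (trans (cong ⟦_⟧² e) ⟦𝟎⟧²))))

      -- If w ≠ 0, then λ = X / W is a root of s² + s + c, hence outside F. Both X = λW and λX lie
      -- in A ∩ λA, so the Sidon property puts their ratio λ into F after all.
      μ-norm : ∀ c → Irreducible c → ∀ x w → μ x x ⊕ μ x w ⊕ c ⊙ μ w w ≡ 𝟎 → x ≡ 𝟎 × w ≡ 𝟎
      μ-norm c irreducible x w e = by (w ≟ᵥ 𝟎)
        where
        open ≡-Reasoning
        X = ⟦ x ⟧ᴬ
        W = ⟦ w ⟧ᴬ
        C = ι c
        relation : X L.* X L.+ X L.* W L.+ C L.* (W L.* W) ≡ L.0#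
        relation = begin
          X L.* X L.+ X L.* W L.+ C L.* (W L.* W)                         ≡⟨ cong₂ (λ a b → a L.+ b L.+ C L.* (W L.* W)) (sym (⟦μ⟧ x x)) (sym (⟦μ⟧ x w)) ⟩
          ⟦ μ x x ⟧² L.+ ⟦ μ x w ⟧² L.+ C L.* (W L.* W)                   ≡⟨ cong₂ L._+_ (sym (eval-⊕ vs (μ x x) (μ x w))) (trans (cong (C L.*_) (sym (⟦μ⟧ w w))) (sym (eval-⊙ vs c (μ w w)))) ⟩
          ⟦ μ x x ⊕ μ x w ⟧² L.+ ⟦ c ⊙ μ w w ⟧²                           ≡⟨ sym (eval-⊕ vs (μ x x ⊕ μ x w) (c ⊙ μ w w)) ⟩
          ⟦ μ x x ⊕ μ x w ⊕ c ⊙ μ w w ⟧²                                  ≡⟨ trans (cong ⟦_⟧² e) ⟦𝟎⟧² ⟩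
          L.0#                                                            ∎
        by : Dec (w ≡ 𝟎) → x ≡ 𝟎 × w ≡ 𝟎
        by (yes w≡0) = x≡0 , w≡0
          where
          W≡0 : W ≡ L.0#
          W≡0 = trans (cong ⟦_⟧ᴬ w≡0) (eval-𝟎 va)
          X²≡0 : X L.* X ≡ L.0#
          X²≡0 = trans (solveᴸ 2 (λ x c → x ⊡ x ≔ x ⊡ x ⊞ x ⊡ conᴸ 0ℤ ⊞ c ⊡ (conᴸ 0ℤ ⊡ conᴸ 0ℤ)) refl X C)
            (trans (cong (λ W → X L.* X L.+ X L.* W L.+ C L.* (W L.* W)) (sym W≡0)) relation)
          x≡0 : x ≡ 𝟎
          x≡0 = Dec.decidable-stable (x ≟ᵥ 𝟎) (λ x≢0 → ⟦⟧≢0 x≢0 (L.*-cancel-0 (⟦⟧≢0 x≢0) X²≡0))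
        by (no w≢0) = ⊥-elim (λ∉F (subst F (sym λ≡t) t∈))
          where
          i = proj₁ (L.inv W (⟦⟧≢0 w≢0))
          Wi≡1 : W L.* i ≡ L.1#
          Wi≡1 = proj₂ (L.inv W (⟦⟧≢0 w≢0))
          ratio = X L.* i
          ratio*W : ratio L.* W ≡ X
          ratio*W = trans (solveᴸ 3 (λ x i w → x ⊡ i ⊡ w ≔ x ⊡ (w ⊡ i)) refl X i W) (trans (cong (X L.*_) Wi≡1) (L.*-identityʳ X))
          root : ratio L.* ratio L.+ ratio L.+ C ≡ L.0#
          root = begin
            ratio L.* ratio L.+ ratio L.+ C
              ≡⟨ solveᴸ 2 (λ r c → r ⊡ r ⊞ r ⊞ c ≔ r ⊡ r ⊞ r ⊡ conᴸ 1ℤ ⊞ c ⊡ (conᴸ 1ℤ ⊡ conᴸ 1ℤ)) refl ratio C ⟩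
            ratio L.* ratio L.+ ratio L.* L.1# L.+ C L.* (L.1# L.* L.1#)
              ≡⟨ cong (λ o → ratio L.* ratio L.+ ratio L.* o L.+ C L.* (o L.* o)) (sym Wi≡1) ⟩
            ratio L.* ratio L.+ ratio L.* (W L.* i) L.+ C L.* (W L.* i L.* (W L.* i))
              ≡⟨ solveᴸ 4 (λ x w i c → x ⊡ i ⊡ (x ⊡ i) ⊞ x ⊡ i ⊡ (w ⊡ i) ⊞ c ⊡ (w ⊡ i ⊡ (w ⊡ i)) ≔ (x ⊡ x ⊞ x ⊡ w ⊞ c ⊡ (w ⊡ w)) ⊡ (i ⊡ i)) refl X W i C ⟩
            (X L.* X L.+ X L.* W L.+ C L.* (W L.* W)) L.* (i L.* i)
              ≡⟨ trans (cong (L._* (i L.* i)) relation) (L.zeroˡ _) ⟩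
            L.0# ∎
          λ∉F : ¬ F ratio
          λ∉F r∈ = let (s , ιs≡r) = ι-sur ratio r∈ in irreducible s (ι-inj (begin
            ι (s * s + s + c)                       ≡⟨ trans (ι-+ _ c) (cong (L._+ C) (trans (ι-+ _ s) (cong (L._+ ι s) (ι-* s s)))) ⟩
            ι s L.* ι s L.+ ι s L.+ C               ≡⟨ cong (λ r → r L.* r L.+ r L.+ C) ιs≡r ⟩
            ratio L.* ratio L.+ ratio L.+ C         ≡⟨ root ⟩
            L.0#                                    ≡⟨ sym ι-0 ⟩
            ι 0#                                    ∎))
          X≢0 : ¬ (X ≡ L.0#)
          X≢0 = ratio∉F⇒≢0 λ∉F
          -- By the relation, (X / W) X = - (X + c W) lies in A again.
          ratio*X : ratio L.* X ≡ ι (- 1#) L.* (X L.+ C L.* W)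
          ratio*X = L.x-y≡0⇒x≡y (begin
            ratio L.* X L.+ L.- (ι (- 1#) L.* (X L.+ C L.* W))
              ≡⟨ cong (λ o → ratio L.* X L.+ L.- (o L.* (X L.+ C L.* W))) (trans (ι-neg 1#) (cong L.-_ ι-1)) ⟩
            ratio L.* X L.+ L.- (L.- L.1# L.* (X L.+ C L.* W))
              ≡⟨ cong (λ z → ratio L.* z L.+ L.- (L.- L.1# L.* (z L.+ C L.* W))) (sym ratio*W) ⟩
            ratio L.* (ratio L.* W) L.+ L.- (L.- L.1# L.* (ratio L.* W L.+ C L.* W))
              ≡⟨ solveᴸ 3 (λ r c w → r ⊡ (r ⊡ w) ⊞ (⊟ ((⊟ conᴸ 1ℤ) ⊡ (r ⊡ w ⊞ c ⊡ w))) ≔ (r ⊡ r ⊞ r ⊞ c) ⊡ w) refl ratio C W ⟩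
            (ratio L.* ratio L.+ ratio L.+ C) L.* W
              ≡⟨ trans (cong (L._* W) root) (L.zeroˡ W) ⟩
            L.0# ∎)
          X∈ : Dilate ratio X
          X∈ = A.⟦⟧∈ isSubspace x , W , A.⟦⟧∈ isSubspace w , sym ratio*W
          ratioX∈ : Dilate ratio (ratio L.* X)
          ratioX∈ = subst A (sym ratio*X) (Sub.·∈ (ι∈ (- 1#)) (Sub.+∈ (A.⟦⟧∈ isSubspace x) (Sub.·∈ (ι∈ c) (A.⟦⟧∈ isSubspace w)))) ,
                    X , A.⟦⟧∈ isSubspace x , refl
          line = sidon-line ratio λ∉F X∈ ratioX∈ X≢0
          t = proj₁ line
          t∈ : F t
          t∈ = proj₁ (proj₂ line)
          λ≡t : ratio ≡ t
          λ≡t = L.x-y≡0⇒x≡y (L.*-cancel-0 X≢0 (trans (solveᴸ 3 (λ x r t → x ⊡ (r ⊞ (⊟ t)) ≔ r ⊡ x ⊞ (⊟ (t ⊡ x))) refl X ratio t)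
            (trans (cong (L._+ L.- (t L.* X)) (proj₂ (proj₂ line))) (L.-‿inverseʳ _))))

      -- With λ = b / a outside F, the relation ax + by = 0 says x = λ(-y). So b = λa and x both lie
      -- in A ∩ λA, which makes x a multiple tb; cancelling b then gives y = -ta.
      μ-sidon : ∀ a b → ¬ (a ≡ 𝟎) → (∀ t → ¬ (b ≡ t ⊙ a)) → ∀ x y → μ a x ⊕ μ b y ≡ 𝟎 → ∃ λ t → x ≡ t ⊙ b × y ≡ (- t) ⊙ a
      μ-sidon a b a≢0 indep x y e = s , A.⟦⟧-inj (trans X≡tB (sym (trans (eval-⊙ va s b) (cong (L._* B′) ιs≡t)))) , A.⟦⟧-inj Y≡
        where
        open ≡-Reasoning
        A′ = ⟦ a ⟧ᴬ
        B′ = ⟦ b ⟧ᴬ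
        X = ⟦ x ⟧ᴬ
        Y = ⟦ y ⟧ᴬ
        relation : A′ L.* X L.+ B′ L.* Y ≡ L.0#
        relation = trans (cong₂ L._+_ (sym (⟦μ⟧ a x)) (sym (⟦μ⟧ b y))) (trans (sym (eval-⊕ vs (μ a x) (μ b y))) (trans (cong ⟦_⟧² e) ⟦𝟎⟧²))
        A≢0 = ⟦⟧≢0 a≢0
        i = proj₁ (L.inv A′ A≢0)
        Ai≡1 : A′ L.* i ≡ L.1#
        Ai≡1 = proj₂ (L.inv A′ A≢0)
        ratio = B′ L.* i
        ratio*A : B′ ≡ ratio L.* A′
        ratio*A = sym (trans (solveᴸ 3 (λ b i a → b ⊡ i ⊡ a ≔ b ⊡ (a ⊡ i)) refl B′ i A′) (trans (cong (B′ L.*_) Ai≡1) (L.*-identityʳ B′)))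
        ratio∉F : ¬ F ratio
        ratio∉F r∈ = let (s , ιs≡r) = ι-sur ratio r∈ in
          indep s (A.⟦⟧-inj (trans ratio*A (trans (cong (L._* A′) (sym ιs≡r)) (sym (eval-⊙ va s a)))))
        ratio*Y : X ≡ ratio L.* (ι (- 1#) L.* Y)
        ratio*Y = L.x-y≡0⇒x≡y (L.*-cancel-0 A≢0 (begin
          A′ L.* (X L.+ L.- (B′ L.* i L.* (ι (- 1#) L.* Y)))
            ≡⟨ cong (λ o → A′ L.* (X L.+ L.- (B′ L.* i L.* (o L.* Y)))) (trans (ι-neg 1#) (cong L.-_ ι-1)) ⟩
          A′ L.* (X L.+ L.- (B′ L.* i L.* (L.- L.1# L.* Y)))
            ≡⟨ solveᴸ 5 (λ a x b i y → a ⊡ (x ⊞ (⊟ (b ⊡ i ⊡ ((⊟ conᴸ 1ℤ) ⊡ y)))) ≔ a ⊡ x ⊞ (a ⊡ i) ⊡ (b ⊡ y)) refl A′ X B′ i Y ⟩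
          A′ L.* X L.+ A′ L.* i L.* (B′ L.* Y)
            ≡⟨ cong (λ o → A′ L.* X L.+ o L.* (B′ L.* Y)) Ai≡1 ⟩
          A′ L.* X L.+ L.1# L.* (B′ L.* Y)
            ≡⟨ trans (cong (A′ L.* X L.+_) (L.*-identityˡ _)) relation ⟩
          L.0# ∎))
        B∈ : Dilate ratio B′
        B∈ = A.⟦⟧∈ isSubspace b , A′ , A.⟦⟧∈ isSubspace a , ratio*A
        X∈ : Dilate ratio X
        X∈ = A.⟦⟧∈ isSubspace x , _ , Sub.·∈ (ι∈ (- 1#)) (A.⟦⟧∈ isSubspace y) , ratio*Y
        B≢0 : ¬ (B′ ≡ L.0#)
        B≢0 = ratio∉F⇒≢0 ratio∉F
        line = sidon-line ratio ratio∉F B∈ X∈ B≢0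
        t = proj₁ line
        X≡tB : X ≡ t L.* B′
        X≡tB = proj₂ (proj₂ line)
        s = proj₁ (ι-sur t (proj₁ (proj₂ line)))
        ιs≡t : ι s ≡ t
        ιs≡t = proj₂ (ι-sur t (proj₁ (proj₂ line)))
        Y≡ : Y ≡ ⟦ (- s) ⊙ a ⟧ᴬ
        Y≡ = L.x-y≡0⇒x≡y (L.*-cancel-0 B≢0 (begin
          B′ L.* (Y L.+ L.- ⟦ (- s) ⊙ a ⟧ᴬ)
            ≡⟨ cong (λ z → B′ L.* (Y L.+ L.- z)) (trans (eval-⊙ va (- s) a) (cong (L._* A′) (trans (ι-neg s) (cong L.-_ ιs≡t)))) ⟩
          B′ L.* (Y L.+ L.- (L.- t L.* A′))
            ≡⟨ solveᴸ 4 (λ a b t y → b ⊡ (y ⊞ (⊟ ((⊟ t) ⊡ a))) ≔ a ⊡ (t ⊡ b) ⊞ b ⊡ y) refl A′ B′ t Y ⟩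
          A′ L.* (t L.* B′) L.+ B′ L.* Y
            ≡⟨ cong (λ z → A′ L.* z L.+ B′ L.* Y) (sym X≡tB) ⟩
          A′ L.* X L.+ B′ L.* Y
            ≡⟨ relation ⟩
          L.0# ∎))

    sidonProduct : SidonProduct 𝔽 E n m
    sidonProduct = record
      { μ = μ
      ; μ-⊕ˡ = λ u v w → A².⟦⟧-inj (trans (⟦μ⟧ (u ⊕ v) w) (trans (cong (L._* ⟦ w ⟧ᴬ) (eval-⊕ va u v))
          (trans (L.distribʳ ⟦ w ⟧ᴬ ⟦ u ⟧ᴬ ⟦ v ⟧ᴬ) (sym (trans (eval-⊕ vs (μ u w) (μ v w)) (cong₂ L._+_ (⟦μ⟧ u w) (⟦μ⟧ v w)))))))
      ; μ-⊙ˡ = λ t u v → A².⟦⟧-inj (trans (⟦μ⟧ (t ⊙ u) v) (trans (cong (L._* ⟦ v ⟧ᴬ) (eval-⊙ va t u))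
          (trans (L.*-assoc (ι t) ⟦ u ⟧ᴬ ⟦ v ⟧ᴬ) (sym (trans (eval-⊙ vs t (μ u v)) (cong (ι t L.*_) (⟦μ⟧ u v)))))))
      ; μ-comm = λ u v → A².⟦⟧-inj (trans (⟦μ⟧ u v) (trans (L.*-comm ⟦ u ⟧ᴬ ⟦ v ⟧ᴬ) (sym (⟦μ⟧ v u))))
      ; μ-zero = μ-zero ; μ-norm = μ-norm ; μ-sidon = μ-sidon }

open import Data.Nat using (_≤_; _<_; _*_; _∸_)

theorem5p2 : (L : Field) (F : Pred L) → IsSubfield L F → IsFinite L F →
    (A : Pred L) → IsSubspace L F A → IsSidon L F A →
    (n : ℕ) → HasDim L F A n → 3 ≤ n →
    (m : ℕ) → HasDim L F (Sq L F A) m → 2 * n ∸ 1 < m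
theorem5p2 L F isSubfield isFinite A isSubspace isSidon n dimA 3≤n m dimSq =
  -- The conclusion compares two natural numbers, so it is stable under double negation and a doubly
  -- negated model of F is enough.
  Dec.decidable-stable (2 * n ∸ 1 ℕ.<? m) λ m≤2n-1 →
    finiteModel L F isSubfield isFinite λ X →
      m≤2n-1 (ℕP.<-≤-trans (pred< n 3≤n)
        (sidon-product-bound (FiniteModel.𝔽 X) (FiniteModel.E X) (sidonProduct L F isSubfield X A isSubspace isSidon dimA dimSq) 3≤n))
  where
  pred< : ∀ n → 3 ≤ n → 2 * n ∸ 1 < 2 * n
  pred< (suc n) _ = ℕP.≤-refl
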